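{- Fix a prime $q$. For primes $p\neq q$ let $f_q(p)$ be the multiplicative order of $q$ modulo $p$ and let $t_p=\dfrac{p-1}{f_q(p)}$. Let $\psi$ be the completely multiplicative function on the positive integers with $\psi(p)=e^{2\pi i/t_p}=e^{2\pi i f_q(p)/(p-1)}$ for primes $p\ne q$ and $\psi(q)=0$. Let $k$ be a positive integer, and let $\psi^k$ denote the function $m\mapsto\psi(m)^k$. If the limit $M(\psi^k)=\lim_{n\to\infty}\frac1n\sum_{m\le n}\psi(m)^k$ does not exist, or exists and is zero, then the set $$S_k=\{p \text{ prime},\ p\ne q \ :\ t_p\nmid k\}$$ is infinite.
   Context: A completely multiplicative function is determined by its values at primes, with value $1$ at $1$. The number $t_p$ is a positive integer since $f_q(p)$ divides $p-1$. -}

module Defs where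

open import Data.Fin.Base as Fin using (Fin; toℕ)
import Data.Fin.Properties as Fin
open import Data.Integer.Base as ℤ using (+_)
import Data.Integer.Properties as ℤ
open import Data.List.Base using (List)
open import Data.List.Membership.Propositional using (_∈_)
open import Data.Nat.Base as ℕ using (ℕ; zero; suc; _∸_; NonZero; z≤n; s≤s)
open import Data.Nat.Divisibility
open import Data.Nat.DivMod using (_%_; m%n<n; m≥n⇒m/n>0)
open import Data.Nat.Primality
import Data.Nat.Properties as ℕ
import Data.Nat.Solver as ℕSolver
open import Data.Product.Base using (Σ-syntax; ∃; _×_; _,_; proj₁; proj₂)
open import Data.Rational.Base as ℚ using (ℚ; 0ℚ; 1ℚ; ½; mkℚ; _/_; toℚᵘ)
import Data.Rational.Properties as ℚ
import Data.Rational.Solver as ℚSolver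
open import Data.Rational.Unnormalised.Base as ℚᵘ using (mkℚᵘ; *≡*; *≤*)
import Data.Rational.Unnormalised.Properties as ℚᵘ
open import Data.Sum.Base using (inj₁; inj₂)
open import Relation.Binary.PropositionalEquality
open import Relation.Nullary using (¬_; yes; no; contradiction)
open import Relation.Unary using (Pred; Decidable)
open import Level using (0ℓ)

private

  abs-sub-comm : ∀ a b → ℚ.∣ a ℚ.- b ∣ ≡ ℚ.∣ b ℚ.- a ∣
  abs-sub-comm a b = trans (cong ℚ.∣_∣ (lem a b)) (ℚ.∣-p∣≡∣p∣ (b ℚ.- a))
    where
    open ℚSolver.+-*-Solver
    lem : ∀ a b → a ℚ.- b ≡ ℚ.- (b ℚ.- a)
    lem = solve 2 (λ a b → a :- b := :- (b :- a)) refl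

  add-lemma : ∀ a b c d → (a ℚ.+ b) ℚ.- (c ℚ.+ d) ≡ (a ℚ.- c) ℚ.+ (b ℚ.- d)
  add-lemma = solve 4 (λ a b c d → (a :+ b) :- (c :+ d) := (a :- c) :+ (b :- d)) refl
    where open ℚSolver.+-*-Solver

  mul-lemma : ∀ a b c d → (a ℚ.* b) ℚ.- (c ℚ.* d) ≡ a ℚ.* (b ℚ.- d) ℚ.+ d ℚ.* (a ℚ.- c)
  mul-lemma = solve 4 (λ a b c d → (a :* b) :- (c :* d) := a :* (b :- d) :+ d :* (a :- c)) refl
    where open ℚSolver.+-*-Solver

  neg-lemma : ∀ a b → (ℚ.- a) ℚ.- (ℚ.- b) ≡ ℚ.- (a ℚ.- b)
  neg-lemma = solve 2 (λ a b → (:- a) :- (:- b) := :- (a :- b)) refl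
    where open ℚSolver.+-*-Solver

  half+half : ∀ a → ½ ℚ.* a ℚ.+ ½ ℚ.* a ≡ a
  half+half a = trans (sym (ℚ.*-distribʳ-+ a ½ ½)) (ℚ.*-identityˡ a)

  half>0 : ∀ {ε} → 0ℚ ℚ.< ε → 0ℚ ℚ.< ½ ℚ.* ε
  half>0 {ε} ε>0 = subst (ℚ._< ½ ℚ.* ε) (ℚ.*-zeroʳ ½) (ℚ.*-monoʳ-<-pos ½ ε>0)

  abs≤ : ∀ {a b} → a ℚ.≤ b → ℚ.- a ℚ.≤ b → ℚ.∣ a ∣ ℚ.≤ b
  abs≤ {a} {b} p q with ℚ.∣p∣≡p∨∣p∣≡-p a
  ... | inj₁ e = subst (ℚ._≤ b) (sym e) p
  ... | inj₂ e = subst (ℚ._≤ b) (sym e) q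

  sub≤ : ∀ {a b c} → a ℚ.≤ b ℚ.+ c → a ℚ.- b ℚ.≤ c
  sub≤ {a} {b} {c} p = subst (a ℚ.- b ℚ.≤_) (lem b c) (ℚ.+-monoˡ-≤ (ℚ.- b) p)
    where
    open ℚSolver.+-*-Solver
    lem : ∀ b c → b ℚ.+ c ℚ.- b ≡ c
    lem = solve 2 (λ b c → b :+ c :- b := c) refl

  split : ∀ a b → a ≡ b ℚ.+ (a ℚ.- b)
  split = solve 2 (λ a b → a := b :+ (a :- b)) refl
    where open ℚSolver.+-*-Solver

  abs-abs : ∀ a b → ℚ.∣ ℚ.∣ a ∣ ℚ.- ℚ.∣ b ∣ ∣ ℚ.≤ ℚ.∣ a ℚ.- b ∣
  abs-abs a b = abs≤ (one a b) (subst₂ ℚ._≤_ (lem ℚ.∣ b ∣ ℚ.∣ a ∣) (abs-sub-comm b a) (one b a))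
    where
    open ℚSolver.+-*-Solver
    lem : ∀ x y → x ℚ.- y ≡ ℚ.- (y ℚ.- x)
    lem = solve 2 (λ x y → x :- y := :- (y :- x)) refl
    one : ∀ x y → ℚ.∣ x ∣ ℚ.- ℚ.∣ y ∣ ℚ.≤ ℚ.∣ x ℚ.- y ∣
    one x y = sub≤ (subst (λ z → ℚ.∣ z ∣ ℚ.≤ ℚ.∣ y ∣ ℚ.+ ℚ.∣ x ℚ.- y ∣) (sym (split x y))
      (ℚ.∣p+q∣≤∣p∣+∣q∣ y (x ℚ.- y)))

-- ℝ is the Cauchy completion of ℚ, as a setoid under _≈ℝ_.
Cauchy : (ℕ → ℚ) → Set
Cauchy x = ∀ ε → 0ℚ ℚ.< ε →
  ∃ λ N → ∀ m n → N ℕ.≤ m → N ℕ.≤ n → ℚ.∣ x m ℚ.- x n ∣ ℚ.< ε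

record ℝ : Set where
  constructor mkℝ
  field
    seq    : ℕ → ℚ
    cauchy : Cauchy seq

open ℝ public

infix 4 _≈ℝ_ _<ℝ_

_≈ℝ_ : ℝ → ℝ → Set
x ≈ℝ y = ∀ ε → 0ℚ ℚ.< ε → ∃ λ N → ∀ n → N ℕ.≤ n → ℚ.∣ seq x n ℚ.- seq y n ∣ ℚ.< ε

_<ℝ_ : ℝ → ℝ → Set
x <ℝ y = Σ[ δ ∈ ℚ ] 0ℚ ℚ.< δ × ∃ λ N → ∀ n → N ℕ.≤ n → seq x n ℚ.+ δ ℚ.< seq y n

fromℚ : ℚ → ℝ
fromℚ a = mkℝ (λ _ → a) λ ε ε>0 → 0 , λ _ _ _ _ →
  subst (ℚ._< ε) (cong ℚ.∣_∣ (sym (ℚ.+-inverseʳ a))) ε>0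

private

  abstract
    Cauchy-+ : ∀ {x y} → Cauchy x → Cauchy y → Cauchy (λ n → x n ℚ.+ y n)
    Cauchy-+ {x} {y} cx cy ε ε>0 with cx (½ ℚ.* ε) (half>0 ε>0) | cy (½ ℚ.* ε) (half>0 ε>0)
    ... | N , p | M , q = N ℕ.⊔ M , λ m n l k → begin-strict
      ℚ.∣ (x m ℚ.+ y m) ℚ.- (x n ℚ.+ y n) ∣     ≡⟨ cong ℚ.∣_∣ (add-lemma (x m) (y m) (x n) (y n)) ⟩
      ℚ.∣ (x m ℚ.- x n) ℚ.+ (y m ℚ.- y n) ∣     ≤⟨ ℚ.∣p+q∣≤∣p∣+∣q∣ (x m ℚ.- x n) (y m ℚ.- y n) ⟩
      ℚ.∣ x m ℚ.- x n ∣ ℚ.+ ℚ.∣ y m ℚ.- y n ∣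
        <⟨ ℚ.+-mono-< (p m n (ℕ.m⊔n≤o⇒m≤o N M l) (ℕ.m⊔n≤o⇒m≤o N M k))
                      (q m n (ℕ.m⊔n≤o⇒n≤o N M l) (ℕ.m⊔n≤o⇒n≤o N M k)) ⟩
      ½ ℚ.* ε ℚ.+ ½ ℚ.* ε                       ≡⟨ half+half ε ⟩
      ε                                         ∎
      where open ℚ.≤-Reasoning

  abstract
    Cauchy-neg : ∀ {x} → Cauchy x → Cauchy (λ n → ℚ.- x n)
    Cauchy-neg {x} cx ε ε>0 with cx ε ε>0
    ... | N , p = N , λ m n l k → subst (ℚ._< ε)
      (sym (trans (cong ℚ.∣_∣ (neg-lemma (x m) (x n))) (ℚ.∣-p∣≡∣p∣ (x m ℚ.- x n)))) (p m n l k)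

  abstract
    Cauchy-abs : ∀ {x} → Cauchy x → Cauchy (λ n → ℚ.∣ x n ∣)
    Cauchy-abs {x} cx ε ε>0 with cx ε ε>0
    ... | N , p = N , λ m n l k → ℚ.≤-<-trans (abs-abs (x m) (x n)) (p m n l k)

  tailBound : ∀ {x} → Cauchy x →
    Σ[ B ∈ ℚ ] 0ℚ ℚ.< B × ∃ λ N → ∀ n → N ℕ.≤ n → ℚ.∣ x n ∣ ℚ.≤ B
  tailBound {x} cx with cx 1ℚ (ℚ.positive⁻¹ 1ℚ)
  ... | N , p = ℚ.∣ x N ∣ ℚ.+ 1ℚ , B>0 , N , λ n l → begin
    ℚ.∣ x n ∣                             ≡⟨ cong ℚ.∣_∣ (split (x n) (x N)) ⟩
    ℚ.∣ x N ℚ.+ (x n ℚ.- x N) ∣           ≤⟨ ℚ.∣p+q∣≤∣p∣+∣q∣ (x N) (x n ℚ.- x N) ⟩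
    ℚ.∣ x N ∣ ℚ.+ ℚ.∣ x n ℚ.- x N ∣       ≤⟨ ℚ.+-monoʳ-≤ ℚ.∣ x N ∣ (ℚ.<⇒≤ (p n N l ℕ.≤-refl)) ⟩
    ℚ.∣ x N ∣ ℚ.+ 1ℚ                      ∎
    where
    open ℚ.≤-Reasoning
    B>0 : 0ℚ ℚ.< ℚ.∣ x N ∣ ℚ.+ 1ℚ
    B>0 = ℚ.+-mono-≤-< (ℚ.0≤∣p∣ (x N)) (ℚ.positive⁻¹ 1ℚ)

  scale : ∀ B ε → 0ℚ ℚ.< B → 0ℚ ℚ.< ε → Σ[ δ ∈ ℚ ] 0ℚ ℚ.< δ × B ℚ.* δ ≡ ε
  scale B ε B>0 ε>0 = ε ℚ.* ℚ.1/ B , δ>0 , Bδ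
    where
    instance
      B⁺ : ℚ.Positive B
      B⁺ = ℚ.positive B>0
      B≢0 : ℚ.NonZero B
      B≢0 = ℚ.pos⇒nonZero B
      1/B⁺ : ℚ.Positive (ℚ.1/ B)
      1/B⁺ = ℚ.1/pos⇒pos B
    δ>0 : 0ℚ ℚ.< ε ℚ.* ℚ.1/ B
    δ>0 = subst (ℚ._< ε ℚ.* ℚ.1/ B) (ℚ.*-zeroˡ (ℚ.1/ B)) (ℚ.*-monoˡ-<-pos (ℚ.1/ B) ε>0)
    Bδ : B ℚ.* (ε ℚ.* ℚ.1/ B) ≡ ε
    Bδ = trans (ℚ.*-comm B (ε ℚ.* ℚ.1/ B)) (trans (ℚ.*-assoc ε (ℚ.1/ B) B)
         (trans (cong (ε ℚ.*_) (ℚ.*-inverseˡ B)) (ℚ.*-identityʳ ε)))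

  prod< : ∀ {B δ ε} a d → 0ℚ ℚ.< B → B ℚ.* δ ≡ ε →
    ℚ.∣ a ∣ ℚ.≤ B → ℚ.∣ d ∣ ℚ.< δ → ℚ.∣ a ℚ.* d ∣ ℚ.< ε
  prod< {B} {δ} {ε} a d B>0 Bδ p q = begin-strict
    ℚ.∣ a ℚ.* d ∣           ≡⟨ ℚ.∣p*q∣≡∣p∣*∣q∣ a d ⟩
    ℚ.∣ a ∣ ℚ.* ℚ.∣ d ∣     ≤⟨ ℚ.*-monoʳ-≤-nonNeg ℚ.∣ d ∣ {{ℚ.∣-∣-nonNeg d}} p ⟩
    B ℚ.* ℚ.∣ d ∣           <⟨ ℚ.*-monoʳ-<-pos B {{ℚ.positive B>0}} q ⟩
    B ℚ.* δ                 ≡⟨ Bδ ⟩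
    ε                       ∎
    where open ℚ.≤-Reasoning

  mul< : ∀ {A B α β ε} a b c d → 0ℚ ℚ.< A → 0ℚ ℚ.< B →
    A ℚ.* β ≡ ½ ℚ.* ε → B ℚ.* α ≡ ½ ℚ.* ε →
    ℚ.∣ a ∣ ℚ.≤ A → ℚ.∣ d ∣ ℚ.≤ B → ℚ.∣ a ℚ.- c ∣ ℚ.< α → ℚ.∣ b ℚ.- d ∣ ℚ.< β →
    ℚ.∣ a ℚ.* b ℚ.- c ℚ.* d ∣ ℚ.< ε
  mul< {ε = ε} a b c d A>0 B>0 Aβ Bα a≤A d≤B a-c b-d = begin-strict
    ℚ.∣ a ℚ.* b ℚ.- c ℚ.* d ∣
      ≡⟨ cong ℚ.∣_∣ (mul-lemma a b c d) ⟩
    ℚ.∣ a ℚ.* (b ℚ.- d) ℚ.+ d ℚ.* (a ℚ.- c) ∣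
      ≤⟨ ℚ.∣p+q∣≤∣p∣+∣q∣ (a ℚ.* (b ℚ.- d)) (d ℚ.* (a ℚ.- c)) ⟩
    ℚ.∣ a ℚ.* (b ℚ.- d) ∣ ℚ.+ ℚ.∣ d ℚ.* (a ℚ.- c) ∣
      <⟨ ℚ.+-mono-< (prod< a (b ℚ.- d) A>0 Aβ a≤A b-d) (prod< d (a ℚ.- c) B>0 Bα d≤B a-c) ⟩
    ½ ℚ.* ε ℚ.+ ½ ℚ.* ε
      ≡⟨ half+half ε ⟩
    ε ∎
    where open ℚ.≤-Reasoning

  TailBound : (ℕ → ℚ) → Set
  TailBound x = Σ[ B ∈ ℚ ] 0ℚ ℚ.< B × ∃ λ N → ∀ n → N ℕ.≤ n → ℚ.∣ x n ∣ ℚ.≤ B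

  Within : (ℕ → ℚ) → ℚ → Set
  Within x ε = ∃ λ N → ∀ m n → N ℕ.≤ m → N ℕ.≤ n → ℚ.∣ x m ℚ.- x n ∣ ℚ.< ε

  abstract
    Cauchy-* : ∀ {x y} → Cauchy x → Cauchy y → Cauchy (λ n → x n ℚ.* y n)
    Cauchy-* {x} {y} cx cy ε ε>0 = step₁ (tailBound {x} cx) (tailBound {y} cy)
      where
      step₃ : ∀ A B α β → 0ℚ ℚ.< A → 0ℚ ℚ.< B → A ℚ.* β ≡ ½ ℚ.* ε → B ℚ.* α ≡ ½ ℚ.* ε →
        (∃ λ N → ∀ n → N ℕ.≤ n → ℚ.∣ x n ∣ ℚ.≤ A) → (∃ λ N → ∀ n → N ℕ.≤ n → ℚ.∣ y n ∣ ℚ.≤ B) →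
        Within x α → Within y β → Within (λ n → x n ℚ.* y n) ε
      step₃ A B α β A>0 B>0 Aβ Bα (K , a) (L , b) (N , p) (M , q) = (N ℕ.⊔ M) ℕ.⊔ (K ℕ.⊔ L) , λ m n l k →
        let l₁ = ℕ.m⊔n≤o⇒m≤o (N ℕ.⊔ M) (K ℕ.⊔ L) l
            l₂ = ℕ.m⊔n≤o⇒n≤o (N ℕ.⊔ M) (K ℕ.⊔ L) l
            k₁ = ℕ.m⊔n≤o⇒m≤o (N ℕ.⊔ M) (K ℕ.⊔ L) k
            k₂ = ℕ.m⊔n≤o⇒n≤o (N ℕ.⊔ M) (K ℕ.⊔ L) k
        in mul< (x m) (y m) (x n) (y n) A>0 B>0 Aβ Bα
             (a m (ℕ.m⊔n≤o⇒m≤o K L l₂)) (b n (ℕ.m⊔n≤o⇒n≤o K L k₂))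
             (p m n (ℕ.m⊔n≤o⇒m≤o N M l₁) (ℕ.m⊔n≤o⇒m≤o N M k₁))
             (q m n (ℕ.m⊔n≤o⇒n≤o N M l₁) (ℕ.m⊔n≤o⇒n≤o N M k₁))

      step₂ : ∀ A B → 0ℚ ℚ.< A → 0ℚ ℚ.< B →
        (∃ λ N → ∀ n → N ℕ.≤ n → ℚ.∣ x n ∣ ℚ.≤ A) → (∃ λ N → ∀ n → N ℕ.≤ n → ℚ.∣ y n ∣ ℚ.≤ B) →
        (Σ[ δ ∈ ℚ ] 0ℚ ℚ.< δ × A ℚ.* δ ≡ ½ ℚ.* ε) → (Σ[ δ ∈ ℚ ] 0ℚ ℚ.< δ × B ℚ.* δ ≡ ½ ℚ.* ε) →
        Within (λ n → x n ℚ.* y n) ε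
      step₂ A B A>0 B>0 a b (β , β>0 , Aβ) (α , α>0 , Bα) =
        step₃ A B α β A>0 B>0 Aβ Bα a b (cx α α>0) (cy β β>0)

      step₁ : TailBound x → TailBound y → Within (λ n → x n ℚ.* y n) ε
      step₁ (A , A>0 , a) (B , B>0 , b) = step₂ A B A>0 B>0 a b
        (scale A (½ ℚ.* ε) A>0 (half>0 ε>0)) (scale B (½ ℚ.* ε) B>0 (half>0 ε>0))

infixl 6 _+ℝ_ _-ℝ_
infixl 7 _*ℝ_
infix  8 -ℝ_

_+ℝ_ _*ℝ_ : ℝ → ℝ → ℝ
x +ℝ y = mkℝ (λ n → seq x n ℚ.+ seq y n) (Cauchy-+ {seq x} {seq y} (cauchy x) (cauchy y))
x *ℝ y = mkℝ (λ n → seq x n ℚ.* seq y n) (Cauchy-* {seq x} {seq y} (cauchy x) (cauchy y))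

-ℝ_ : ℝ → ℝ
-ℝ x = mkℝ (λ n → ℚ.- seq x n) (Cauchy-neg {seq x} (cauchy x))

∣_∣ℝ : ℝ → ℝ
∣ x ∣ℝ = mkℝ (λ n → ℚ.∣ seq x n ∣) (Cauchy-abs {seq x} (cauchy x))

_-ℝ_ : ℝ → ℝ → ℝ
x -ℝ y = x +ℝ (-ℝ y)

infix 4 _⟶ℝ_

_⟶ℝ_ : (ℕ → ℝ) → ℝ → Set
u ⟶ℝ l = ∀ ε → 0ℚ ℚ.< ε → ∃ λ N → ∀ n → N ℕ.≤ n → ∣ u n -ℝ l ∣ℝ <ℝ fromℚ ε

∑ℚ : ℕ → (ℕ → ℚ) → ℚ
∑ℚ zero    f = 0ℚ
∑ℚ (suc n) f = ∑ℚ n f ℚ.+ f n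

-- π = ∫₀¹ 4/(1+x²) dx, as the limit of the left Riemann sums
-- (1/n) Σ_{k<n} 4/(1+(k/n)²) = Σ_{k<n} 4n/(n²+k²), with n = suc n′.
riemannTerm : ℕ → ℕ → ℚ
riemannTerm n′ k = let n = suc n′ in + (4 ℕ.* n) / (n ℕ.* n ℕ.+ k ℕ.* k)

riemannSum : ℕ → ℚ
riemannSum n′ = ∑ℚ (suc n′) (riemannTerm n′)

private

  toℚᵘ-/ : ∀ a b → toℚᵘ (+ a / suc b) ℚᵘ.≃ mkℚᵘ (+ a) b
  toℚᵘ-/ a b = ℚ.toℚᵘ-fromℚᵘ (mkℚᵘ (+ a) b)

  frac≤ : ∀ a b c d .{{_ : NonZero b}} .{{_ : NonZero d}} →
    a ℕ.* d ℕ.≤ c ℕ.* b → + a / b ℚ.≤ + c / d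
  frac≤ a b@(suc b′) c d@(suc d′) p = ℚ.toℚᵘ-cancel-≤ (begin
    toℚᵘ (+ a / b)    ≃⟨ toℚᵘ-/ a b′ ⟩
    mkℚᵘ (+ a) b′     ≤⟨ *≤* (subst₂ ℤ._≤_ (ℤ.pos-* a d) (ℤ.pos-* c b) (ℤ.+≤+ p)) ⟩
    mkℚᵘ (+ c) d′     ≃⟨ toℚᵘ-/ c d′ ⟨
    toℚᵘ (+ c / d)    ∎)
    where open ℚᵘ.≤-Reasoning

  suc/1 : ∀ n → + suc n / 1 ≡ + n / 1 ℚ.+ 1ℚ
  suc/1 n = ℚ.toℚᵘ-injective (begin
    toℚᵘ (+ suc n / 1)                ≈⟨ toℚᵘ-/ (suc n) 0 ⟩
    mkℚᵘ (+ suc n) 0                  ≈⟨ *≡* (cong (ℤ._* + 1) lem) ⟩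
    mkℚᵘ (+ n) 0 ℚᵘ.+ ℚᵘ.1ℚᵘ          ≈⟨ ℚᵘ.+-congˡ ℚᵘ.1ℚᵘ (toℚᵘ-/ n 0) ⟨
    toℚᵘ (+ n / 1) ℚᵘ.+ toℚᵘ 1ℚ       ≈⟨ ℚ.toℚᵘ-homo-+ (+ n / 1) 1ℚ ⟨
    toℚᵘ (+ n / 1 ℚ.+ 1ℚ)             ∎)
    where
    open import Relation.Binary.Reasoning.Setoid ℚᵘ.≃-setoid
    lem : + suc n ≡ + n ℤ.* + 1 ℤ.+ + 1
    lem = sym (trans (cong (ℤ._+ + 1) (ℤ.*-identityʳ (+ n))) (cong +_ (ℕ.+-comm n 1)))

  mulFrac : ∀ m a b .{{_ : NonZero b}} →
    + suc m / 1 ℚ.* (+ a / (suc m ℕ.* b)) {{ℕ.m*n≢0 (suc m) b}} ≡ + a / b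
  mulFrac m a b@(suc b′) = ℚ.toℚᵘ-injective (begin
    toℚᵘ (+ M / 1 ℚ.* (+ a / (M ℕ.* b)))                 ≈⟨ ℚ.toℚᵘ-homo-* (+ M / 1) (+ a / (M ℕ.* b)) ⟩
    toℚᵘ (+ M / 1) ℚᵘ.* toℚᵘ (+ a / (M ℕ.* b))           ≈⟨ ℚᵘ.*-cong (toℚᵘ-/ M 0) (toℚᵘ-/ a _) ⟩
    mkℚᵘ (+ M) 0 ℚᵘ.* mkℚᵘ (+ a) (b′ ℕ.+ m ℕ.* b)        ≈⟨ *≡* lem ⟩
    mkℚᵘ (+ a) b′                                        ≈⟨ toℚᵘ-/ a b′ ⟨
    toℚᵘ (+ a / b)                                       ∎)
    where
    open import Relation.Binary.Reasoning.Setoid ℚᵘ.≃-setoid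
    M = suc m
    lemℕ : ∀ M a b → (M ℕ.* a) ℕ.* b ≡ a ℕ.* (1 ℕ.* (M ℕ.* b))
    lemℕ = solve 3 (λ M a b → (M :* a) :* b := a :* (con 1 :* (M :* b))) refl
      where open ℕSolver.+-*-Solver
    lem : (+ M ℤ.* + a) ℤ.* + b ≡ + a ℤ.* + (1 ℕ.* (M ℕ.* b))
    lem = trans (cong (ℤ._* + b) (sym (ℤ.pos-* M a)))
          (trans (sym (ℤ.pos-* (M ℕ.* a) b))
          (trans (cong +_ (lemℕ M a b)) (ℤ.pos-* a (1 ℕ.* (M ℕ.* b)))))

  ∑-mono : ∀ n {f g} → (∀ k → k ℕ.< n → f k ℚ.≤ g k) → ∑ℚ n f ℚ.≤ ∑ℚ n g
  ∑-mono zero    p = ℚ.≤-refl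
  ∑-mono (suc n) p = ℚ.+-mono-≤ (∑-mono n λ k l → p k (ℕ.m<n⇒m<1+n l)) (p n ℕ.≤-refl)

  ∑-const : ∀ n c → ∑ℚ n (λ _ → c) ≡ + n / 1 ℚ.* c
  ∑-const zero    c = sym (ℚ.*-zeroˡ c)
  ∑-const (suc n) c = begin
    ∑ℚ n (λ _ → c) ℚ.+ c              ≡⟨ cong₂ ℚ._+_ (∑-const n c) (sym (ℚ.*-identityˡ c)) ⟩
    + n / 1 ℚ.* c ℚ.+ 1ℚ ℚ.* c        ≡⟨ ℚ.*-distribʳ-+ c (+ n / 1) 1ℚ ⟨
    (+ n / 1 ℚ.+ 1ℚ) ℚ.* c            ≡⟨ cong (ℚ._* c) (suc/1 n) ⟨
    + suc n / 1 ℚ.* c                 ∎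
    where open ≡-Reasoning

  ∑-append : ∀ n m f → ∑ℚ (n ℕ.+ m) f ≡ ∑ℚ n f ℚ.+ ∑ℚ m (λ l → f (n ℕ.+ l))
  ∑-append n zero    f = trans (cong (λ z → ∑ℚ z f) (ℕ.+-identityʳ n)) (sym (ℚ.+-identityʳ _))
  ∑-append n (suc m) f = trans (cong (λ z → ∑ℚ z f) (ℕ.+-suc n m))
    (trans (cong (ℚ._+ f (n ℕ.+ m)) (∑-append n m f)) (ℚ.+-assoc (∑ℚ n f) _ _))

  ∑-blocks : ∀ n m f → ∑ℚ (n ℕ.* m) f ≡ ∑ℚ n (λ k → ∑ℚ m (λ l → f (k ℕ.* m ℕ.+ l)))
  ∑-blocks zero    m f = refl
  ∑-blocks (suc n) m f = trans (cong (λ z → ∑ℚ z f) (ℕ.+-comm m (n ℕ.* m)))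
    (trans (∑-append (n ℕ.* m) m f) (cong (ℚ._+ ∑ℚ m (λ l → f (n ℕ.* m ℕ.+ l))) (∑-blocks n m f)))

  ∑-shift : ∀ n f → f 0 ℚ.+ ∑ℚ n (λ k → f (suc k)) ≡ ∑ℚ n f ℚ.+ f n
  ∑-shift zero    f = ℚ.+-comm (f 0) 0ℚ
  ∑-shift (suc n) f = trans (sym (ℚ.+-assoc (f 0) _ _)) (cong (ℚ._+ f (suc n)) (∑-shift n f))

  refine : ℕ → ℕ → ℕ
  refine n m = m ℕ.+ n ℕ.* suc m

  module _ (n m : ℕ) where
    private
      N = suc n
      M = suc m
      D : ℕ → ℕ
      D k = N ℕ.* N ℕ.+ k ℕ.* k

      instance
        MD≢0 : ∀ {k} → NonZero (M ℕ.* D k)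
        MD≢0 {k} = ℕ.m*n≢0 M (D k)

      fine : ℕ → ℕ → ℚ
      fine k l = riemannTerm (refine n m) (k ℕ.* M ℕ.+ l)

      fineD : ℕ → ℕ → ℕ
      fineD k l = (N ℕ.* M) ℕ.* (N ℕ.* M) ℕ.+ (k ℕ.* M ℕ.+ l) ℕ.* (k ℕ.* M ℕ.+ l)

      lhs : ∀ N M k → (4 ℕ.* (N ℕ.* M)) ℕ.* (M ℕ.* (N ℕ.* N ℕ.+ k ℕ.* k))
                    ≡ (4 ℕ.* N) ℕ.* ((N ℕ.* M) ℕ.* (N ℕ.* M) ℕ.+ (k ℕ.* M) ℕ.* (k ℕ.* M))
      lhs = solve 3 (λ N M k → (con 4 :* (N :* M)) :* (M :* (N :* N :+ k :* k))
             := (con 4 :* N) :* ((N :* M) :* (N :* M) :+ (k :* M) :* (k :* M))) refl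
        where open ℕSolver.+-*-Solver

      upper : ∀ k l → fine k l ℚ.≤ + (4 ℕ.* N) / (M ℕ.* D k)
      upper k l = frac≤ (4 ℕ.* (N ℕ.* M)) _ (4 ℕ.* N) (M ℕ.* D k)
        (subst (ℕ._≤ (4 ℕ.* N) ℕ.* fineD k l) (sym (lhs N M k)) (ℕ.*-monoʳ-≤ (4 ℕ.* N)
          (ℕ.+-monoʳ-≤ ((N ℕ.* M) ℕ.* (N ℕ.* M)) (ℕ.*-mono-≤ (ℕ.m≤m+n (k ℕ.* M) l) (ℕ.m≤m+n (k ℕ.* M) l)))))

      lower : ∀ k l → l ℕ.< M → + (4 ℕ.* N) / (M ℕ.* D (suc k)) ℚ.≤ fine k l
      lower k l l<M = frac≤ (4 ℕ.* N) (M ℕ.* D (suc k)) (4 ℕ.* (N ℕ.* M)) _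
        (subst ((4 ℕ.* N) ℕ.* fineD k l ℕ.≤_) (sym (lhs N M (suc k))) (ℕ.*-monoʳ-≤ (4 ℕ.* N)
          (ℕ.+-monoʳ-≤ ((N ℕ.* M) ℕ.* (N ℕ.* M)) (ℕ.*-mono-≤ le le))))
        where
        le : k ℕ.* M ℕ.+ l ℕ.≤ suc k ℕ.* M
        le = subst (k ℕ.* M ℕ.+ l ℕ.≤_) (ℕ.+-comm (k ℕ.* M) M) (ℕ.+-monoʳ-≤ (k ℕ.* M) (ℕ.<⇒≤ l<M))

      ∑-frac : ∀ k → ∑ℚ M (λ _ → + (4 ℕ.* N) / (M ℕ.* D k)) ≡ riemannTerm n k
      ∑-frac k = trans (∑-const M _) (mulFrac m (4 ℕ.* N) (D k))

      blocks : riemannSum (refine n m) ≡ ∑ℚ N (λ k → ∑ℚ M (fine k))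
      blocks = ∑-blocks N M (riemannTerm (refine n m))

    refine≤ : riemannSum (refine n m) ℚ.≤ riemannSum n
    refine≤ = subst (ℚ._≤ riemannSum n) (sym blocks) (∑-mono N λ k _ →
      subst (∑ℚ M (fine k) ℚ.≤_) (∑-frac k) (∑-mono M λ l _ → upper k l))

    refine≥ : riemannSum n ℚ.≤ riemannSum (refine n m) ℚ.+ riemannTerm n 0
    refine≥ = begin
      riemannSum n
        ≡⟨ ℚ.+-identityʳ (riemannSum n) ⟨
      riemannSum n ℚ.+ 0ℚ
        ≤⟨ ℚ.+-monoʳ-≤ (riemannSum n) (frac≤ 0 1 (4 ℕ.* N) (D N) z≤n) ⟩
      riemannSum n ℚ.+ riemannTerm n N
        ≡⟨ ∑-shift N (riemannTerm n) ⟨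
      riemannTerm n 0 ℚ.+ ∑ℚ N (λ k → riemannTerm n (suc k))
        ≤⟨ ℚ.+-monoʳ-≤ (riemannTerm n 0) (∑-mono N λ k _ →
             subst (ℚ._≤ ∑ℚ M (fine k)) (∑-frac (suc k)) (∑-mono M (lower k))) ⟩
      riemannTerm n 0 ℚ.+ ∑ℚ N (λ k → ∑ℚ M (fine k))
        ≡⟨ cong (riemannTerm n 0 ℚ.+_) blocks ⟨
      riemannTerm n 0 ℚ.+ riemannSum (refine n m)
        ≡⟨ ℚ.+-comm (riemannTerm n 0) _ ⟩
      riemannSum (refine n m) ℚ.+ riemannTerm n 0 ∎
      where open ℚ.≤-Reasoning

  refine-comm : ∀ n m → refine n m ≡ refine m n
  refine-comm n m = ℕ.suc-injective (ℕ.*-comm (suc n) (suc m))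

  riemann-step : ∀ n m → riemannSum n ℚ.- riemannSum m ℚ.≤ riemannTerm n 0
  riemann-step n m = sub≤ (ℚ.≤-trans (refine≥ n m) (ℚ.+-monoˡ-≤ (riemannTerm n 0)
    (subst (λ z → riemannSum z ℚ.≤ riemannSum m) (refine-comm m n) (refine≤ m n))))

  smallTerm : ∀ ε → 0ℚ ℚ.< ε → ∃ λ N → ∀ n → N ℕ.≤ n → riemannTerm n 0 ℚ.< ε
  smallTerm (mkℚ (+ zero) d c) ε>0 = contradiction ε>0 λ { (ℚ.*<* (ℤ.+<+ ())) }
  smallTerm (mkℚ ℤ.-[1+ a ] d c) ε>0 = contradiction ε>0 λ { (ℚ.*<* ()) }
  smallTerm ε@(mkℚ ℤ.+[1+ a ] d c) _ = 4 ℕ.* suc d , λ n l →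
    ℚ.toℚᵘ-cancel-< (bound n l)
    where
    open ℚᵘ.≤-Reasoning
    lem : ∀ d n → 4 ℕ.* suc d ℕ.≤ n → 4 ℕ.* suc n ℕ.* suc d ℕ.< suc a ℕ.* (suc n ℕ.* suc n ℕ.+ 0)
    lem d n l = ℕ.<-≤-trans
      (subst₂ ℕ._<_ (e (suc n) (suc d)) (sym (ℕ.+-identityʳ _)) (ℕ.*-monoʳ-< (suc n) (s≤s l)))
      (ℕ.m≤m+n (suc n ℕ.* suc n ℕ.+ 0) _)
      where
      e : ∀ n d → n ℕ.* (4 ℕ.* d) ≡ 4 ℕ.* n ℕ.* d
      e = solve 2 (λ n d → n :* (con 4 :* d) := con 4 :* n :* d) refl
        where open ℕSolver.+-*-Solver
    bound : ∀ n → 4 ℕ.* suc d ℕ.≤ n → toℚᵘ (riemannTerm n 0) ℚᵘ.< toℚᵘ ε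
    bound n l = begin-strict
      toℚᵘ (riemannTerm n 0)                   ≃⟨ toℚᵘ-/ (4 ℕ.* suc n) _ ⟩
      mkℚᵘ (+ (4 ℕ.* suc n)) (n ℕ.+ n ℕ.* suc n ℕ.+ 0)
        <⟨ ℚᵘ.*<* (subst₂ ℤ._<_ (ℤ.pos-* (4 ℕ.* suc n) (suc d))
                   (ℤ.pos-* (suc a) (suc n ℕ.* suc n ℕ.+ 0)) (ℤ.+<+ (lem d n l))) ⟩
      toℚᵘ ε                                   ∎

  abs-sub< : ∀ a b {ε} → a ℚ.- b ℚ.< ε → b ℚ.- a ℚ.< ε → ℚ.∣ a ℚ.- b ∣ ℚ.< ε
  abs-sub< a b {ε} p q with ℚ.∣p∣≡p∨∣p∣≡-p (a ℚ.- b)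
  ... | inj₁ e = subst (ℚ._< ε) (sym e) p
  ... | inj₂ e = subst (ℚ._< ε) (sym (trans e (swap a b))) q
    where
    swap : ∀ x y → ℚ.- (x ℚ.- y) ≡ y ℚ.- x
    swap = solve 2 (λ x y → :- (x :- y) := y :- x) refl
      where open ℚSolver.+-*-Solver

  abstract
    riemann-cauchy : Cauchy riemannSum
    riemann-cauchy ε ε>0 = proj₁ small , λ m n l k → abs-sub< (riemannSum m) (riemannSum n)
      (ℚ.≤-<-trans (riemann-step m n) (proj₂ small m l))
      (ℚ.≤-<-trans (riemann-step n m) (proj₂ small n k))
      where
      small : ∃ λ N → ∀ n → N ℕ.≤ n → riemannTerm n 0 ℚ.< ε
      small = smallTerm ε ε>0

-- Opaque only to keep the type checker from normalising Riemann sums.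
opaque
  π : ℝ
  π = mkℝ riemannSum riemann-cauchy

  seq-π : ∀ n → seq π n ≡ riemannSum n
  seq-π n = refl

record ℂ : Set where
  constructor _+i_
  field
    re im : ℝ

open ℂ public

infix 4 _≈ℂ_ _⟶_
infixl 6 _+ℂ_
infixl 7 _*ℂ_
infixr 8 _^ℂ_

_≈ℂ_ : ℂ → ℂ → Set
z ≈ℂ w = re z ≈ℝ re w × im z ≈ℝ im w

_⟶_ : (ℕ → ℂ) → ℂ → Set
u ⟶ l = (λ n → re (u n)) ⟶ℝ re l × (λ n → im (u n)) ⟶ℝ im l

fromℝ : ℝ → ℂ
fromℝ x = x +i fromℚ 0ℚ

0ℂ 1ℂ 𝕚 : ℂ
0ℂ = fromℝ (fromℚ 0ℚ)
1ℂ = fromℝ (fromℚ 1ℚ)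
𝕚  = fromℚ 0ℚ +i fromℚ 1ℚ

_+ℂ_ _*ℂ_ : ℂ → ℂ → ℂ
z +ℂ w = (re z +ℝ re w) +i (im z +ℝ im w)
z *ℂ w = (re z *ℝ re w -ℝ im z *ℝ im w) +i (re z *ℝ im w +ℝ im z *ℝ re w)

_^ℂ_ : ℂ → ℕ → ℂ
z ^ℂ zero  = 1ℂ
z ^ℂ suc n = z *ℂ z ^ℂ n

1/ℂ_ : (n : ℕ) .{{_ : NonZero n}} → ℂ
1/ℂ n = fromℝ (fromℚ (+ 1 / n))

-- w = e^z, where e^z = lim (1 + z/n)^n.
_IsExp_ : ℂ → ℂ → Set
w IsExp z = (λ n → (1ℂ +ℂ 1/ℂ suc n *ℂ z) ^ℂ suc n) ⟶ w

2πi : ℂ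
2πi = fromℝ (fromℚ (+ 2 / 1) *ℝ π) *ℂ 𝕚

∑₁ : ℕ → (ℕ → ℂ) → ℂ
∑₁ zero    g = 0ℂ
∑₁ (suc n) g = ∑₁ n g +ℂ g (suc n)

HasMean : (ℕ → ℂ) → ℂ → Set
HasMean g L = (λ n → 1/ℂ suc n *ℂ ∑₁ (suc n) g) ⟶ L

-- The least m < n satisfying P, or n if there is none.
leastBelow : {P : Pred ℕ 0ℓ} → Decidable P → ℕ → ℕ
leastBelow P? zero = zero
leastBelow P? (suc n) with P? 0
... | yes _ = 0
... | no  _ = suc (leastBelow (λ m → P? (suc m)) n)

-- The least d ≥ 1 with a ^ d ≡ 1 (mod n), provided there is one with d ≤ n.
order : ℕ → ℕ → ℕ
order a n = suc (leastBelow (λ d → n ∣? (a ℕ.^ suc d ∸ 1)) n)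

private

  leastBelow-least : ∀ {P : Pred ℕ 0ℓ} (P? : Decidable P) n m → P m → leastBelow P? n ℕ.≤ m
  leastBelow-least P? zero    m pm = z≤n
  leastBelow-least P? (suc n) m pm with P? 0
  leastBelow-least P? (suc n) m       pm | yes _  = z≤n
  leastBelow-least P? (suc n) zero    pm | no ¬p0 = contradiction pm ¬p0
  leastBelow-least P? (suc n) (suc m) pm | no _   = s≤s (leastBelow-least (λ k → P? (suc k)) n m pm)

  leastBelow-sat : ∀ {P : Pred ℕ 0ℓ} (P? : Decidable P) n m → m ℕ.< n → P m → P (leastBelow P? n)
  leastBelow-sat P? (suc n) m m<n pm with P? 0
  leastBelow-sat P? (suc n) m       m<n       pm | yes p0 = p0
  leastBelow-sat P? (suc n) zero    m<n       pm | no ¬p0 = contradiction pm ¬p0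
  leastBelow-sat P? (suc n) (suc m) (s≤s m<n) pm | no _   = leastBelow-sat (λ k → P? (suc k)) n m m<n pm

  %-≡⇒∣∸ : ∀ a b p .{{_ : NonZero p}} → a % p ≡ b % p → p ∣ b ∸ a
  %-≡⇒∣∸ a b p e = subst (p ∣_) (sym eq) (n∣m*n (b ℕ./ p ∸ a ℕ./ p))
    where
    open import Data.Nat.DivMod using (m≡m%n+[m/n]*n)
    open ≡-Reasoning
    eq : b ∸ a ≡ (b ℕ./ p ∸ a ℕ./ p) ℕ.* p
    eq = begin
      b ∸ a
        ≡⟨ cong₂ _∸_ (m≡m%n+[m/n]*n b p) (m≡m%n+[m/n]*n a p) ⟩
      (b % p ℕ.+ b ℕ./ p ℕ.* p) ∸ (a % p ℕ.+ a ℕ./ p ℕ.* p)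
        ≡⟨ cong (λ z → (b % p ℕ.+ b ℕ./ p ℕ.* p) ∸ (z ℕ.+ a ℕ./ p ℕ.* p)) e ⟩
      (b % p ℕ.+ b ℕ./ p ℕ.* p) ∸ (b % p ℕ.+ a ℕ./ p ℕ.* p)
        ≡⟨ ℕ.[m+n]∸[m+o]≡n∸o (b % p) _ _ ⟩
      b ℕ./ p ℕ.* p ∸ a ℕ./ p ℕ.* p
        ≡⟨ ℕ.*-distribʳ-∸ p (b ℕ./ p) (a ℕ./ p) ⟨
      (b ℕ./ p ∸ a ℕ./ p) ℕ.* p ∎

  prime∤^ : ∀ {p a} → Prime p → ¬ p ∣ a → ∀ i → ¬ p ∣ a ℕ.^ i
  prime∤^ pp p∤a zero    p∣1 = ¬prime[1] (subst Prime (∣1⇒≡1 p∣1) pp)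
  prime∤^ {a = a} pp p∤a (suc i) p∣ with euclidsLemma a (a ℕ.^ i) pp p∣
  ... | inj₁ d = p∤a d
  ... | inj₂ d = prime∤^ pp p∤a i d

  someExponent : ∀ {p a} → Prime p → ¬ p ∣ a → ∃ λ d → suc d ℕ.< p × p ∣ a ℕ.^ suc d ∸ 1
  someExponent {zero} pp _ = contradiction pp ¬prime[0]
  someExponent {p@(suc p′)} {a} pp p∤a with Fin.pigeonhole {p′} {p} ℕ.≤-refl residue
    where
    r : ℕ → ℕ
    r i = a ℕ.^ i % p
    r≢0 : ∀ i → NonZero (r i)
    r≢0 i = ℕ.≢-nonZero λ e → prime∤^ pp p∤a i (m%n≡0⇒n∣m (a ℕ.^ i) p e)
    residue : Fin p → Fin p′
    residue i = Fin.fromℕ< {ℕ.pred (r (toℕ i))}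
      (ℕ.<-≤-trans (ℕ.≤-reflexive (ℕ.suc-pred (r (toℕ i)) {{r≢0 (toℕ i)}}))
        (ℕ.≤-pred (m%n<n (a ℕ.^ toℕ i) p)))
  ... | i , j , i<j , e = go (ℕ.m≤n⇒∃[o]m+o≡n i<j)
    where
    r : ℕ → ℕ
    r i = a ℕ.^ i % p
    r≢0 : ∀ i → NonZero (r i)
    r≢0 i = ℕ.≢-nonZero λ e → prime∤^ pp p∤a i (m%n≡0⇒n∣m (a ℕ.^ i) p e)
    same : r (toℕ i) ≡ r (toℕ j)
    same = trans (sym (ℕ.suc-pred _ {{r≢0 (toℕ i)}})) (trans (cong suc
      (trans (sym (Fin.toℕ-fromℕ< _)) (trans (cong toℕ e) (Fin.toℕ-fromℕ< _))))
      (ℕ.suc-pred _ {{r≢0 (toℕ j)}}))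
    go : (∃ λ d → suc (toℕ i) ℕ.+ d ≡ toℕ j) → _
    go (d , eq) = d , d<p , result
      where
      eq′ : toℕ i ℕ.+ suc d ≡ toℕ j
      eq′ = trans (ℕ.+-suc (toℕ i) d) eq
      d<p : suc d ℕ.< p
      d<p = ℕ.≤-<-trans (subst (suc d ℕ.≤_) eq′ (ℕ.m≤n+m (suc d) (toℕ i))) (Fin.toℕ<n j)
      factor : a ℕ.^ toℕ j ∸ a ℕ.^ toℕ i ≡ a ℕ.^ toℕ i ℕ.* (a ℕ.^ suc d ∸ 1)
      factor = trans (cong₂ _∸_
        (trans (cong (a ℕ.^_) (sym eq′)) (ℕ.^-distribˡ-+-* a (toℕ i) (suc d)))
        (sym (ℕ.*-identityʳ (a ℕ.^ toℕ i)))) (sym (ℕ.*-distribˡ-∸ (a ℕ.^ toℕ i) (a ℕ.^ suc d) 1))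
      result : p ∣ a ℕ.^ suc d ∸ 1
      result with euclidsLemma (a ℕ.^ toℕ i) (a ℕ.^ suc d ∸ 1) pp
                    (subst (p ∣_) factor (%-≡⇒∣∸ (a ℕ.^ toℕ i) (a ℕ.^ toℕ j) p same))
      ... | inj₁ bad = contradiction bad (prime∤^ pp p∤a (toℕ i))
      ... | inj₂ ok  = ok

module _ {p a : ℕ} (pp : Prime p) (p∤a : ¬ p ∣ a) where

  order-sat : p ∣ a ℕ.^ order a p ∸ 1
  order-sat with someExponent pp p∤a
  ... | d , d<p , sat =
    leastBelow-sat (λ d → p ∣? (a ℕ.^ suc d ∸ 1)) p d (ℕ.<-trans ℕ.≤-refl d<p) sat

  order-least : ∀ d .{{_ : NonZero d}} → p ∣ a ℕ.^ d ∸ 1 → order a p ℕ.≤ d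
  order-least (suc d) sat = s≤s (leastBelow-least (λ d → p ∣? (a ℕ.^ suc d ∸ 1)) p d sat)

  order<p : order a p ℕ.< p
  order<p with someExponent pp p∤a
  ... | d , d<p , sat = ℕ.≤-<-trans (order-least (suc d) sat) d<p

-- For a prime p ≠ q the order divides p ∸ 1, so this floor division is exact.
t : ℕ → ℕ → ℕ
t q p = (p ∸ 1) ℕ./ order q p

t-nonZero : ∀ {q p} → Prime q → Prime p → p ≢ q → NonZero (t q p)
t-nonZero {q} {p} pq pp p≢q = ℕ.>-nonZero (m≥n⇒m/n>0 (ℕ.<⇒≤pred (order<p pp p∤q)))
  where
  p∤q : ¬ p ∣ q
  p∤q p∣q with prime⇒irreducible pq p∣q
  ... | inj₁ e = ¬prime[1] (subst Prime e pp)
  ... | inj₂ e = p≢q e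

-- Multiplicativity is only asked on positive integers: ψ 0 is arbitrary and never used.
CompletelyMultiplicative : (ℕ → ℂ) → Set
CompletelyMultiplicative ψ = ψ 1 ≈ℂ 1ℂ ×
  (∀ m n .{{_ : NonZero m}} .{{_ : NonZero n}} → ψ (m ℕ.* n) ≈ℂ ψ m *ℂ ψ n)

IsPsi : (q : ℕ) → Prime q → (ℕ → ℂ) → Set
IsPsi q q-prime ψ = CompletelyMultiplicative ψ ×
  (∀ p (p-prime : Prime p) (p≢q : p ≢ q) →
    ψ p IsExp (1/ℂ_ (t q p) {{t-nonZero q-prime p-prime p≢q}} *ℂ 2πi)) ×
  ψ q ≈ℂ 0ℂ

S : ℕ → ℕ → Pred ℕ 0ℓ
S q k p = Prime p × p ≢ q × ¬ (t q p ∣ k)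

-- Not contained in any finite list.
Infinite : Pred ℕ 0ℓ → Set
Infinite P = ¬ (∃ λ (xs : List ℕ) → ∀ {n} → P n → n ∈ xs)

{-# OPTIONS --safe #-}
module Submission where

-- If S_k is finite, then g = ψᵏ is 1 at all but finitely many primes, because e^{2πi} = 1.
-- For such g the mean exists and is nonzero, by induction on the list of exceptional primes:
-- if h agrees with g off the multiples of p but has h(p) = 1, and z = g(p), then the partial
-- sums satisfy G(n) − H(n) = z G(n/p) − H(n/p), so a mean M of h gives the mean
-- L = M (p − 1)/(p − z) of g. Here |z| ≤ 1 and p − z is invertible since z is 0 or a root of unity.
--
-- For e^{2πi} = 1, let C(y) = (1 + iy)/(1 − iy), a point of the unit circle. The product of C over
-- the tangents m/(m² + k² + k), k < m, telescopes to (1 + i)/(1 − i) = i, and four times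
-- the sum of these tangents is a Riemann sum for π. Since C(a)C(c) − C(a + c) is O(ac(a + c)),
-- products of values of C at small arguments depend, up to a small error, only on the sum of the
-- arguments; hence C(π/n)ⁿ, and with it (1 + 2πi/n)ⁿ, tends to i⁴ = 1.

open import Defs
open import Algebra.Bundles using (CommutativeRing)
import Algebra.Solver.Ring
import Algebra.Solver.Ring.AlmostCommutativeRing as ACR
open import Data.Empty using (⊥)
open import Data.Integer.Base as ℤ using (+_)
import Data.Integer.Properties as ℤ
open import Data.List.Base using (List; []; _∷_; _++_; length; replicate; applyDownFrom)
open import Data.List.Membership.Propositional using (_∈_)
open import Data.List.Relation.Unary.All using (All; []; _∷_)
import Data.List.Relation.Unary.All.Properties as All
open import Data.List.Relation.Unary.Any using (here; there)
import Data.Maybe.Base as Maybe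
open import Data.Nat.Base as ℕ using (ℕ; zero; suc; NonZero)
open import Data.Nat.Divisibility
import Data.Nat.DivMod as ℕ
open import Data.Nat.Induction using (<-rec)
open import Data.Nat.ListAction using (product)
open import Data.Nat.Primality
open import Data.Nat.Primality.Factorisation using (factorise; PrimeFactorisation)
import Data.Nat.Properties as ℕ
open import Data.Product.Base using (Σ-syntax; ∃; _×_; _,_; proj₁; proj₂)
open import Data.Rational.Base as ℚ using (ℚ; 0ℚ; 1ℚ; ½; mkℚ; _+_; _*_; -_; _-_; _≤_; _<_; _/_; toℚᵘ)
import Data.Rational.Properties as ℚ
open import Data.Rational.Unnormalised.Base as ℚᵘ using (mkℚᵘ)
import Data.Rational.Unnormalised.Properties as ℚᵘ
open import Data.Sum.Base using (_⊎_; inj₁; inj₂)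
open import Relation.Binary.PropositionalEquality
open import Relation.Nullary using (¬_; Dec; yes; no; contradiction)
open import Relation.Nullary.Decidable using (dec⇒maybe)

ι : ℕ → ℚ
ι n = + n / 1

opaque

  toℚᵘ-/1 : ∀ z → toℚᵘ (z / 1) ℚᵘ.≃ mkℚᵘ z 0
  toℚᵘ-/1 z = ℚ.toℚᵘ-fromℚᵘ (mkℚᵘ z 0)

  /1-+ : ∀ y z → (y ℤ.+ z) / 1 ≡ y / 1 + z / 1
  /1-+ y z = ℚ.toℚᵘ-injective (begin
    toℚᵘ ((y ℤ.+ z) / 1)               ≈⟨ toℚᵘ-/1 (y ℤ.+ z) ⟩
    mkℚᵘ (y ℤ.+ z) 0                   ≈⟨ ℚᵘ.*≡* (cong (ℤ._* + 1) (cong₂ ℤ._+_ (ℤ.*-identityʳ y) (ℤ.*-identityʳ z))) ⟨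
    mkℚᵘ y 0 ℚᵘ.+ mkℚᵘ z 0             ≈⟨ ℚᵘ.+-cong (toℚᵘ-/1 y) (toℚᵘ-/1 z) ⟨
    toℚᵘ (y / 1) ℚᵘ.+ toℚᵘ (z / 1)     ≈⟨ ℚ.toℚᵘ-homo-+ (y / 1) (z / 1) ⟨
    toℚᵘ (y / 1 + z / 1)               ∎)
    where open import Relation.Binary.Reasoning.Setoid ℚᵘ.≃-setoid

  /1-* : ∀ y z → (y ℤ.* z) / 1 ≡ (y / 1) * (z / 1)
  /1-* y z = ℚ.toℚᵘ-injective (begin
    toℚᵘ ((y ℤ.* z) / 1)               ≈⟨ toℚᵘ-/1 (y ℤ.* z) ⟩
    mkℚᵘ y 0 ℚᵘ.* mkℚᵘ z 0             ≈⟨ ℚᵘ.*-cong (toℚᵘ-/1 y) (toℚᵘ-/1 z) ⟨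
    toℚᵘ (y / 1) ℚᵘ.* toℚᵘ (z / 1)     ≈⟨ ℚ.toℚᵘ-homo-* (y / 1) (z / 1) ⟨
    toℚᵘ ((y / 1) * (z / 1))           ∎)
    where open import Relation.Binary.Reasoning.Setoid ℚᵘ.≃-setoid

  /1-neg : ∀ z → (ℤ.- z) / 1 ≡ - (z / 1)
  /1-neg z = ℚ.toℚᵘ-injective (begin
    toℚᵘ ((ℤ.- z) / 1)                 ≈⟨ toℚᵘ-/1 (ℤ.- z) ⟩
    ℚᵘ.- mkℚᵘ z 0                      ≈⟨ ℚᵘ.-‿cong (toℚᵘ-/1 z) ⟨
    ℚᵘ.- toℚᵘ (z / 1)                  ≈⟨ ℚ.toℚᵘ-homo‿- (z / 1) ⟨
    toℚᵘ (- (z / 1))                   ∎)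
    where open import Relation.Binary.Reasoning.Setoid ℚᵘ.≃-setoid

ℤ→ℚ : ℤ.+-*-rawRing ACR.-Raw-AlmostCommutative⟶ ACR.fromCommutativeRing ℚ.+-*-commutativeRing
ℤ→ℚ = record
  { ⟦_⟧ = _/ 1 ; +-homo = /1-+ ; *-homo = /1-* ; -‿homo = /1-neg ; 0-homo = refl ; 1-homo = refl }

-- The ring solvers with integer coefficients are much faster than those with rational ones.
module ℚSolver = Algebra.Solver.Ring ℤ.+-*-rawRing (ACR.fromCommutativeRing ℚ.+-*-commutativeRing)
  ℤ→ℚ (λ y z → Maybe.map (cong (_/ 1)) (dec⇒maybe (y ℤ.≟ z)))

opaque

  ι-+ : ∀ m n → ι (m ℕ.+ n) ≡ ι m + ι n
  ι-+ m n = /1-+ (+ m) (+ n)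

  ι-* : ∀ m n → ι (m ℕ.* n) ≡ ι m * ι n
  ι-* m n = trans (cong (_/ 1) (ℤ.pos-* m n)) (/1-* (+ m) (+ n))

  ι-/ : ∀ a b .{{_ : NonZero b}} → ι b * (+ a / b) ≡ ι a
  ι-/ a b@(suc b′) = ℚ.toℚᵘ-injective (begin
    toℚᵘ (ι b * (+ a / b))              ≈⟨ ℚ.toℚᵘ-homo-* (ι b) (+ a / b) ⟩
    toℚᵘ (ι b) ℚᵘ.* toℚᵘ (+ a / b)      ≈⟨ ℚᵘ.*-cong (toℚᵘ-/1 (+ b)) (ℚ.toℚᵘ-fromℚᵘ (mkℚᵘ (+ a) b′)) ⟩
    mkℚᵘ (+ b) 0 ℚᵘ.* mkℚᵘ (+ a) b′     ≈⟨ ℚᵘ.*≡* lem ⟩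
    mkℚᵘ (+ a) 0                        ≈⟨ toℚᵘ-/1 (+ a) ⟨
    toℚᵘ (ι a)                          ∎)
    where
    open import Relation.Binary.Reasoning.Setoid ℚᵘ.≃-setoid
    lem : (+ b ℤ.* + a) ℤ.* + 1 ≡ + a ℤ.* + (1 ℕ.* b)
    lem = trans (ℤ.*-identityʳ (+ b ℤ.* + a)) (trans (ℤ.*-comm (+ b) (+ a))
            (cong (λ x → + a ℤ.* + x) (sym (ℕ.*-identityˡ b))))

  0≤ι : ∀ n → 0ℚ ≤ ι n
  0≤ι zero    = ℚ.≤-refl
  0≤ι (suc n) = subst (0ℚ ≤_) (sym (ι-+ 1 n)) (ℚ.+-mono-≤ (ℚ.<⇒≤ (ℚ.positive⁻¹ 1ℚ)) (0≤ι n))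

  ι-mono : ∀ {m n} → m ℕ.≤ n → ι m ≤ ι n
  ι-mono {m} {n} le with ℕ.m≤n⇒∃[o]m+o≡n le
  ... | o , refl = subst₂ _≤_ (ℚ.+-identityʳ (ι m)) (sym (ι-+ m o)) (ℚ.+-monoʳ-≤ (ι m) (0≤ι o))

  0<ι : ∀ n .{{_ : NonZero n}} → 0ℚ < ι n
  0<ι (suc n) = ℚ.<-≤-trans (ℚ.positive⁻¹ 1ℚ) (ι-mono (ℕ.s≤s (ℕ.z≤n {n})))

  0≤1 : 0ℚ ≤ 1ℚ
  0≤1 = ℚ.<⇒≤ (ℚ.positive⁻¹ 1ℚ)

  0≤+ : ∀ {p q} → 0ℚ ≤ p → 0ℚ ≤ q → 0ℚ ≤ p + q
  0≤+ a b = ℚ.+-mono-≤ a b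

  *-mono-≤ : ∀ {p q r s} → 0ℚ ≤ r → 0ℚ ≤ q → p ≤ q → r ≤ s → p * r ≤ q * s
  *-mono-≤ {p} {q} {r} {s} 0≤r 0≤q p≤q r≤s = ℚ.≤-trans
    (ℚ.*-monoʳ-≤-nonNeg r {{ℚ.nonNegative 0≤r}} p≤q)
    (ℚ.*-monoˡ-≤-nonNeg q {{ℚ.nonNegative 0≤q}} r≤s)

  *-monoˡ-≤ : ∀ {p q} r → 0ℚ ≤ r → p ≤ q → r * p ≤ r * q
  *-monoˡ-≤ r 0≤r = ℚ.*-monoˡ-≤-nonNeg r {{ℚ.nonNegative 0≤r}}

  0≤* : ∀ {p q} → 0ℚ ≤ p → 0ℚ ≤ q → 0ℚ ≤ p * q
  0≤* {p} {q} a b = subst (_≤ p * q) (ℚ.*-zeroʳ p) (*-monoˡ-≤ p a b)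

  0<* : ∀ {p q} → 0ℚ < p → 0ℚ < q → 0ℚ < p * q
  0<* {p} {q} a b = subst (_< p * q) (ℚ.*-zeroʳ p) (ℚ.*-monoʳ-<-pos p {{ℚ.positive a}} b)

  *-cancelˡ-≤ : ∀ {p q} r → 0ℚ < r → r * p ≤ r * q → p ≤ q
  *-cancelˡ-≤ r 0<r = ℚ.*-cancelˡ-≤-pos r {{ℚ.positive 0<r}}

  *-cancelˡ-≡ : ∀ {p q} r → 0ℚ < r → r * p ≡ r * q → p ≡ q
  *-cancelˡ-≡ r 0<r e = ℚ.≤-antisym (*-cancelˡ-≤ r 0<r (ℚ.≤-reflexive e)) (*-cancelˡ-≤ r 0<r (ℚ.≤-reflexive (sym e)))

  0≤p*p : ∀ p → 0ℚ ≤ p * p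
  0≤p*p p with ℚ.≤-total 0ℚ p
  ... | inj₁ 0≤p = 0≤* 0≤p 0≤p
  ... | inj₂ p≤0 = subst (0ℚ ≤_) (lem p) (0≤* 0≤-p 0≤-p)
    where
    0≤-p : 0ℚ ≤ - p
    0≤-p = ℚ.neg-antimono-≤ p≤0
    lem : ∀ p → - p * - p ≡ p * p
    lem = solve 1 (λ p → (:- p) :* (:- p) := p :* p) refl where open ℚSolver

  ≤-by : ∀ {p q} d → q ≡ p + d → 0ℚ ≤ d → p ≤ q
  ≤-by {p} d refl 0≤d = subst (_≤ p + d) (ℚ.+-identityʳ p) (ℚ.+-monoʳ-≤ p 0≤d)

  0≤q-p : ∀ {p q} → p ≤ q → 0ℚ ≤ q - p
  0≤q-p {p} {q} p≤q = subst (_≤ q - p) (ℚ.+-inverseʳ p) (ℚ.+-monoˡ-≤ (- p) p≤q)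

  sq-cancel-≤ : ∀ {p q} → 0ℚ ≤ q → p * p ≤ q * q → p ≤ q
  sq-cancel-≤ {p} {q} 0≤q le with p ℚ.≤? q
  ... | yes p≤q = p≤q
  ... | no  p≰q = contradiction (ℚ.≤-<-trans le q*q<p*p) (ℚ.<-irrefl refl)
    where
    q<p : q < p
    q<p = ℚ.≰⇒> p≰q
    q*q<p*p : q * q < p * p
    q*q<p*p = ℚ.≤-<-trans (*-monoˡ-≤ q 0≤q (ℚ.<⇒≤ q<p))
      (ℚ.*-monoˡ-<-pos p {{ℚ.positive (ℚ.≤-<-trans 0≤q q<p)}} q<p)

  *-pos-inverse : ∀ p → 0ℚ < p → Σ[ r ∈ ℚ ] 0ℚ < r × p * r ≡ 1ℚ
  *-pos-inverse p 0<p = ℚ.1/ p , ℚ.positive⁻¹ (ℚ.1/ p) , ℚ.*-inverseʳ p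
    where
    instance
      p⁺ : ℚ.Positive p
      p⁺ = ℚ.positive 0<p
      p≢0 : ℚ.NonZero p
      p≢0 = ℚ.pos⇒nonZero p
      1/p⁺ : ℚ.Positive (ℚ.1/ p)
      1/p⁺ = ℚ.1/pos⇒pos p

  archimedes : ∀ p → ∃ λ n → p ≤ ι n
  archimedes p@(mkℚ (+ n) d c) = n , *-cancelˡ-≤ (ι (suc d)) (0<ι (suc d)) (subst (_≤ ι (suc d) * ι n)
    (sym (trans (cong (ι (suc d) *_) (sym (ℚ.fromℚᵘ-toℚᵘ p))) (ι-/ n (suc d))))
    (subst (_≤ ι (suc d) * ι n) (ℚ.*-identityˡ (ι n)) (*-mono-≤ (0≤ι n) (0≤ι (suc d)) (ι-mono (ℕ.s≤s (ℕ.z≤n {d}))) ℚ.≤-refl)))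
  archimedes p@(mkℚ ℤ.-[1+ n ] d c) = 0 , ℚ.<⇒≤ (ℚ.negative⁻¹ p)

-- Gaussian rationals

infix  5 _+𝕚_
infixl 6 _⊕_ _⊖_
infixl 7 _⊗_
infix  8 ⊝_
infixr 8 _^ᵍ_

-- As with ℚ, the absence of eta keeps the ring solver from unfolding the operations.
record ℚ[i] : Set where
  no-eta-equality; pattern
  constructor _+𝕚_
  field
    Re Im : ℚ

open ℚ[i] public

_⊕_ _⊗_ _⊖_ : ℚ[i] → ℚ[i] → ℚ[i]
(a +𝕚 b) ⊕ (c +𝕚 d) = a + c +𝕚 b + d
(a +𝕚 b) ⊗ (c +𝕚 d) = a * c - b * d +𝕚 a * d + b * c

⊝_ : ℚ[i] → ℚ[i]
⊝ (a +𝕚 b) = - a +𝕚 - b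

z ⊖ w = z ⊕ ⊝ w

ofℚ : ℚ → ℚ[i]
ofℚ x = x +𝕚 0ℚ

0ᵍ 1ᵍ iᵍ : ℚ[i]
0ᵍ = ofℚ 0ℚ
1ᵍ = ofℚ 1ℚ
iᵍ = 0ℚ +𝕚 1ℚ

conj : ℚ[i] → ℚ[i]
conj (a +𝕚 b) = a +𝕚 - b

_^ᵍ_ : ℚ[i] → ℕ → ℚ[i]
z ^ᵍ zero  = 1ᵍ
z ^ᵍ suc n = z ⊗ z ^ᵍ n

ℚ[i]-ring : CommutativeRing _ _
ℚ[i]-ring = record
  { Carrier = ℚ[i] ; _≈_ = _≡_ ; _+_ = _⊕_ ; _*_ = _⊗_ ; -_ = ⊝_ ; 0# = 0ᵍ ; 1# = 1ᵍ
  ; isCommutativeRing = record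
    { isRing = record
      { +-isAbelianGroup = record
        { isGroup = record
          { isMonoid = record
            { isSemigroup = record
              { isMagma = record { isEquivalence = isEquivalence ; ∙-cong = cong₂ _⊕_ }
              ; assoc = λ { (a +𝕚 b) (c +𝕚 d) (e +𝕚 f) → cong₂ _+𝕚_ (ℚ.+-assoc a c e) (ℚ.+-assoc b d f) } }
            ; identity = (λ { (a +𝕚 b) → cong₂ _+𝕚_ (ℚ.+-identityˡ a) (ℚ.+-identityˡ b) })
                       , (λ { (a +𝕚 b) → cong₂ _+𝕚_ (ℚ.+-identityʳ a) (ℚ.+-identityʳ b) }) }
          ; inverse = (λ { (a +𝕚 b) → cong₂ _+𝕚_ (ℚ.+-inverseˡ a) (ℚ.+-inverseˡ b) })
                    , (λ { (a +𝕚 b) → cong₂ _+𝕚_ (ℚ.+-inverseʳ a) (ℚ.+-inverseʳ b) })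
          ; ⁻¹-cong = cong ⊝_ }
        ; comm = λ { (a +𝕚 b) (c +𝕚 d) → cong₂ _+𝕚_ (ℚ.+-comm a c) (ℚ.+-comm b d) } }
      ; *-cong = cong₂ _⊗_
      ; *-assoc = λ { (a +𝕚 b) (c +𝕚 d) (e +𝕚 f) → cong₂ _+𝕚_
          (solve 6 (λ a b c d e f → (a :* c :- b :* d) :* e :- (a :* d :+ b :* c) :* f
             := a :* (c :* e :- d :* f) :- b :* (c :* f :+ d :* e)) refl a b c d e f)
          (solve 6 (λ a b c d e f → (a :* c :- b :* d) :* f :+ (a :* d :+ b :* c) :* e
             := a :* (c :* f :+ d :* e) :+ b :* (c :* e :- d :* f)) refl a b c d e f) }
      ; *-identity =
          (λ { (a +𝕚 b) → cong₂ _+𝕚_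
            (solve 2 (λ a b → con (+ 1) :* a :- con (+ 0) :* b := a) refl a b)
            (solve 2 (λ a b → con (+ 1) :* b :+ con (+ 0) :* a := b) refl a b) })
        , (λ { (a +𝕚 b) → cong₂ _+𝕚_
            (solve 2 (λ a b → a :* con (+ 1) :- b :* con (+ 0) := a) refl a b)
            (solve 2 (λ a b → a :* con (+ 0) :+ b :* con (+ 1) := b) refl a b) })
      ; distrib =
          (λ { (a +𝕚 b) (c +𝕚 d) (e +𝕚 f) → cong₂ _+𝕚_
            (solve 6 (λ a b c d e f → a :* (c :+ e) :- b :* (d :+ f)
               := (a :* c :- b :* d) :+ (a :* e :- b :* f)) refl a b c d e f)
            (solve 6 (λ a b c d e f → a :* (d :+ f) :+ b :* (c :+ e)
               := (a :* d :+ b :* c) :+ (a :* f :+ b :* e)) refl a b c d e f) })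
        , (λ { (a +𝕚 b) (c +𝕚 d) (e +𝕚 f) → cong₂ _+𝕚_
            (solve 6 (λ a b c d e f → (c :+ e) :* a :- (d :+ f) :* b
               := (c :* a :- d :* b) :+ (e :* a :- f :* b)) refl a b c d e f)
            (solve 6 (λ a b c d e f → (c :+ e) :* b :+ (d :+ f) :* a
               := (c :* b :+ d :* a) :+ (e :* b :+ f :* a)) refl a b c d e f) }) }
    ; *-comm = λ { (a +𝕚 b) (c +𝕚 d) → cong₂ _+𝕚_
        (solve 4 (λ a b c d → a :* c :- b :* d := c :* a :- d :* b) refl a b c d)
        (solve 4 (λ a b c d → a :* d :+ b :* c := c :* b :+ d :* a) refl a b c d) } } }
  where open ℚSolver

ofℤ : ℤ.ℤ → ℚ[i]
ofℤ z = ofℚ (z / 1)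

ℤ→ℚ[i] : ℤ.+-*-rawRing ACR.-Raw-AlmostCommutative⟶ ACR.fromCommutativeRing ℚ[i]-ring
ℤ→ℚ[i] = record
    { ⟦_⟧    = ofℤ
    ; +-homo = λ y z → cong₂ _+𝕚_ (/1-+ y z) refl
    ; *-homo = λ y z → trans (cong ofℚ (/1-* y z)) (cong₂ _+𝕚_
        (ℚSolver.solve 2 (λ a b → a ℚSolver.:* b ℚSolver.:= a ℚSolver.:* b ℚSolver.:- ℚSolver.con (+ 0) ℚSolver.:* ℚSolver.con (+ 0)) refl (y / 1) (z / 1))
        (ℚSolver.solve 2 (λ a b → ℚSolver.con (+ 0) ℚSolver.:= a ℚSolver.:* ℚSolver.con (+ 0) ℚSolver.:+ ℚSolver.con (+ 0) ℚSolver.:* b) refl (y / 1) (z / 1)))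
    ; -‿homo = λ z → cong ofℚ (/1-neg z)
    ; 0-homo = refl ; 1-homo = refl }

module GSolver = Algebra.Solver.Ring ℤ.+-*-rawRing (ACR.fromCommutativeRing ℚ[i]-ring)
  ℤ→ℚ[i] (λ y z → Maybe.map (cong ofℤ) (dec⇒maybe (y ℤ.≟ z)))

module Gℚ = CommutativeRing ℚ[i]-ring

N : ℚ[i] → ℚ
N (a +𝕚 b) = a * a + b * b

infix 4 ‖_‖≤_

record ‖_‖≤_ (z : ℚ[i]) (r : ℚ) : Set where
  constructor bound
  field
    0≤r : 0ℚ ≤ r
    N≤ : N z ≤ r * r

open ‖_‖≤_ public

N-⊗ : ∀ z w → N (z ⊗ w) ≡ N z * N w
N-⊗ (a +𝕚 b) (c +𝕚 d) = solve 4 (λ a b c d →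
  (a :* c :- b :* d) :* (a :* c :- b :* d) :+ (a :* d :+ b :* c) :* (a :* d :+ b :* c)
  := (a :* a :+ b :* b) :* (c :* c :+ d :* d)) refl a b c d
  where open ℚSolver

0≤N : ∀ z → 0ℚ ≤ N z
0≤N (a +𝕚 b) = 0≤+ (0≤p*p a) (0≤p*p b)

opaque

  ‖‖-⊗ : ∀ {z w r s} → ‖ z ‖≤ r → ‖ w ‖≤ s → ‖ z ⊗ w ‖≤ r * s
  ‖‖-⊗ {z} {w} {r} {s} (bound 0≤r p) (bound 0≤s q) = bound (0≤* 0≤r 0≤s)
    (subst₂ _≤_ (sym (N-⊗ z w)) (lem r s) (*-mono-≤ (0≤N w) (0≤* 0≤r 0≤r) p q))
    where
    lem : ∀ r s → (r * r) * (s * s) ≡ (r * s) * (r * s)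
    lem = solve 2 (λ r s → (r :* r) :* (s :* s) := (r :* s) :* (r :* s)) refl where open ℚSolver

  ‖‖-⊕ : ∀ {z w r s} → ‖ z ‖≤ r → ‖ w ‖≤ s → ‖ z ⊕ w ‖≤ r + s
  ‖‖-⊕ {z@(a +𝕚 b)} {w@(c +𝕚 d)} {r} {s} (bound 0≤r p) (bound 0≤s q) = bound (0≤+ 0≤r 0≤s) (begin
    N (z ⊕ w)                                  ≡⟨ expand a b c d ⟩
    N z + N w + (a * c + b * d + (a * c + b * d))  ≤⟨ ℚ.+-mono-≤ (ℚ.+-mono-≤ p q) (ℚ.+-mono-≤ inner inner) ⟩
    r * r + s * s + (r * s + r * s)            ≡⟨ square r s ⟩
    (r + s) * (r + s)                          ∎)
    where
    open ℚ.≤-Reasoning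
    expand : ∀ a b c d → (a + c) * (a + c) + (b + d) * (b + d)
      ≡ (a * a + b * b) + (c * c + d * d) + (a * c + b * d + (a * c + b * d))
    expand = solve 4 (λ a b c d → (a :+ c) :* (a :+ c) :+ (b :+ d) :* (b :+ d)
      := (a :* a :+ b :* b) :+ (c :* c :+ d :* d) :+ (a :* c :+ b :* d :+ (a :* c :+ b :* d))) refl
      where open ℚSolver
    square : ∀ r s → r * r + s * s + (r * s + r * s) ≡ (r + s) * (r + s)
    square = solve 2 (λ r s → r :* r :+ s :* s :+ (r :* s :+ r :* s) := (r :+ s) :* (r :+ s)) refl
      where open ℚSolver
    lagrange : ∀ a b c d → (a * a + b * b) * (c * c + d * d)
      ≡ (a * c + b * d) * (a * c + b * d) + (a * d - b * c) * (a * d - b * c)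
    lagrange = solve 4 (λ a b c d → (a :* a :+ b :* b) :* (c :* c :+ d :* d)
      := (a :* c :+ b :* d) :* (a :* c :+ b :* d) :+ (a :* d :- b :* c) :* (a :* d :- b :* c)) refl
      where open ℚSolver
    rearrange : ∀ r s → (r * r) * (s * s) ≡ (r * s) * (r * s)
    rearrange = solve 2 (λ r s → (r :* r) :* (s :* s) := (r :* s) :* (r :* s)) refl
      where open ℚSolver
    inner : a * c + b * d ≤ r * s
    inner = sq-cancel-≤ (0≤* 0≤r 0≤s) (ℚ.≤-trans
      (≤-by _ (lagrange a b c d) (0≤p*p (a * d - b * c)))
      (ℚ.≤-trans (*-mono-≤ (0≤N w) (0≤* 0≤r 0≤r) p q) (ℚ.≤-reflexive (rearrange r s))))

  ‖‖-⊝ : ∀ {z r} → ‖ z ‖≤ r → ‖ ⊝ z ‖≤ r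
  ‖‖-⊝ {a +𝕚 b} (bound 0≤r p) = bound 0≤r (ℚ.≤-trans (ℚ.≤-reflexive (lem a b)) p)
    where
    lem : ∀ a b → - a * - a + - b * - b ≡ a * a + b * b
    lem = solve 2 (λ a b → (:- a) :* (:- a) :+ (:- b) :* (:- b) := a :* a :+ b :* b) refl
      where open ℚSolver

  ‖‖-weaken : ∀ {z r s} → r ≤ s → ‖ z ‖≤ r → ‖ z ‖≤ s
  ‖‖-weaken r≤s (bound 0≤r p) = bound (ℚ.≤-trans 0≤r r≤s)
    (ℚ.≤-trans p (*-mono-≤ 0≤r (ℚ.≤-trans 0≤r r≤s) r≤s r≤s))

  ‖‖-ofℚ : ∀ {x} → 0ℚ ≤ x → ‖ ofℚ x ‖≤ x
  ‖‖-ofℚ {x} 0≤x = bound 0≤x (ℚ.≤-reflexive (lem x))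
    where
    lem : ∀ x → x * x + 0ℚ * 0ℚ ≡ x * x
    lem = solve 1 (λ x → x :* x :+ con (+ 0) :* con (+ 0) := x :* x) refl where open ℚSolver

  ‖‖-1 : ‖ 1ᵍ ‖≤ 1ℚ
  ‖‖-1 = ‖‖-ofℚ 0≤1

  ‖‖-Re : ∀ {z r} → ‖ z ‖≤ r → Re z ≤ r
  ‖‖-Re {a +𝕚 b} (bound 0≤r p) = sq-cancel-≤ 0≤r (ℚ.≤-trans (≤-by (b * b) refl (0≤p*p b)) p)

  ‖‖-Im : ∀ {z r} → ‖ z ‖≤ r → Im z ≤ r
  ‖‖-Im {a +𝕚 b} (bound 0≤r p) = sq-cancel-≤ 0≤r (ℚ.≤-trans (≤-by (a * a) (ℚ.+-comm (a * a) (b * b)) (0≤p*p a)) p)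

  ∣∣≤ : ∀ {x r} → x ≤ r → - x ≤ r → ℚ.∣ x ∣ ≤ r
  ∣∣≤ {x} {r} p q with ℚ.∣p∣≡p∨∣p∣≡-p x
  ... | inj₁ e = subst (_≤ r) (sym e) p
  ... | inj₂ e = subst (_≤ r) (sym e) q

  ‖‖-∣Re∣ : ∀ {z r} → ‖ z ‖≤ r → ℚ.∣ Re z ∣ ≤ r
  ‖‖-∣Re∣ {_ +𝕚 _} p = ∣∣≤ (‖‖-Re p) (‖‖-Re (‖‖-⊝ p))

  ‖‖-∣Im∣ : ∀ {z r} → ‖ z ‖≤ r → ℚ.∣ Im z ∣ ≤ r
  ‖‖-∣Im∣ {_ +𝕚 _} p = ∣∣≤ (‖‖-Im p) (‖‖-Im (‖‖-⊝ p))

  ‖‖-components : ∀ {z r s} → ℚ.∣ Re z ∣ ≤ r → ℚ.∣ Im z ∣ ≤ s → ‖ z ‖≤ r + s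
  ‖‖-components {a +𝕚 b} {r} {s} p q = bound (0≤+ 0≤r′ 0≤s′)
    (≤-by (r * s + r * s + ((r * r - a * a) + (s * s - b * b))) (lem a b r s)
      (0≤+ (0≤+ (0≤* 0≤r′ 0≤s′) (0≤* 0≤r′ 0≤s′)) (0≤+ (0≤q-p (sq p)) (0≤q-p (sq q)))))
    where
    0≤r′ : 0ℚ ≤ r
    0≤r′ = ℚ.≤-trans (ℚ.0≤∣p∣ a) p
    0≤s′ : 0ℚ ≤ s
    0≤s′ = ℚ.≤-trans (ℚ.0≤∣p∣ b) q
    sq : ∀ {x t} → ℚ.∣ x ∣ ≤ t → x * x ≤ t * t
    sq {x} {t} le = subst (_≤ t * t) (∣x∣² x) (*-mono-≤ (ℚ.0≤∣p∣ x) (ℚ.≤-trans (ℚ.0≤∣p∣ x) le) le le)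
      where
      ∣x∣² : ∀ x → ℚ.∣ x ∣ * ℚ.∣ x ∣ ≡ x * x
      ∣x∣² x with ℚ.∣p∣≡p∨∣p∣≡-p x
      ... | inj₁ e rewrite e = refl
      ... | inj₂ e rewrite e = neg² x
        where
        neg² : ∀ x → - x * - x ≡ x * x
        neg² = solve 1 (λ x → (:- x) :* (:- x) := x :* x) refl where open ℚSolver
    lem : ∀ a b r s → (r + s) * (r + s)
      ≡ (a * a + b * b) + (r * s + r * s + ((r * r - a * a) + (s * s - b * b)))
    lem = solve 4 (λ a b r s → (r :+ s) :* (r :+ s)
      := (a :* a :+ b :* b) :+ (r :* s :+ r :* s :+ ((r :* r :- a :* a) :+ (s :* s :- b :* b)))) refl
      where open ℚSolver

  ⊗-cancelˡ : ∀ {z w v} → 0ℚ < N z → z ⊗ w ≡ z ⊗ v → w ≡ v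
  ⊗-cancelˡ {z} {w} {v} 0<N e with *-pos-inverse (N z) 0<N
  ... | r , _ , Nr≡1 = trans (recover w) (trans (cong (ofℚ r ⊗ conj z ⊗_) e) (sym (recover v)))
    where
    conj-⊗ : ∀ z r → ofℚ r ⊗ conj z ⊗ z ≡ ofℚ (N z * r)
    conj-⊗ (a +𝕚 b) r = cong₂ _+𝕚_
      (Q.solve 3 (λ a b r → (r Q.:* a Q.:- Q.con (+ 0) Q.:* Q.:- b) Q.:* a
           Q.:- (r Q.:* Q.:- b Q.:+ Q.con (+ 0) Q.:* a) Q.:* b Q.:= (a Q.:* a Q.:+ b Q.:* b) Q.:* r) refl a b r)
      (Q.solve 3 (λ a b r → (r Q.:* a Q.:- Q.con (+ 0) Q.:* Q.:- b) Q.:* b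
           Q.:+ (r Q.:* Q.:- b Q.:+ Q.con (+ 0) Q.:* a) Q.:* a Q.:= Q.con (+ 0)) refl a b r)
      where module Q = ℚSolver
    recover : ∀ u → u ≡ ofℚ r ⊗ conj z ⊗ (z ⊗ u)
    recover u = begin
      u                                ≡⟨ Gℚ.*-identityˡ u ⟨
      1ᵍ ⊗ u                           ≡⟨ cong (λ x → ofℚ x ⊗ u) Nr≡1 ⟨
      ofℚ (N z * r) ⊗ u                ≡⟨ cong (_⊗ u) (conj-⊗ z r) ⟨
      ofℚ r ⊗ conj z ⊗ z ⊗ u           ≡⟨ Gℚ.*-assoc (ofℚ r ⊗ conj z) z u ⟩
      ofℚ r ⊗ conj z ⊗ (z ⊗ u)         ∎
      where open ≡-Reasoning

-- The Cayley transform

opaque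

  cayley : ℚ → ℚ[i]
  cayley y = (1ℚ +𝕚 y) ⊗ (1ℚ +𝕚 y) ⊗ ofℚ (proj₁ (*-pos-inverse (1ℚ + y * y) (ℚ.+-mono-<-≤ (ℚ.positive⁻¹ 1ℚ) (0≤p*p y))))

opaque
  unfolding cayley

  cayley-eq : ∀ y → cayley y ⊗ (1ℚ +𝕚 - y) ≡ (1ℚ +𝕚 y)
  cayley-eq y with *-pos-inverse (1ℚ + y * y) (ℚ.+-mono-<-≤ (ℚ.positive⁻¹ 1ℚ) (0≤p*p y))
  ... | r , _ , e = begin
    (1ℚ +𝕚 y) ⊗ (1ℚ +𝕚 y) ⊗ ofℚ r ⊗ (1ℚ +𝕚 - y)          ≡⟨ GSolver.solve 3 (λ u v r → u GSolver.:* u GSolver.:* r GSolver.:* v GSolver.:= u GSolver.:* (v GSolver.:* u GSolver.:* r)) refl (1ℚ +𝕚 y) (1ℚ +𝕚 - y) (ofℚ r) ⟩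
    (1ℚ +𝕚 y) ⊗ ((1ℚ +𝕚 - y) ⊗ (1ℚ +𝕚 y) ⊗ ofℚ r)        ≡⟨ cong ((1ℚ +𝕚 y) ⊗_) (norm y r) ⟩
    (1ℚ +𝕚 y) ⊗ ofℚ ((1ℚ + y * y) * r)                   ≡⟨ cong (λ x → (1ℚ +𝕚 y) ⊗ ofℚ x) e ⟩
    (1ℚ +𝕚 y) ⊗ 1ᵍ                                       ≡⟨ Gℚ.*-identityʳ (1ℚ +𝕚 y) ⟩
    (1ℚ +𝕚 y)                                            ∎
    where
    open ≡-Reasoning
    norm : ∀ y r → (1ℚ +𝕚 - y) ⊗ (1ℚ +𝕚 y) ⊗ ofℚ r ≡ ofℚ ((1ℚ + y * y) * r)
    norm y r = cong₂ _+𝕚_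
      (solve 2 (λ y r → (con (+ 1) :* con (+ 1) :- :- y :* y) :* r :- (con (+ 1) :* y :+ :- y :* con (+ 1)) :* con (+ 0)
         := (con (+ 1) :+ y :* y) :* r) refl y r)
      (solve 2 (λ y r → (con (+ 1) :* con (+ 1) :- :- y :* y) :* con (+ 0) :+ (con (+ 1) :* y :+ :- y :* con (+ 1)) :* r
         := con (+ 0)) refl y r)
      where open ℚSolver

  cayley-unit : ∀ y → ‖ cayley y ‖≤ 1ℚ
  cayley-unit y with *-pos-inverse (1ℚ + y * y) (ℚ.+-mono-<-≤ (ℚ.positive⁻¹ 1ℚ) (0≤p*p y))
  ... | r , _ , e = bound 0≤1 (ℚ.≤-reflexive (begin
    N ((1ℚ +𝕚 y) ⊗ (1ℚ +𝕚 y) ⊗ ofℚ r)           ≡⟨ trans (N-⊗ ((1ℚ +𝕚 y) ⊗ (1ℚ +𝕚 y)) (ofℚ r)) (cong (_* N (ofℚ r)) (N-⊗ (1ℚ +𝕚 y) (1ℚ +𝕚 y))) ⟩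
    N (1ℚ +𝕚 y) * N (1ℚ +𝕚 y) * N (ofℚ r)       ≡⟨ lem y r ⟩
    ((1ℚ + y * y) * r) * ((1ℚ + y * y) * r)     ≡⟨ cong (λ x → x * x) e ⟩
    1ℚ * 1ℚ                                     ∎))
    where
    open ≡-Reasoning
    lem : ∀ y r → (1ℚ * 1ℚ + y * y) * (1ℚ * 1ℚ + y * y) * (r * r + 0ℚ * 0ℚ) ≡ ((1ℚ + y * y) * r) * ((1ℚ + y * y) * r)
    lem = solve 2 (λ y r → (con (+ 1) :* con (+ 1) :+ y :* y) :* (con (+ 1) :* con (+ 1) :+ y :* y) :* (r :* r :+ con (+ 0) :* con (+ 0))
      := ((con (+ 1) :+ y :* y) :* r) :* ((con (+ 1) :+ y :* y) :* r)) refl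
      where open ℚSolver

opaque

  ‖‖-÷ : ∀ {z r} y → ‖ z ⊗ (1ℚ +𝕚 - y) ‖≤ r → ‖ z ‖≤ r
  ‖‖-÷ {z} y (bound 0≤r p) = bound 0≤r (ℚ.≤-trans
    (≤-by (N z * (y * y)) (trans (N-⊗ z (1ℚ +𝕚 - y)) (lem (N z) y)) (0≤* (0≤N z) (0≤p*p y))) p)
    where
    lem : ∀ n y → n * (1ℚ * 1ℚ + - y * - y) ≡ n + n * (y * y)
    lem = solve 2 (λ n y → n :* (con (+ 1) :* con (+ 1) :+ (:- y) :* (:- y)) := n :+ n :* (y :* y)) refl
      where open ℚSolver

  ‖‖-imaginary : ∀ {y} → 0ℚ ≤ y → ‖ 0ℚ +𝕚 y ‖≤ y
  ‖‖-imaginary {y} 0≤y = bound 0≤y (ℚ.≤-reflexive (lem y))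
    where
    lem : ∀ y → 0ℚ * 0ℚ + y * y ≡ y * y
    lem = solve 1 (λ y → con (+ 0) :* con (+ 0) :+ y :* y := y :* y) refl where open ℚSolver

  cayley-near-1 : ∀ {y} → 0ℚ ≤ y → ‖ cayley y ⊖ 1ᵍ ‖≤ y + y
  cayley-near-1 {y} 0≤y = ‖‖-÷ y (subst (λ z → ‖ z ‖≤ y + y) (sym lem) (‖‖-imaginary (0≤+ 0≤y 0≤y)))
    where
    open ≡-Reasoning
    lem : (cayley y ⊖ 1ᵍ) ⊗ (1ℚ +𝕚 - y) ≡ (0ℚ +𝕚 y + y)
    lem = begin
      (cayley y ⊖ 1ᵍ) ⊗ (1ℚ +𝕚 - y)                   ≡⟨ GSolver.solve 2 (λ c u → (c GSolver.:- GSolver.con (+ 1)) GSolver.:* u GSolver.:= c GSolver.:* u GSolver.:- u) refl (cayley y) (1ℚ +𝕚 - y) ⟩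
      cayley y ⊗ (1ℚ +𝕚 - y) ⊖ (1ℚ +𝕚 - y)            ≡⟨ cong (_⊖ (1ℚ +𝕚 - y)) (cayley-eq y) ⟩
      (1ℚ +𝕚 y) ⊖ (1ℚ +𝕚 - y)                         ≡⟨ cong (0ℚ +𝕚_) (solve 1 (λ y → y :- (:- y) := y :+ y) refl y) ⟩
      (0ℚ +𝕚 y + y)                                   ∎
      where open ℚSolver

  ⊗-fractions : ∀ {x y z u v w u′ v′ w′} → x ⊗ u ≡ u′ → y ⊗ v ≡ v′ → z ⊗ w ≡ w′ →
    (x ⊗ y ⊖ z) ⊗ u ⊗ v ⊗ w ≡ u′ ⊗ v′ ⊗ w ⊖ w′ ⊗ u ⊗ v
  ⊗-fractions {x} {y} {z} {u} {v} {w} refl refl refl =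
    solve 6 (λ x y z u v w → (x :* y :- z) :* u :* v :* w := (x :* u) :* (y :* v) :* w :- (z :* w) :* u :* v) refl x y z u v w
    where open GSolver

  cayley-split : ∀ {a c} → 0ℚ ≤ a → 0ℚ ≤ c →
    ‖ cayley a ⊗ cayley c ⊖ cayley (a + c) ‖≤ a * c * (a + c) + a * c * (a + c)
  cayley-split {a} {c} 0≤a 0≤c = ‖‖-÷ a (‖‖-÷ c (‖‖-÷ (a + c)
    (subst (λ z → ‖ z ‖≤ a * c * (a + c) + a * c * (a + c)) (sym lem) (‖‖-imaginary (0≤+ 0≤e 0≤e)))))
    where
    0≤e : 0ℚ ≤ a * c * (a + c)
    0≤e = 0≤* (0≤* 0≤a 0≤c) (0≤+ 0≤a 0≤c)
    U V : ℚ → ℚ[i]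
    U y = 1ℚ +𝕚 y
    V y = 1ℚ +𝕚 - y
    explicit : ∀ a c → U a ⊗ U c ⊗ V (a + c) ⊖ U (a + c) ⊗ V a ⊗ V c ≡ (0ℚ +𝕚 a * c * (a + c) + a * c * (a + c))
    explicit a c = cong₂ _+𝕚_
      (solve 2 (λ a c → (one :* one :- a :* c) :* one :- (one :* c :+ a :* one) :* (:- (a :+ c))
           :- ((one :* one :- (a :+ c) :* (:- a)) :* one :- (one :* (:- a) :+ (a :+ c) :* one) :* (:- c)) := con (+ 0)) refl a c)
      (solve 2 (λ a c → (one :* one :- a :* c) :* (:- (a :+ c)) :+ (one :* c :+ a :* one) :* one
           :- ((one :* one :- (a :+ c) :* (:- a)) :* (:- c) :+ (one :* (:- a) :+ (a :+ c) :* one) :* one)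
           := a :* c :* (a :+ c) :+ a :* c :* (a :+ c)) refl a c)
      where
      open ℚSolver
      one : ∀ {n} → Polynomial n
      one = con (+ 1)
    lem : (cayley a ⊗ cayley c ⊖ cayley (a + c)) ⊗ V a ⊗ V c ⊗ V (a + c) ≡ (0ℚ +𝕚 a * c * (a + c) + a * c * (a + c))
    lem = trans (⊗-fractions {cayley a} {cayley c} {cayley (a + c)} {V a} {V c} {V (a + c)} (cayley-eq a) (cayley-eq c) (cayley-eq (a + c)))
      (explicit a c)

cayleys : List ℚ → ℚ[i]
cayleys []       = 1ᵍ
cayleys (y ∷ ys) = cayley y ⊗ cayleys ys

total cubes : List ℚ → ℚ
total []       = 0ℚ
total (y ∷ ys) = y + total ys
cubes []       = 0ℚ
cubes (y ∷ ys) = y * y * y + cubes ys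

NonNeg : List ℚ → Set
NonNeg = All (0ℚ ≤_)

opaque

  cayleys-unit : ∀ ys → ‖ cayleys ys ‖≤ 1ℚ
  cayleys-unit []       = ‖‖-1
  cayleys-unit (y ∷ ys) = ‖‖-weaken ℚ.≤-refl (‖‖-⊗ (cayley-unit y) (cayleys-unit ys))

  0≤cubes : ∀ {ys} → NonNeg ys → 0ℚ ≤ cubes ys
  0≤cubes []       = ℚ.≤-refl
  0≤cubes (p ∷ ps) = 0≤+ (0≤* (0≤* p p) p) (0≤cubes ps)

  0≤total : ∀ {ys} → NonNeg ys → 0ℚ ≤ total ys
  0≤total []       = ℚ.≤-refl
  0≤total (p ∷ ps) = 0≤+ p (0≤total ps)

  ⊖-swap : ∀ {z w r} → ‖ z ⊖ w ‖≤ r → ‖ w ⊖ z ‖≤ r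
  ⊖-swap {z} {w} {r} p = subst (λ x → ‖ x ‖≤ r) (lem z w) (‖‖-⊝ p)
    where
    lem : ∀ z w → ⊝ (z ⊖ w) ≡ w ⊖ z
    lem = solve 2 (λ z w → :- (z :- w) := w :- z) refl where open GSolver

  cayleys-near-1 : ∀ {ys} → NonNeg ys → ‖ cayleys ys ⊖ 1ᵍ ‖≤ total ys + total ys
  cayleys-near-1 []                 = ‖‖-ofℚ ℚ.≤-refl
  cayleys-near-1 {y ∷ ys} (p ∷ ps)  = subst₂ ‖_‖≤_ (lem (cayley y) (cayleys ys)) (lem′ y (total ys))
    (‖‖-⊕ (‖‖-⊗ (cayley-unit y) (cayleys-near-1 ps)) (cayley-near-1 p))
    where
    lem : ∀ c z → c ⊗ (z ⊖ 1ᵍ) ⊕ (c ⊖ 1ᵍ) ≡ c ⊗ z ⊖ 1ᵍ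
    lem = solve 2 (λ c z → c :* (z :- con (+ 1)) :+ (c :- con (+ 1)) := c :* z :- con (+ 1)) refl where open GSolver
    lem′ : ∀ y s → 1ℚ * (s + s) + (y + y) ≡ y + s + (y + s)
    lem′ = solve 2 (λ y s → con (+ 1) :* (s :+ s) :+ (y :+ y) := y :+ s :+ (y :+ s)) refl where open ℚSolver

  cayley-step : ∀ {a c e z w} → 0ℚ ≤ a → 0ℚ ≤ c → ‖ w ‖≤ 1ℚ → ‖ z ⊖ cayley c ⊗ w ‖≤ e →
    ‖ cayley a ⊗ z ⊖ cayley (a + c) ⊗ w ‖≤ e + (a * c * (a + c) + a * c * (a + c))
  cayley-step {a} {c} {e} {z} {w} 0≤a 0≤c w≤1 p = subst₂ ‖_‖≤_
    (lem (cayley a) (cayley c) (cayley (a + c)) z w) (cong₂ _+_ (ℚ.*-identityˡ e) (ℚ.*-identityʳ _))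
    (‖‖-⊕ (‖‖-⊗ (cayley-unit a) p) (‖‖-⊗ (cayley-split 0≤a 0≤c) w≤1))
    where
    lem : ∀ x y s z w → x ⊗ (z ⊖ y ⊗ w) ⊕ (x ⊗ y ⊖ s) ⊗ w ≡ x ⊗ z ⊖ s ⊗ w
    lem = solve 5 (λ x y s z w → x :* (z :- y :* w) :+ (x :* y :- s) :* w := x :* z :- s :* w) refl
      where open GSolver

cayleyError : List ℚ → List ℚ → ℚ
cayleyError as bs = cubes as + cubes bs + (ℚ.∣ total as - total bs ∣ + ℚ.∣ total as - total bs ∣)

opaque

  cayleyError-comm : ∀ as bs → cayleyError as bs ≡ cayleyError bs as
  cayleyError-comm as bs = cong₂ _+_ (ℚ.+-comm (cubes as) (cubes bs)) (cong₂ _+_ swap swap)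
    where
    swap : ℚ.∣ total as - total bs ∣ ≡ ℚ.∣ total bs - total as ∣
    swap = trans (cong ℚ.∣_∣ (lem (total as) (total bs))) (ℚ.∣-p∣≡∣p∣ (total bs - total as))
      where
      lem : ∀ x y → x - y ≡ - (y - x)
      lem = solve 2 (λ x y → x :- y := :- (y :- x)) refl where open ℚSolver

  -- The cubes absorb the error of a split: (a + c)³ ≥ c³ + 2ac(a + c).
  cayleyError-step : ∀ {a} c as bs → 0ℚ ≤ a → 0ℚ ≤ c →
    cayleyError as (c ∷ bs) + (a * c * (a + c) + a * c * (a + c)) ≤ cayleyError (a ∷ as) (a + c ∷ bs)
  cayleyError-step {a} c as bs 0≤a 0≤c = subst (λ d → cayleyError as (c ∷ bs) + (e + e) ≤ a * a * a + A + ((a + c) * (a + c) * (a + c) + B) + (ℚ.∣ d ∣ + ℚ.∣ d ∣))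
    (solve 4 (λ a c x y → x :- (c :+ y) := a :+ x :- (a :+ c :+ y)) refl a c (total as) (total bs))
    (≤-by (a * a * a + a * a * a + e)
      (solve 5 (λ a c A B d → a :* a :* a :+ A :+ ((a :+ c) :* (a :+ c) :* (a :+ c) :+ B) :+ (d :+ d)
         := A :+ (c :* c :* c :+ B) :+ (d :+ d) :+ (a :* c :* (a :+ c) :+ a :* c :* (a :+ c))
            :+ (a :* a :* a :+ a :* a :* a :+ a :* c :* (a :+ c))) refl a c A B d)
      (0≤+ (0≤+ (0≤* (0≤* 0≤a 0≤a) 0≤a) (0≤* (0≤* 0≤a 0≤a) 0≤a)) (0≤* (0≤* 0≤a 0≤c) (0≤+ 0≤a 0≤c))))
    where
    open ℚSolver
    A : ℚ
    A = cubes as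
    B : ℚ
    B = cubes bs
    e : ℚ
    e = a * c * (a + c)
    d : ℚ
    d = ℚ.∣ total as - (c + total bs) ∣

  -- Merging the two lists: the smaller of the two heads is split off the larger one.
  cayleys-close : ∀ n {as bs} → length as ℕ.+ length bs ℕ.≤ n → NonNeg as → NonNeg bs →
    ‖ cayleys as ⊖ cayleys bs ‖≤ cayleyError as bs
  cayleys-close n {[]} {bs} _ [] ps = ‖‖-weaken le (⊖-swap (cayleys-near-1 ps))
    where
    T : ℚ
    T = total bs
    open ℚ.≤-Reasoning
    T≡ : ℚ.∣ 0ℚ - T ∣ ≡ T
    T≡ = trans (cong ℚ.∣_∣ (ℚ.+-identityˡ (- T))) (trans (ℚ.∣-p∣≡∣p∣ T) (ℚ.0≤p⇒∣p∣≡p (0≤total ps)))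
    le : T + T ≤ cayleyError [] bs
    le = subst (λ d → T + T ≤ 0ℚ + cubes bs + (d + d)) (sym T≡)
      (≤-by (0ℚ + cubes bs) (ℚ.+-comm (0ℚ + cubes bs) (T + T)) (0≤+ ℚ.≤-refl (0≤cubes ps)))
  cayleys-close n {a ∷ as} {[]} l ps [] = subst (‖ cayleys (a ∷ as) ⊖ 1ᵍ ‖≤_) (cayleyError-comm [] (a ∷ as))
    (⊖-swap (cayleys-close n (subst (ℕ._≤ n) (ℕ.+-comm (suc (length as)) 0) l) [] ps))
  cayleys-close (suc n) {a ∷ as} {b ∷ bs} (ℕ.s≤s l) (p ∷ ps) (q ∷ qs) with ℚ.≤-total a b
  ... | inj₁ a≤b = subst (λ x → ‖ cayley a ⊗ cayleys as ⊖ cayley x ⊗ cayleys bs ‖≤ cayleyError (a ∷ as) (x ∷ bs)) (lem a b)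
      (‖‖-weaken (cayleyError-step (b - a) as bs p (0≤q-p a≤b))
        (cayley-step p (0≤q-p a≤b) (cayleys-unit bs) (cayleys-close n {as} {b - a ∷ bs} l ps (0≤q-p a≤b ∷ qs))))
    where
    lem : ∀ a b → a + (b - a) ≡ b
    lem = solve 2 (λ a b → a :+ (b :- a) := b) refl where open ℚSolver
  ... | inj₂ b≤a = ⊖-swap {cayleys (b ∷ bs)} {cayleys (a ∷ as)} (subst (‖ cayleys (b ∷ bs) ⊖ cayleys (a ∷ as) ‖≤_) (cayleyError-comm (b ∷ bs) (a ∷ as))
      (subst (λ x → ‖ cayley b ⊗ cayleys bs ⊖ cayley x ⊗ cayleys as ‖≤ cayleyError (b ∷ bs) (x ∷ as)) (lem b a)
      (‖‖-weaken (cayleyError-step (a - b) bs as q (0≤q-p b≤a))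
        (cayley-step q (0≤q-p b≤a) (cayleys-unit as) (cayleys-close n {bs} {a - b ∷ as} l′ qs (0≤q-p b≤a ∷ ps))))))
    where
    l′ : length bs ℕ.+ suc (length as) ℕ.≤ n
    l′ = subst (ℕ._≤ n) (trans (ℕ.+-suc (length as) (length bs))
           (trans (cong suc (ℕ.+-comm (length as) (length bs))) (sym (ℕ.+-suc (length bs) (length as))))) l
    lem : ∀ a b → a + (b - a) ≡ b
    lem = solve 2 (λ a b → a :+ (b :- a) := b) refl where open ℚSolver

opaque

  /-mono : ∀ a b c d .{{_ : NonZero b}} .{{_ : NonZero d}} → a ℕ.* d ℕ.≤ c ℕ.* b → + a / b ≤ + c / d
  /-mono a b c d le = *-cancelˡ-≤ (ι b * ι d) (0<* (0<ι b) (0<ι d)) (subst₂ _≤_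
    (trans (ι-* a d) (trans (cong (_* ι d) (sym (ι-/ a b))) (lem (ι b) (+ a / b) (ι d))))
    (trans (ι-* c b) (trans (cong (_* ι b) (sym (ι-/ c d))) (lem′ (ι b) (+ c / d) (ι d))))
    (ι-mono le))
    where
    open ℚSolver
    lem : ∀ x y z → x * y * z ≡ x * z * y
    lem = solve 3 (λ x y z → x :* y :* z := x :* z :* y) refl
    lem′ : ∀ x y z → z * y * x ≡ x * z * y
    lem′ = solve 3 (λ x y z → z :* y :* x := x :* z :* y) refl

  0≤/ : ∀ a b .{{_ : NonZero b}} → 0ℚ ≤ + a / b
  0≤/ a b = /-mono 0 1 a b ℕ.z≤n

  ∑ℚ-mono : ∀ n {f g} → (∀ k → f k ≤ g k) → ∑ℚ n f ≤ ∑ℚ n g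
  ∑ℚ-mono zero    p = ℚ.≤-refl
  ∑ℚ-mono (suc n) p = ℚ.+-mono-≤ (∑ℚ-mono n p) (p n)

  ∑ℚ-const : ∀ n c → ∑ℚ n (λ _ → c) ≡ ι n * c
  ∑ℚ-const zero    c = sym (ℚ.*-zeroˡ c)
  ∑ℚ-const (suc n) c = begin
    ∑ℚ n (λ _ → c) + c     ≡⟨ cong (_+ c) (∑ℚ-const n c) ⟩
    ι n * c + c            ≡⟨ solve 2 (λ n c → n :* c :+ c := (con (+ 1) :+ n) :* c) refl (ι n) c ⟩
    (ι 1 + ι n) * c        ≡⟨ cong (_* c) (ι-+ 1 n) ⟨
    ι (suc n) * c          ∎
    where
    open ≡-Reasoning
    open ℚSolver

  ∑ℚ-shift : ∀ n f → f 0 + ∑ℚ n (λ k → f (suc k)) ≡ ∑ℚ n f + f n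
  ∑ℚ-shift zero    f = ℚ.+-comm (f 0) 0ℚ
  ∑ℚ-shift (suc n) f = trans (sym (ℚ.+-assoc (f 0) _ _)) (cong (_+ f (suc n)) (∑ℚ-shift n f))

  cayleys-++ : ∀ as bs → cayleys (as ++ bs) ≡ cayleys as ⊗ cayleys bs
  cayleys-++ []       bs = sym (Gℚ.*-identityˡ (cayleys bs))
  cayleys-++ (a ∷ as) bs = trans (cong (cayley a ⊗_) (cayleys-++ as bs)) (sym (Gℚ.*-assoc (cayley a) (cayleys as) (cayleys bs)))

  total-++ : ∀ as bs → total (as ++ bs) ≡ total as + total bs
  total-++ []       bs = sym (ℚ.+-identityˡ (total bs))
  total-++ (a ∷ as) bs = trans (cong (λ x → a + x) (total-++ as bs)) (sym (ℚ.+-assoc a (total as) (total bs)))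

  cubes-++ : ∀ as bs → cubes (as ++ bs) ≡ cubes as + cubes bs
  cubes-++ []       bs = sym (ℚ.+-identityˡ (cubes bs))
  cubes-++ (a ∷ as) bs = trans (cong (λ x → a * a * a + x) (cubes-++ as bs)) (sym (ℚ.+-assoc (a * a * a) (cubes as) (cubes bs)))

  total-applyDownFrom : ∀ f n → total (applyDownFrom f n) ≡ ∑ℚ n f
  total-applyDownFrom f zero    = refl
  total-applyDownFrom f (suc n) = trans (ℚ.+-comm (f n) _) (cong (_+ f n) (total-applyDownFrom f n))

  cubes-applyDownFrom : ∀ f n → cubes (applyDownFrom f n) ≡ ∑ℚ n (λ k → f k * f k * f k)
  cubes-applyDownFrom f zero    = refl
  cubes-applyDownFrom f (suc n) = trans (ℚ.+-comm (f n * f n * f n) _) (cong (_+ f n * f n * f n) (cubes-applyDownFrom f n))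

  cayleys-replicate : ∀ n y → cayleys (replicate n y) ≡ cayley y ^ᵍ n
  cayleys-replicate zero    y = refl
  cayleys-replicate (suc n) y = cong (cayley y ⊗_) (cayleys-replicate n y)

  total-replicate : ∀ n y → total (replicate n y) ≡ ι n * y
  total-replicate n y = trans (lem n) (∑ℚ-const n y)
    where
    lem : ∀ n → total (replicate n y) ≡ ∑ℚ n (λ _ → y)
    lem zero    = refl
    lem (suc n) = trans (ℚ.+-comm y _) (cong (_+ y) (lem n))

  cubes-replicate : ∀ n y → cubes (replicate n y) ≡ ι n * (y * y * y)
  cubes-replicate n y = trans (lem n) (∑ℚ-const n (y * y * y))
    where
    lem : ∀ n → cubes (replicate n y) ≡ ∑ℚ n (λ _ → y * y * y)
    lem zero    = refl
    lem (suc n) = trans (ℚ.+-comm (y * y * y) _) (cong (_+ y * y * y) (lem n))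

module _ (j : ℕ) where

  private
    m : ℕ
    m = suc j

    D : ℕ → ℕ
    D k = m ℕ.* m ℕ.+ k ℕ.* k ℕ.+ k

    η : ℚ
    η = + 1 / m

  -- The points 1 + ik/m divide the segment from 1 to 1 + i; consecutive points
  -- subtend an angle with tangent m/(m² + k² + k).
  tangent : ℕ → ℚ
  tangent k = + m / D k

  tangents : List ℚ
  tangents = applyDownFrom tangent m

  opaque

    private
      ι-D : ∀ k → ι (D k) ≡ ι m * ι m + ι k * ι k + ι k
      ι-D k = trans (ι-+ (m ℕ.* m ℕ.+ k ℕ.* k) k) (cong (_+ ι k)
        (trans (ι-+ (m ℕ.* m) (k ℕ.* k)) (cong₂ _+_ (ι-* m m) (ι-* k k))))

      scaled : ∀ x y → x * y ≡ ι m → ofℚ x ⊗ (1ℚ +𝕚 y) ≡ (x +𝕚 ι m)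
      scaled x y e = cong₂ _+𝕚_
        (solve 2 (λ x y → x :* con (+ 1) :- con (+ 0) :* y := x) refl x y)
        (trans (solve 2 (λ x y → x :* y :+ con (+ 0) :* con (+ 1) := x :* y) refl x y) e)
        where open ℚSolver

      scaled′ : ∀ x y → x * y ≡ ι m → ofℚ x ⊗ (1ℚ +𝕚 - y) ≡ (x +𝕚 - ι m)
      scaled′ x y e = cong₂ _+𝕚_
        (solve 2 (λ x y → x :* con (+ 1) :- con (+ 0) :* (:- y) := x) refl x y)
        (trans (solve 2 (λ x y → x :* (:- y) :+ con (+ 0) :* con (+ 1) := :- (x :* y)) refl x y) (cong -_ e))
        where open ℚSolver

      factor : ∀ k → (ι m +𝕚 ι (suc k)) ⊗ (ι m +𝕚 - ι k) ≡ (ι (D k) +𝕚 ι m)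
      factor k = subst₂ (λ s d → (ι m +𝕚 s) ⊗ (ι m +𝕚 - ι k) ≡ (d +𝕚 ι m)) (sym (ι-+ 1 k)) (sym (ι-D k))
        (cong₂ _+𝕚_
          (solve 2 (λ m k → m :* m :- (con (+ 1) :+ k) :* (:- k) := m :* m :+ k :* k :+ k) refl (ι m) (ι k))
          (solve 2 (λ m k → m :* (:- k) :+ (con (+ 1) :+ k) :* m := m) refl (ι m) (ι k)))
        where open ℚSolver

      factor′ : ∀ k → (ι m +𝕚 - ι (suc k)) ⊗ (ι m +𝕚 ι k) ≡ (ι (D k) +𝕚 - ι m)
      factor′ k = subst₂ (λ s d → (ι m +𝕚 - s) ⊗ (ι m +𝕚 ι k) ≡ (d +𝕚 - ι m)) (sym (ι-+ 1 k)) (sym (ι-D k))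
        (cong₂ _+𝕚_
          (solve 2 (λ m k → m :* m :- (:- (con (+ 1) :+ k)) :* k := m :* m :+ k :* k :+ k) refl (ι m) (ι k))
          (solve 2 (λ m k → m :* k :+ (:- (con (+ 1) :+ k)) :* m := :- m) refl (ι m) (ι k)))
        where open ℚSolver

      cayley-tangent : ∀ k → cayley (tangent k) ⊗ (ι (D k) +𝕚 - ι m) ≡ (ι (D k) +𝕚 ι m)
      cayley-tangent k = begin
        c ⊗ (ι (D k) +𝕚 - ι m)              ≡⟨ cong (c ⊗_) (scaled′ (ι (D k)) y e) ⟨
        c ⊗ (ofℚ (ι (D k)) ⊗ (1ℚ +𝕚 - y))   ≡⟨ swap c (ofℚ (ι (D k))) (1ℚ +𝕚 - y) ⟩
        ofℚ (ι (D k)) ⊗ (c ⊗ (1ℚ +𝕚 - y))   ≡⟨ cong (ofℚ (ι (D k)) ⊗_) (cayley-eq y) ⟩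
        ofℚ (ι (D k)) ⊗ (1ℚ +𝕚 y)           ≡⟨ scaled (ι (D k)) y e ⟩
        (ι (D k) +𝕚 ι m)                    ∎
        where
        open ≡-Reasoning
        y : ℚ
        y = tangent k
        c : ℚ[i]
        c = cayley y
        e : ι (D k) * y ≡ ι m
        e = ι-/ m (D k)
        swap : ∀ x y z → x ⊗ (y ⊗ z) ≡ y ⊗ (x ⊗ z)
        swap = solve 3 (λ x y z → x :* (y :* z) := y :* (x :* z)) refl where open GSolver

      0<N-point : ∀ y → 0ℚ < N (ι m +𝕚 y)
      0<N-point y = ℚ.+-mono-<-≤ (0<* (0<ι m) (0<ι m)) (0≤p*p y)

      telescope : ∀ k → cayleys (applyDownFrom tangent k) ⊗ (ι m +𝕚 - ι k) ≡ (ι m +𝕚 ι k)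
      telescope zero    = Gℚ.*-identityˡ (ι m +𝕚 0ℚ)
      telescope (suc k) = ⊗-cancelˡ {ι m +𝕚 ι k} (0<N-point (ι k)) (begin
        u ⊗ (c ⊗ P ⊗ v′)       ≡⟨ rearrange u c P v′ ⟩
        c ⊗ (v′ ⊗ u) ⊗ P       ≡⟨ cong (λ x → c ⊗ x ⊗ P) (factor′ k) ⟩
        c ⊗ (ι (D k) +𝕚 - ι m) ⊗ P  ≡⟨ cong (_⊗ P) (cayley-tangent k) ⟩
        (ι (D k) +𝕚 ι m) ⊗ P   ≡⟨ cong (_⊗ P) (factor k) ⟨
        u′ ⊗ v ⊗ P             ≡⟨ rearrange′ u′ v P ⟩
        P ⊗ v ⊗ u′             ≡⟨ cong (_⊗ u′) (telescope k) ⟩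
        u ⊗ u′                 ∎)
        where
        open ≡-Reasoning
        u v u′ v′ c P : ℚ[i]
        u  = ι m +𝕚 ι k
        v  = ι m +𝕚 - ι k
        u′ = ι m +𝕚 ι (suc k)
        v′ = ι m +𝕚 - ι (suc k)
        c  = cayley (tangent k)
        P  = cayleys (applyDownFrom tangent k)
        rearrange : ∀ u c P v → u ⊗ (c ⊗ P ⊗ v) ≡ c ⊗ (v ⊗ u) ⊗ P
        rearrange = solve 4 (λ u c P v → u :* (c :* P :* v) := c :* (v :* u) :* P) refl where open GSolver
        rearrange′ : ∀ u v P → u ⊗ v ⊗ P ≡ P ⊗ v ⊗ u
        rearrange′ = solve 3 (λ u v P → u :* v :* P := P :* v :* u) refl where open GSolver

      cayleys-tangents : cayleys tangents ≡ iᵍ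
      cayleys-tangents = ⊗-cancelˡ {ι m +𝕚 - ι m} (0<N-point (- ι m))
        (trans (Gℚ.*-comm (ι m +𝕚 - ι m) (cayleys tangents)) (trans (telescope m) (sym (lem (ι m)))))
        where
        lem : ∀ x → (x +𝕚 - x) ⊗ iᵍ ≡ (x +𝕚 x)
        lem x = cong₂ _+𝕚_
          (solve 1 (λ x → x :* con (+ 0) :- (:- x) :* con (+ 1) := x) refl x)
          (solve 1 (λ x → x :* con (+ 1) :+ (:- x) :* con (+ 0) := x) refl x)
          where open ℚSolver

  fourTangents : List ℚ
  fourTangents = (tangents ++ tangents) ++ (tangents ++ tangents)

  opaque

    cayleys-fourTangents : cayleys fourTangents ≡ 1ᵍ
    cayleys-fourTangents = trans (cayleys-++ (tangents ++ tangents) (tangents ++ tangents))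
      (cong₂ _⊗_ half half)
      where
      half : cayleys (tangents ++ tangents) ≡ iᵍ ⊗ iᵍ
      half = trans (cayleys-++ tangents tangents) (cong₂ _⊗_ cayleys-tangents cayleys-tangents)

    fourTangents-nonNeg : NonNeg fourTangents
    fourTangents-nonNeg = All.++⁺ (All.++⁺ nonNeg nonNeg) (All.++⁺ nonNeg nonNeg)
      where
      nonNeg : NonNeg tangents
      nonNeg = All.applyDownFrom⁺₂ tangent m (λ k → 0≤/ m (D k))

    private
      four : ∀ k → tangent k + tangent k + (tangent k + tangent k) ≡ + (4 ℕ.* m) / D k
      four k = *-cancelˡ-≡ (ι (D k)) (0<ι (D k)) e
        where
        open ≡-Reasoning
        e : ι (D k) * (tangent k + tangent k + (tangent k + tangent k)) ≡ ι (D k) * (+ (4 ℕ.* m) / D k)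
        e = begin
          ι (D k) * (tangent k + tangent k + (tangent k + tangent k))
            ≡⟨ solve 2 (λ d y → d :* (y :+ y :+ (y :+ y)) := con (+ 4) :* (d :* y)) refl (ι (D k)) (tangent k) ⟩
          ι 4 * (ι (D k) * tangent k)      ≡⟨ cong (ι 4 *_) (ι-/ m (D k)) ⟩
          ι 4 * ι m                        ≡⟨ ι-* 4 m ⟨
          ι (4 ℕ.* m)                      ≡⟨ ι-/ (4 ℕ.* m) (D k) ⟨
          ι (D k) * (+ (4 ℕ.* m) / D k)    ∎
          where open ℚSolver

      total-four : total fourTangents ≡ ∑ℚ m (λ k → + (4 ℕ.* m) / D k)
      total-four = begin
        total fourTangents                     ≡⟨ total-++ (tangents ++ tangents) (tangents ++ tangents) ⟩
        total (tangents ++ tangents) + total (tangents ++ tangents)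
          ≡⟨ cong (λ x → x + x) (total-++ tangents tangents) ⟩
        T + T + (T + T)                        ≡⟨ cong (λ x → x + x + (x + x)) (total-applyDownFrom tangent m) ⟩
        s m + s m + (s m + s m)                ≡⟨ lem m ⟩
        ∑ℚ m (λ k → + (4 ℕ.* m) / D k)         ∎
        where
        open ≡-Reasoning
        T : ℚ
        T = total tangents
        s : ℕ → ℚ
        s n = ∑ℚ n tangent
        lem : ∀ n → s n + s n + (s n + s n) ≡ ∑ℚ n (λ k → + (4 ℕ.* m) / D k)
        lem zero    = refl
        lem (suc n) = trans
          (solve 2 (λ s y → s :+ y :+ (s :+ y) :+ (s :+ y :+ (s :+ y)) := s :+ s :+ (s :+ s) :+ (y :+ y :+ (y :+ y)))
            refl (s n) (tangent n))
          (cong₂ _+_ (lem n) (four n))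
          where open ℚSolver

      term≤ : ∀ k → riemannTerm j k ≤ + 4 / m
      term≤ k = /-mono (4 ℕ.* m) (m ℕ.* m ℕ.+ k ℕ.* k) 4 m (ℕ.≤-trans
        (ℕ.≤-reflexive (ℕ.*-assoc 4 m m)) (ℕ.*-monoʳ-≤ 4 (ℕ.m≤m+n (m ℕ.* m) (k ℕ.* k))))

    riemannSum≤4 : riemannSum j ≤ ι 4
    riemannSum≤4 = ℚ.≤-trans (∑ℚ-mono m term≤) (ℚ.≤-reflexive (trans (∑ℚ-const m (+ 4 / m)) (ι-/ 4 m)))

    0≤riemannSum : 0ℚ ≤ riemannSum j
    0≤riemannSum = subst (_≤ riemannSum j) (trans (∑ℚ-const m 0ℚ) (ℚ.*-zeroʳ (ι m)))
      (∑ℚ-mono m (λ k → 0≤/ (4 ℕ.* m) (m ℕ.* m ℕ.+ k ℕ.* k)))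

    -- 4m/(m² + k² + k) lies between the Riemann terms with indices k + 1 and k.
    riemannSum-tangents : ℚ.∣ total fourTangents - riemannSum j ∣ ≤ + 4 / m
    riemannSum-tangents = subst (λ x → ℚ.∣ x - R ∣ ≤ + 4 / m) (sym total-four) (∣∣≤
      (ℚ.≤-trans (≤-by (R - Q) (lem₁ Q R) (0≤q-p (∑ℚ-mono m upper))) (0≤/ 4 m))
      (≤-by (Q - ∑ℚ m (λ k → riemannTerm j (suc k)) + (+ 4 / m - riemannTerm j 0) + riemannTerm j m)
        (trans (lem₂ Q R (+ 4 / m) (riemannTerm j 0) (∑ℚ m (λ k → riemannTerm j (suc k))) (riemannTerm j m))
          (trans (cong (λ x → - (Q - R) + (Q - S′ + (+ 4 / m - riemannTerm j 0) + riemannTerm j m + (x - (R + riemannTerm j m)))) (∑ℚ-shift m (riemannTerm j)))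
            (lem₃ (- (Q - R)) (Q - S′ + (+ 4 / m - riemannTerm j 0) + riemannTerm j m) (R + riemannTerm j m))))
        (0≤+ (0≤+ (0≤q-p (∑ℚ-mono m lower)) (0≤q-p (term≤ 0))) (0≤/ (4 ℕ.* m) (m ℕ.* m ℕ.+ m ℕ.* m)))))
      where
      Q R S′ : ℚ
      Q = ∑ℚ m (λ k → + (4 ℕ.* m) / D k)
      R = riemannSum j
      S′ = ∑ℚ m (λ k → riemannTerm j (suc k))
      open ℚSolver
      upper : ∀ k → + (4 ℕ.* m) / D k ≤ riemannTerm j k
      upper k = /-mono (4 ℕ.* m) (D k) (4 ℕ.* m) (m ℕ.* m ℕ.+ k ℕ.* k)
        (ℕ.*-monoʳ-≤ (4 ℕ.* m) (ℕ.m≤m+n (m ℕ.* m ℕ.+ k ℕ.* k) k))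
      lower : ∀ k → riemannTerm j (suc k) ≤ + (4 ℕ.* m) / D k
      lower k = /-mono (4 ℕ.* m) (m ℕ.* m ℕ.+ suc k ℕ.* suc k) (4 ℕ.* m) (D k)
        (ℕ.*-monoʳ-≤ (4 ℕ.* m) (ℕ.≤-trans (ℕ.≤-reflexive (ℕ.+-assoc (m ℕ.* m) (k ℕ.* k) k))
          (ℕ.+-monoʳ-≤ (m ℕ.* m) (ℕ.≤-trans (ℕ.≤-reflexive (trans (ℕ.+-comm (k ℕ.* k) k) (sym (ℕ.*-suc k k)))) (ℕ.m≤n+m (k ℕ.* suc k) (suc k))))))
      lem₁ : ∀ x y → 0ℚ ≡ x - y + (y - x)
      lem₁ = solve 2 (λ x y → con (+ 0) := x :- y :+ (y :- x)) refl
      lem₂ : ∀ q r f t s u → f ≡ - (q - r) + (q - s + (f - t) + u + ((t + s) - (r + u)))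
      lem₂ = solve 6 (λ q r f t s u → f := :- (q :- r) :+ (q :- s :+ (f :- t) :+ u :+ ((t :+ s) :- (r :+ u)))) refl
      lem₃ : ∀ x y z → x + (y + (z - z)) ≡ x + y
      lem₃ = solve 3 (λ x y z → x :+ (y :+ (z :- z)) := x :+ y) refl

    cubes-fourTangents : cubes fourTangents ≤ + 4 / m
    cubes-fourTangents = begin
      cubes fourTangents                 ≡⟨ cubes-++ (tangents ++ tangents) (tangents ++ tangents) ⟩
      cubes (tangents ++ tangents) + cubes (tangents ++ tangents)
                                         ≡⟨ cong (λ x → x + x) (cubes-++ tangents tangents) ⟩
      c + c + (c + c)                    ≤⟨ ℚ.+-mono-≤ (ℚ.+-mono-≤ c≤η c≤η) (ℚ.+-mono-≤ c≤η c≤η) ⟩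
      η + η + (η + η)                    ≡⟨ solve 1 (λ x → x :+ x :+ (x :+ x) := con (+ 4) :* x) refl η ⟩
      ι 4 * η                            ≤⟨ *-cancelˡ-≤ (ι m) (0<ι m) (ℚ.≤-reflexive 4η) ⟩
      + 4 / m                            ∎
      where
      open ℚ.≤-Reasoning
      open ℚSolver
      c : ℚ
      c = cubes tangents
      4η : ι m * (ι 4 * η) ≡ ι m * (+ 4 / m)
      4η = trans (solve 2 (λ m x → m :* (con (+ 4) :* x) := con (+ 4) :* (m :* x)) refl (ι m) η)
        (trans (cong (ι 4 *_) (ι-/ 1 m)) (sym (ι-/ 4 m)))
      y≤η : ∀ k → tangent k ≤ η
      y≤η k = /-mono m (D k) 1 m (ℕ.≤-trans (ℕ.≤-trans (ℕ.m≤m+n (m ℕ.* m) (k ℕ.* k)) (ℕ.m≤m+n _ k))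
        (ℕ.≤-reflexive (sym (ℕ.*-identityˡ (D k)))))
      y≤1 : ∀ k → tangent k ≤ 1ℚ
      y≤1 k = ℚ.≤-trans (y≤η k) (/-mono 1 m 1 1 (ℕ.s≤s ℕ.z≤n))
      0≤y : ∀ k → 0ℚ ≤ tangent k
      0≤y k = 0≤/ m (D k)
      0≤η : 0ℚ ≤ η
      0≤η = 0≤/ 1 m
      cube≤ : ∀ k → tangent k * tangent k * tangent k ≤ η * η
      cube≤ k = subst (tangent k * tangent k * tangent k ≤_) (ℚ.*-identityʳ (η * η))
        (*-mono-≤ (0≤y k) (0≤* 0≤η 0≤η) (*-mono-≤ (0≤y k) 0≤η (y≤η k) (y≤η k)) (y≤1 k))
      c≤η : c ≤ η
      c≤η = begin
        c                          ≡⟨ cubes-applyDownFrom tangent m ⟩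
        ∑ℚ m (λ k → tangent k * tangent k * tangent k)  ≤⟨ ∑ℚ-mono m cube≤ ⟩
        ∑ℚ m (λ _ → η * η)         ≡⟨ ∑ℚ-const m (η * η) ⟩
        ι m * (η * η)              ≡⟨ ℚ.*-assoc (ι m) η η ⟨
        ι m * η * η                ≡⟨ cong (_* η) (ι-/ 1 m) ⟩
        1ℚ * η                     ≡⟨ ℚ.*-identityˡ η ⟩
        η                          ∎

opaque

  ^ᵍ-unit : ∀ {z} → ‖ z ‖≤ 1ℚ → ∀ n → ‖ z ^ᵍ n ‖≤ 1ℚ
  ^ᵍ-unit p zero    = ‖‖-1
  ^ᵍ-unit p (suc n) = ‖‖-⊗ p (^ᵍ-unit p n)

  ^ᵍ-close : ∀ {z w d} → ‖ z ‖≤ 1ℚ → ‖ w ⊖ z ‖≤ d → ∀ n → ι n * d + ι n * d ≤ 1ℚ →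
    ‖ w ^ᵍ n ⊖ z ^ᵍ n ‖≤ ι n * d + ι n * d
  ^ᵍ-close {d = d} p q zero    _ = subst (‖ 1ᵍ ⊖ 1ᵍ ‖≤_) (solve 1 (λ d → con (+ 0) := con (+ 0) :* d :+ con (+ 0) :* d) refl d) (‖‖-ofℚ ℚ.≤-refl)
    where open ℚSolver
  ^ᵍ-close {z} {w} {d} p q (suc n) le = subst (‖_‖≤ ι (suc n) * d + ι (suc n) * d) (alg z w (z ^ᵍ n) (w ^ᵍ n))
    (‖‖-weaken bnd (‖‖-⊕ (‖‖-⊗ w≤ (^ᵍ-close p q n le′)) (‖‖-⊗ q (^ᵍ-unit p n))))
    where
    0≤d : 0ℚ ≤ d
    0≤d = 0≤r q
    alg : ∀ z w u v → w ⊗ (v ⊖ u) ⊕ (w ⊖ z) ⊗ u ≡ w ⊗ v ⊖ z ⊗ u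
    alg = solve 4 (λ z w u v → w :* (v :- u) :+ (w :- z) :* u := w :* v :- z :* u) refl where open GSolver
    w≤ : ‖ w ‖≤ 1ℚ + d
    w≤ = subst (‖_‖≤ 1ℚ + d) (solve 2 (λ z w → z :+ (w :- z) := w) refl z w) (‖‖-⊕ p q) where open GSolver
    step : ∀ x d → (1ℚ + x) * d + (1ℚ + x) * d ≡ x * d + x * d + (d + d)
    step = solve 2 (λ x d → (con (+ 1) :+ x) :* d :+ (con (+ 1) :+ x) :* d := x :* d :+ x :* d :+ (d :+ d)) refl where open ℚSolver
    e : ι (suc n) * d + ι (suc n) * d ≡ ι n * d + ι n * d + (d + d)
    e = trans (cong (λ x → x * d + x * d) (ι-+ 1 n)) (step (ι n) d)
    le′ : ι n * d + ι n * d ≤ 1ℚ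
    le′ = ℚ.≤-trans (≤-by (d + d) e (0≤+ 0≤d 0≤d)) le
    bnd : (1ℚ + d) * (ι n * d + ι n * d) + d * 1ℚ ≤ ι (suc n) * d + ι (suc n) * d
    bnd = ≤-by (d * (1ℚ - (ι n * d + ι n * d)))
      (trans e (lem (ι n * d + ι n * d) d)) (0≤* 0≤d (0≤q-p le′))
      where
      lem : ∀ y d → y + (d + d) ≡ (1ℚ + d) * y + d * 1ℚ + d * (1ℚ - y)
      lem = solve 2 (λ y d → y :+ (d :+ d) := (con (+ 1) :+ d) :* y :+ d :* con (+ 1) :+ d :* (con (+ 1) :- y)) refl
        where open ℚSolver

  cayley-linear : ∀ v → ‖ (1ℚ +𝕚 v + v) ⊖ cayley v ‖≤ v * v + v * v
  cayley-linear v = ‖‖-÷ v (subst (‖_‖≤ v * v + v * v) (sym lem) (‖‖-ofℚ (0≤+ (0≤p*p v) (0≤p*p v))))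
    where
    explicit : ∀ v → (1ℚ +𝕚 v + v) ⊗ (1ℚ +𝕚 - v) ⊖ (1ℚ +𝕚 v) ≡ ofℚ (v * v + v * v)
    explicit v = cong₂ _+𝕚_
      (solve 1 (λ v → con (+ 1) :* con (+ 1) :- (v :+ v) :* (:- v) :- con (+ 1) := v :* v :+ v :* v) refl v)
      (solve 1 (λ v → con (+ 1) :* (:- v) :+ (v :+ v) :* con (+ 1) :- v := con (+ 0)) refl v)
      where open ℚSolver
    distrib : ∀ x y u → (x ⊖ y) ⊗ u ≡ x ⊗ u ⊖ y ⊗ u
    distrib = solve 3 (λ x y u → (x :- y) :* u := x :* u :- y :* u) refl where open GSolver
    lem : ((1ℚ +𝕚 v + v) ⊖ cayley v) ⊗ (1ℚ +𝕚 - v) ≡ ofℚ (v * v + v * v)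
    lem = trans (distrib (1ℚ +𝕚 v + v) (cayley v) (1ℚ +𝕚 - v))
      (trans (cong ((1ℚ +𝕚 v + v) ⊗ (1ℚ +𝕚 - v) ⊖_) (cayley-eq v)) (explicit v))

  compound-near-1 : ∀ j M .{{_ : NonZero M}} v → 0ℚ ≤ v → ι M * v ≡ riemannSum j → 64 ℕ.≤ M →
    ‖ (1ℚ +𝕚 v + v) ^ᵍ M ⊖ 1ᵍ ‖≤ ι 3 * (+ 4 / suc j) + ι 128 * (+ 1 / M)
  compound-near-1 j M v 0≤v Mv≡R 64≤M = subst (‖_‖≤ ι 3 * κ + ι 128 * μ)
    (telescope ((1ℚ +𝕚 v + v) ^ᵍ M) (cayley v ^ᵍ M))
    (‖‖-weaken total≤ (‖‖-⊕ (^ᵍ-close (cayley-unit v) (cayley-linear v) M (ℚ.≤-trans Md≤ 64μ≤1)) rotation))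
    where
    κ μ R : ℚ
    κ = + 4 / suc j
    μ = + 1 / M
    R = riemannSum j
    as bs : List ℚ
    as = fourTangents j
    bs = replicate M v
    0≤μ : 0ℚ ≤ μ
    0≤μ = 0≤/ 1 M
    telescope : ∀ x y → (x ⊖ y) ⊕ (y ⊖ 1ᵍ) ≡ x ⊖ 1ᵍ
    telescope = solve 2 (λ x y → (x :- y) :+ (y :- con (+ 1)) := x :- con (+ 1)) refl where open GSolver
    v≤4μ : v ≤ ι 4 * μ
    v≤4μ = *-cancelˡ-≤ (ι M) (0<ι M) (subst₂ _≤_ (sym Mv≡R)
      (sym (trans (solve 2 (λ m x → m :* (con (+ 4) :* x) := con (+ 4) :* (m :* x)) refl (ι M) μ)
        (trans (cong (ι 4 *_) (ι-/ 1 M)) (ℚ.*-identityʳ (ι 4))))) (riemannSum≤4 j))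
      where open ℚSolver
    64μ≤1 : ι 64 * μ ≤ 1ℚ
    64μ≤1 = ℚ.≤-trans (*-mono-≤ 0≤μ (0≤ι M) (ι-mono 64≤M) ℚ.≤-refl) (ℚ.≤-reflexive (ι-/ 1 M))
    Rv≤ : R * v ≤ ι 4 * (ι 4 * μ)
    Rv≤ = *-mono-≤ 0≤v (0≤ι 4) (riemannSum≤4 j) v≤4μ
    Md≤ : ι M * (v * v + v * v) + ι M * (v * v + v * v) ≤ ι 64 * μ
    Md≤ = begin
      ι M * (v * v + v * v) + ι M * (v * v + v * v)
        ≡⟨ solve 2 (λ m v → m :* (v :* v :+ v :* v) :+ m :* (v :* v :+ v :* v) := con (+ 4) :* (m :* v :* v)) refl (ι M) v ⟩
      ι 4 * (ι M * v * v)        ≡⟨ cong (λ x → ι 4 * (x * v)) Mv≡R ⟩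
      ι 4 * (R * v)              ≤⟨ *-monoˡ-≤ (ι 4) (0≤ι 4) Rv≤ ⟩
      ι 4 * (ι 4 * (ι 4 * μ))    ≡⟨ solve 1 (λ x → con (+ 4) :* (con (+ 4) :* (con (+ 4) :* x)) := con (+ 64) :* x) refl μ ⟩
      ι 64 * μ                   ∎
      where
      open ℚ.≤-Reasoning
      open ℚSolver
    cubes≤ : cubes bs ≤ ι 64 * μ
    cubes≤ = begin
      cubes bs                   ≡⟨ cubes-replicate M v ⟩
      ι M * (v * v * v)          ≡⟨ solve 2 (λ m v → m :* (v :* v :* v) := v :* (m :* v :* v)) refl (ι M) v ⟩
      v * (ι M * v * v)          ≡⟨ cong (λ x → v * (x * v)) Mv≡R ⟩
      v * (R * v)                ≤⟨ *-mono-≤ (0≤* (0≤riemannSum j) 0≤v) (0≤ι 4) v≤4 Rv≤ ⟩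
      ι 4 * (ι 4 * (ι 4 * μ))    ≡⟨ solve 1 (λ x → con (+ 4) :* (con (+ 4) :* (con (+ 4) :* x)) := con (+ 64) :* x) refl μ ⟩
      ι 64 * μ                   ∎
      where
      open ℚ.≤-Reasoning
      open ℚSolver
      μ≤1 : μ ≤ 1ℚ
      μ≤1 = ℚ.≤-trans (subst (_≤ ι 64 * μ) (ℚ.*-identityˡ μ) (*-mono-≤ 0≤μ (0≤ι 64) (ι-mono {1} {64} (ℕ.s≤s ℕ.z≤n)) ℚ.≤-refl)) 64μ≤1
      v≤4 : v ≤ ι 4
      v≤4 = ℚ.≤-trans v≤4μ (subst (ι 4 * μ ≤_) (ℚ.*-identityʳ (ι 4)) (*-monoˡ-≤ (ι 4) (0≤ι 4) μ≤1))
    bs-nonNeg : NonNeg bs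
    bs-nonNeg = All.replicate⁺ M 0≤v
    error≤ : cayleyError as bs ≤ ι 3 * κ + ι 64 * μ
    error≤ = subst (cayleyError as bs ≤_) (solve 2 (λ k u → k :+ con (+ 64) :* u :+ (k :+ k) := con (+ 3) :* k :+ con (+ 64) :* u) refl κ μ)
      (ℚ.+-mono-≤ (ℚ.+-mono-≤ (cubes-fourTangents j) cubes≤) (ℚ.+-mono-≤ diff≤ diff≤))
      where
      open ℚSolver
      diff≤ : ℚ.∣ total as - total bs ∣ ≤ κ
      diff≤ = subst (λ x → ℚ.∣ total as - x ∣ ≤ κ) (sym (trans (total-replicate M v) Mv≡R)) (riemannSum-tangents j)
    rotation : ‖ cayley v ^ᵍ M ⊖ 1ᵍ ‖≤ ι 3 * κ + ι 64 * μ
    rotation = ⊖-swap (subst₂ (λ x y → ‖ x ⊖ y ‖≤ ι 3 * κ + ι 64 * μ) (cayleys-fourTangents j) (cayleys-replicate M v)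
      (‖‖-weaken error≤ (cayleys-close (length as ℕ.+ length bs) {as} {bs} ℕ.≤-refl (fourTangents-nonNeg j) bs-nonNeg)))
    total≤ : ι M * (v * v + v * v) + ι M * (v * v + v * v) + (ι 3 * κ + ι 64 * μ) ≤ ι 3 * κ + ι 128 * μ
    total≤ = subst (ι M * (v * v + v * v) + ι M * (v * v + v * v) + (ι 3 * κ + ι 64 * μ) ≤_)
      (solve 2 (λ k u → con (+ 64) :* u :+ (con (+ 3) :* k :+ con (+ 64) :* u) := con (+ 3) :* k :+ con (+ 128) :* u) refl κ μ)
      (ℚ.+-monoˡ-≤ (ι 3 * κ + ι 64 * μ) Md≤)
      where open ℚSolver

-- A norm on ℂ with rational bounds

at : ℂ → ℕ → ℚ[i]
at z j = seq (re z) j +𝕚 seq (im z) j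

infix  8 -ℂ_
infixl 6 _-ℂ_

-ℂ_ : ℂ → ℂ
-ℂ z = (-ℝ re z) +i (-ℝ im z)

_-ℂ_ : ℂ → ℂ → ℂ
z -ℂ w = z +ℂ (-ℂ w)

ofℚℂ : ℚ → ℂ
ofℚℂ x = fromℝ (fromℚ x)

infix 4 ‖_‖ℂ≤_

record ‖_‖ℂ≤_ (z : ℂ) (r : ℚ) : Set where
  constructor boundℂ
  field
    0≤rℂ : 0ℚ ≤ r
    eventually : ∀ δ → 0ℚ < δ → ∃ λ J → ∀ j → J ℕ.≤ j → ‖ at z j ‖≤ r + δ

open ‖_‖ℂ≤_ public

Eventually : (ℕ → Set) → Set
Eventually P = ∃ λ J → ∀ j → J ℕ.≤ j → P j

ev-both : ∀ {P Q R : ℕ → Set} → (∀ {j} → P j → Q j → R j) → Eventually P → Eventually Q → Eventually R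
ev-both f (J , p) (K , q) = J ℕ.⊔ K , λ j le → f (p j (ℕ.m⊔n≤o⇒m≤o J K le)) (q j (ℕ.m⊔n≤o⇒n≤o J K le))

ev-map : ∀ {P R : ℕ → Set} → (∀ {j} → P j → R j) → Eventually P → Eventually R
ev-map f (J , p) = J , λ j le → f (p j le)

0<½* : ∀ {δ} → 0ℚ < δ → 0ℚ < ½ * δ
0<½* = 0<* (ℚ.positive⁻¹ ½)

½+½ : ∀ δ → ½ * δ + ½ * δ ≡ δ
½+½ δ = trans (sym (ℚ.*-distribʳ-+ δ ½ ½)) (ℚ.*-identityˡ δ)

opaque

  ½*< : ∀ {δ} → 0ℚ < δ → ½ * δ < δ
  ½*< {δ} 0<δ = subst₂ _<_ (ℚ.+-identityʳ (½ * δ)) (½+½ δ) (ℚ.+-monoʳ-< (½ * δ) (0<½* 0<δ))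

  ‖‖ℂ-cong : ∀ {z w r} → (∀ j → at z j ≡ at w j) → ‖ z ‖ℂ≤ r → ‖ w ‖ℂ≤ r
  ‖‖ℂ-cong {r = r} e (boundℂ 0≤r p) = boundℂ 0≤r λ δ 0<δ →
    proj₁ (p δ 0<δ) , λ j le → subst (‖_‖≤ r + δ) (e j) (proj₂ (p δ 0<δ) j le)

  ‖‖ℂ-weaken : ∀ {z r s} → r ≤ s → ‖ z ‖ℂ≤ r → ‖ z ‖ℂ≤ s
  ‖‖ℂ-weaken r≤s (boundℂ 0≤r p) = boundℂ (ℚ.≤-trans 0≤r r≤s) λ δ 0<δ →
    ev-map (‖‖-weaken (ℚ.+-monoˡ-≤ δ r≤s)) (p δ 0<δ)

  ‖‖ℂ-+ : ∀ {z w r s} → ‖ z ‖ℂ≤ r → ‖ w ‖ℂ≤ s → ‖ z +ℂ w ‖ℂ≤ r + s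
  ‖‖ℂ-+ {z} {w} {r} {s} (boundℂ 0≤r p) (boundℂ 0≤s q) = boundℂ (0≤+ 0≤r 0≤s) λ δ 0<δ →
    ev-both (λ a b → subst (‖_‖≤_ _) (lem r s δ) (‖‖-⊕ a b)) (p (½ * δ) (0<½* 0<δ)) (q (½ * δ) (0<½* 0<δ))
    where
    lem : ∀ r s δ → (r + ½ * δ) + (s + ½ * δ) ≡ r + s + δ
    lem r s δ = trans (solve 3 (λ r s δ → (r :+ δ) :+ (s :+ δ) := r :+ s :+ (δ :+ δ)) refl r s (½ * δ))
      (cong (λ x → r + s + x) (½+½ δ))
      where open ℚSolver

  ‖‖ℂ-neg : ∀ {z r} → ‖ z ‖ℂ≤ r → ‖ -ℂ z ‖ℂ≤ r
  ‖‖ℂ-neg (boundℂ 0≤r p) = boundℂ 0≤r λ δ 0<δ → ev-map ‖‖-⊝ (p δ 0<δ)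

  ‖‖ℂ-- : ∀ {z w r s} → ‖ z ‖ℂ≤ r → ‖ w ‖ℂ≤ s → ‖ z -ℂ w ‖ℂ≤ r + s
  ‖‖ℂ-- p q = ‖‖ℂ-+ p (‖‖ℂ-neg q)

  modulus : ∀ {r s δ} → 0ℚ ≤ r → 0ℚ ≤ s → 0ℚ < δ → Σ[ η ∈ ℚ ] 0ℚ < η × r * η + η * s + η * η ≤ δ
  modulus {r} {s} {δ} 0≤r 0≤s 0<δ with *-pos-inverse (r + s + 1ℚ + δ) (ℚ.+-mono-≤-< (0≤+ (0≤+ 0≤r 0≤s) 0≤1) 0<δ)
  ... | i , 0<i , e = η , 0<η , subst (r * η + η * s + η * η ≤_) Tη
        (≤-by (η * (1ℚ - η) + δ * η)
          (solve 4 (λ r s δ η → (r :+ s :+ con (+ 1) :+ δ) :* η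
             := r :* η :+ η :* s :+ η :* η :+ (η :* (con (+ 1) :- η) :+ δ :* η)) refl r s δ η)
          (0≤+ (0≤* (ℚ.<⇒≤ 0<η) (0≤q-p η≤1)) (0≤* (ℚ.<⇒≤ 0<δ) (ℚ.<⇒≤ 0<η))))
    where
    open ℚSolver
    η : ℚ
    η = δ * i
    0<η : 0ℚ < η
    0<η = 0<* 0<δ 0<i
    Tη : (r + s + 1ℚ + δ) * η ≡ δ
    Tη = trans (solve 3 (λ T δ i → T :* (δ :* i) := T :* i :* δ) refl (r + s + 1ℚ + δ) δ i)
      (trans (cong (_* δ) e) (ℚ.*-identityˡ δ))
    η≤1 : η ≤ 1ℚ
    η≤1 = *-cancelˡ-≤ (r + s + 1ℚ + δ) (ℚ.+-mono-≤-< (0≤+ (0≤+ 0≤r 0≤s) 0≤1) 0<δ) (subst₂ _≤_ (sym Tη)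
      (sym (ℚ.*-identityʳ _)) (≤-by (r + s + 1ℚ) (ℚ.+-comm (r + s + 1ℚ) δ) (0≤+ (0≤+ 0≤r 0≤s) 0≤1)))

  ‖‖ℂ-* : ∀ {z w r s} → ‖ z ‖ℂ≤ r → ‖ w ‖ℂ≤ s → ‖ z *ℂ w ‖ℂ≤ r * s
  ‖‖ℂ-* {z} {w} {r} {s} (boundℂ 0≤r p) (boundℂ 0≤s q) = boundℂ (0≤* 0≤r 0≤s) λ δ 0<δ → go δ (modulus 0≤r 0≤s 0<δ)
    where
    expand : ∀ r s η → (r + η) * (s + η) ≡ r * s + (r * η + η * s + η * η)
    expand = solve 3 (λ r s η → (r :+ η) :* (s :+ η) := r :* s :+ (r :* η :+ η :* s :+ η :* η)) refl where open ℚSolver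
    go : ∀ δ → Σ[ η ∈ ℚ ] 0ℚ < η × r * η + η * s + η * η ≤ δ → Eventually (λ j → ‖ at (z *ℂ w) j ‖≤ r * s + δ)
    go δ (η , 0<η , le) = ev-both (λ a b → ‖‖-weaken
      (ℚ.≤-trans (ℚ.≤-reflexive (expand r s η)) (ℚ.+-monoʳ-≤ (r * s) le)) (‖‖-⊗ a b)) (p η 0<η) (q η 0<η)

  ‖‖ℂ-pointwise : ∀ {z r} → (∀ j → ‖ at z j ‖≤ r) → ‖ z ‖ℂ≤ r
  ‖‖ℂ-pointwise {z} {r} p = boundℂ (0≤r (p 0)) λ δ 0<δ → 0 , λ j _ →
    ‖‖-weaken (≤-by δ refl (ℚ.<⇒≤ 0<δ)) (p j)

  ‖‖ℂ-ofℚ : ∀ {x} → 0ℚ ≤ x → ‖ ofℚℂ x ‖ℂ≤ x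
  ‖‖ℂ-ofℚ 0≤x = ‖‖ℂ-pointwise λ _ → ‖‖-ofℚ 0≤x

  ‖‖ℂ-exists : ∀ z → Σ[ B ∈ ℚ ] ‖ z ‖ℂ≤ B
  ‖‖ℂ-exists z = r + s , boundℂ (0≤+ (proj₁ (proj₂ (bounded (re z)))) (proj₁ (proj₂ (bounded (im z))))) λ δ 0<δ →
    ev-both (λ a b → ‖‖-weaken (≤-by δ refl (ℚ.<⇒≤ 0<δ)) (‖‖-components a b)) (proj₂ (proj₂ (bounded (re z)))) (proj₂ (proj₂ (bounded (im z))))
    where
    bounded : ∀ x → Σ[ B ∈ ℚ ] 0ℚ ≤ B × Eventually (λ j → ℚ.∣ seq x j ∣ ≤ B)
    bounded x with cauchy x 1ℚ (ℚ.positive⁻¹ 1ℚ)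
    ... | J , p = ℚ.∣ seq x J ∣ + 1ℚ , 0≤+ (ℚ.0≤∣p∣ (seq x J)) 0≤1 , J , λ j le → ℚ.≤-trans
        (subst (λ y → ℚ.∣ y ∣ ≤ ℚ.∣ seq x J ∣ + ℚ.∣ seq x j - seq x J ∣) (lem (seq x j) (seq x J))
          (ℚ.∣p+q∣≤∣p∣+∣q∣ (seq x J) (seq x j - seq x J)))
        (ℚ.+-monoʳ-≤ ℚ.∣ seq x J ∣ (ℚ.<⇒≤ (p j J le ℕ.≤-refl)))
      where
      lem : ∀ a b → b + (a - b) ≡ a
      lem = solve 2 (λ a b → b :+ (a :- b) := a) refl where open ℚSolver
    r s : ℚ
    r = proj₁ (bounded (re z))
    s = proj₁ (bounded (im z))

  ‖‖ℂ-zero : ∀ {z} → (∀ ε → 0ℚ < ε → ‖ z ‖ℂ≤ ε) → ‖ z ‖ℂ≤ 0ℚ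
  ‖‖ℂ-zero p = boundℂ ℚ.≤-refl λ δ 0<δ →
    ev-map (‖‖-weaken (ℚ.≤-reflexive (trans (½+½ δ) (sym (ℚ.+-identityˡ δ)))))
      (eventually (p (½ * δ) (0<½* 0<δ)) (½ * δ) (0<½* 0<δ))

infix 4 _≋_

_≋_ : ℂ → ℂ → Set
z ≋ w = ‖ z -ℂ w ‖ℂ≤ 0ℚ

Lim : (ℕ → ℂ) → ℂ → Set
Lim u l = ∀ ε → 0ℚ < ε → Eventually (λ n → ‖ u n -ℂ l ‖ℂ≤ ε)

opaque

  ≈⇒≋ : ∀ {z w} → z ≈ℂ w → z ≋ w
  ≈⇒≋ (p , q) = boundℂ ℚ.≤-refl λ δ 0<δ →
    ev-both (λ a b → ‖‖-weaken (ℚ.≤-reflexive (trans (½+½ δ) (sym (ℚ.+-identityˡ δ)))) (‖‖-components (ℚ.<⇒≤ a) (ℚ.<⇒≤ b)))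
      (p (½ * δ) (0<½* 0<δ)) (q (½ * δ) (0<½* 0<δ))

  ⟶⇒Lim : ∀ {u l} → u ⟶ l → Lim u l
  ⟶⇒Lim {u} {l} (p , q) ε 0<ε = ev-both
    (λ {n} a b → boundℂ (ℚ.<⇒≤ 0<ε) λ δ 0<δ →
      ev-both (λ x y → ‖‖-weaken (≤-by δ (cong (_+ δ) (sym (½+½ ε))) (ℚ.<⇒≤ 0<δ)) (‖‖-components x y))
        (drop {∣ re (u n) -ℝ re l ∣ℝ} a) (drop {∣ im (u n) -ℝ im l ∣ℝ} b))
    (p (½ * ε) (0<½* 0<ε)) (q (½ * ε) (0<½* 0<ε))
    where
    drop : ∀ {x} → x <ℝ fromℚ (½ * ε) → Eventually (λ j → seq x j ≤ ½ * ε)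
    drop (δ , 0<δ , ev) = ev-map (λ lt → ℚ.≤-trans (≤-by δ refl (ℚ.<⇒≤ 0<δ)) (ℚ.<⇒≤ lt)) ev

  Lim⇒⟶ : ∀ {u l} → Lim u l → u ⟶ l
  Lim⇒⟶ {u} {l} p = (λ ε 0<ε → go ε 0<ε re (λ {z} → ‖‖-∣Re∣)) , (λ ε 0<ε → go ε 0<ε im (λ {z} → ‖‖-∣Im∣))
    where
    go : ∀ ε → 0ℚ < ε → (f : ℂ → ℝ) → (∀ {z j r} → ‖ at z j ‖≤ r → ℚ.∣ seq (f z) j ∣ ≤ r) →
      Eventually (λ n → ∣ f (u n -ℂ l) ∣ℝ <ℝ fromℚ ε)
    go ε 0<ε f project = ev-map
      (λ {n} b → η , 0<η , ev-map (λ {j} c → le (project {u n -ℂ l} {j} c)) (eventually b η 0<η)) (p η 0<η)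
      where
      η : ℚ
      η = ½ * (½ * ε)
      0<η : 0ℚ < η
      0<η = 0<½* (0<½* 0<ε)
      le : ∀ {x} → x ≤ η + η → x + η < ε
      le {x} x≤ = ℚ.≤-<-trans (ℚ.+-monoˡ-≤ η x≤) (subst₂ _<_ (cong (_+ η) (sym (½+½ (½ * ε)))) (½+½ ε)
        (ℚ.+-monoʳ-< (½ * ε) (½*< (0<½* 0<ε))))

opaque

  at-^ : ∀ z n j → at (z ^ℂ n) j ≡ at z j ^ᵍ n
  at-^ z zero    j = refl
  at-^ z (suc n) j = cong (at z j ⊗_) (at-^ z n j)

  ^ᵍ-distrib-⊗ : ∀ z w n → (z ⊗ w) ^ᵍ n ≡ z ^ᵍ n ⊗ w ^ᵍ n
  ^ᵍ-distrib-⊗ z w zero    = refl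
  ^ᵍ-distrib-⊗ z w (suc n) = trans (cong (z ⊗ w ⊗_) (^ᵍ-distrib-⊗ z w n))
    (solve 4 (λ z w u v → z :* w :* (u :* v) := z :* u :* (w :* v)) refl z w (z ^ᵍ n) (w ^ᵍ n))
    where open GSolver

  ^ᵍ-+ : ∀ z m n → z ^ᵍ (m ℕ.+ n) ≡ z ^ᵍ m ⊗ z ^ᵍ n
  ^ᵍ-+ z zero    n = sym (Gℚ.*-identityˡ (z ^ᵍ n))
  ^ᵍ-+ z (suc m) n = trans (cong (z ⊗_) (^ᵍ-+ z m n)) (sym (Gℚ.*-assoc z (z ^ᵍ m) (z ^ᵍ n)))

  ^ᵍ-* : ∀ z m n → z ^ᵍ (m ℕ.* n) ≡ (z ^ᵍ m) ^ᵍ n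
  ^ᵍ-* z m zero    = cong (z ^ᵍ_) (ℕ.*-zeroʳ m)
  ^ᵍ-* z m (suc n) = trans (cong (z ^ᵍ_) (ℕ.*-suc m n)) (trans (^ᵍ-+ z m (m ℕ.* n)) (cong (z ^ᵍ m ⊗_) (^ᵍ-* z m n)))

  1^ᵍ : ∀ n → 1ᵍ ^ᵍ n ≡ 1ᵍ
  1^ᵍ zero    = refl
  1^ᵍ (suc n) = trans (Gℚ.*-identityˡ (1ᵍ ^ᵍ n)) (1^ᵍ n)

  ≋-pointwise : ∀ {z w} → (∀ j → at z j ≡ at w j) → z ≋ w
  ≋-pointwise {z} {w} e = ‖‖ℂ-pointwise λ j → subst (‖_‖≤ 0ℚ)
    (trans (sym (Gℚ.-‿inverseʳ (at z j))) (cong (λ x → at z j ⊖ x) (e j))) (‖‖-ofℚ ℚ.≤-refl)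

  ≋-refl : ∀ {z} → z ≋ z
  ≋-refl = ≋-pointwise λ _ → refl

  -‖‖ℂ-swap : ∀ {z w r} → ‖ z -ℂ w ‖ℂ≤ r → ‖ w -ℂ z ‖ℂ≤ r
  -‖‖ℂ-swap {z} {w} p = ‖‖ℂ-cong (λ j → lem (at z j) (at w j)) (‖‖ℂ-neg p)
    where
    lem : ∀ z w → ⊝ (z ⊖ w) ≡ w ⊖ z
    lem = solve 2 (λ z w → :- (z :- w) := w :- z) refl where open GSolver

  ≋-sym : ∀ {z w} → z ≋ w → w ≋ z
  ≋-sym = -‖‖ℂ-swap

  -‖‖ℂ-triangle : ∀ {x y z r s} → ‖ x -ℂ y ‖ℂ≤ r → ‖ y -ℂ z ‖ℂ≤ s → ‖ x -ℂ z ‖ℂ≤ r + s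
  -‖‖ℂ-triangle {x} {y} {z} p q = ‖‖ℂ-cong (λ j → lem (at x j) (at y j) (at z j)) (‖‖ℂ-+ p q)
    where
    lem : ∀ x y z → x ⊖ y ⊕ (y ⊖ z) ≡ x ⊖ z
    lem = solve 3 (λ x y z → x :- y :+ (y :- z) := x :- z) refl where open GSolver

  ≋-trans : ∀ {x y z} → x ≋ y → y ≋ z → x ≋ z
  ≋-trans = -‖‖ℂ-triangle

  ‖‖ℂ-≋ : ∀ {z w r} → z ≋ w → ‖ z ‖ℂ≤ r → ‖ w ‖ℂ≤ r
  ‖‖ℂ-≋ {z} {w} p q = ‖‖ℂ-weaken (ℚ.≤-reflexive (ℚ.+-identityʳ _))
    (‖‖ℂ-cong (λ j → lem (at z j) (at w j)) (‖‖ℂ-- q p))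
    where
    lem : ∀ z w → z ⊖ (z ⊖ w) ≡ w
    lem = solve 2 (λ z w → z :- (z :- w) := w) refl where open GSolver

  ‖‖ℂ-*-zero : ∀ z {w} → ‖ w ‖ℂ≤ 0ℚ → ‖ z *ℂ w ‖ℂ≤ 0ℚ
  ‖‖ℂ-*-zero z p = ‖‖ℂ-weaken (ℚ.≤-reflexive (ℚ.*-zeroʳ (proj₁ (‖‖ℂ-exists z)))) (‖‖ℂ-* (proj₂ (‖‖ℂ-exists z)) p)

  *ℂ-cong : ∀ {z z′ w w′} → z ≋ z′ → w ≋ w′ → z *ℂ w ≋ z′ *ℂ w′
  *ℂ-cong {z} {z′} {w} {w′} p q = ‖‖ℂ-cong (λ j → lem (at z j) (at z′ j) (at w j) (at w′ j))
    (‖‖ℂ-+ (‖‖ℂ-*-zero z q) (‖‖ℂ-*-zero w′ p))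
    where
    lem : ∀ z z′ w w′ → z ⊗ (w ⊖ w′) ⊕ w′ ⊗ (z ⊖ z′) ≡ z ⊗ w ⊖ z′ ⊗ w′
    lem = solve 4 (λ z z′ w w′ → z :* (w :- w′) :+ w′ :* (z :- z′) := z :* w :- z′ :* w′) refl where open GSolver

  ^ℂ-cong : ∀ {z w} → z ≋ w → ∀ n → z ^ℂ n ≋ w ^ℂ n
  ^ℂ-cong p zero    = ≋-refl
  ^ℂ-cong p (suc n) = *ℂ-cong p (^ℂ-cong p n)

  ^ℂ-distrib-* : ∀ z w n → (z *ℂ w) ^ℂ n ≋ z ^ℂ n *ℂ w ^ℂ n
  ^ℂ-distrib-* z w n = ≋-pointwise λ j → trans (at-^ (z *ℂ w) n j) (trans (^ᵍ-distrib-⊗ (at z j) (at w j) n)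
    (sym (cong₂ _⊗_ (at-^ z n j) (at-^ w n j))))

  ^ℂ-* : ∀ z m n → z ^ℂ (m ℕ.* n) ≋ (z ^ℂ m) ^ℂ n
  ^ℂ-* z m n = ≋-pointwise λ j → trans (at-^ z (m ℕ.* n) j) (trans (^ᵍ-* (at z j) m n)
    (sym (trans (at-^ (z ^ℂ m) n j) (cong (_^ᵍ n) (at-^ z m j)))))

  1^ℂ : ∀ n → 1ℂ ^ℂ n ≋ 1ℂ
  1^ℂ n = ≋-pointwise λ j → trans (at-^ 1ℂ n j) (1^ᵍ n)

  Lim-unique : ∀ {u a b} → Lim u a → Lim u b → a ≋ b
  Lim-unique {u} {a} {b} p q = ‖‖ℂ-zero λ ε 0<ε → meet ε (ev-both _,_ (p (½ * ε) (0<½* 0<ε)) (q (½ * ε) (0<½* 0<ε)))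
    where
    meet : ∀ ε → Eventually (λ n → ‖ u n -ℂ a ‖ℂ≤ ½ * ε × ‖ u n -ℂ b ‖ℂ≤ ½ * ε) → ‖ a -ℂ b ‖ℂ≤ ε
    meet ε (N , f) with f N ℕ.≤-refl
    ... | x , y = subst (‖ a -ℂ b ‖ℂ≤_) (½+½ ε) (-‖‖ℂ-triangle (-‖‖ℂ-swap x) y)

  Lim-* : ∀ {u v a b} → Lim u a → Lim v b → Lim (λ n → u n *ℂ v n) (a *ℂ b)
  Lim-* {u} {v} {a} {b} p q ε 0<ε with ‖‖ℂ-exists a | ‖‖ℂ-exists b
  ... | A , a≤ | B , b≤ with modulus (0≤rℂ a≤) (0≤rℂ b≤) 0<ε
  ... | η , 0<η , le = ev-both (λ {n} x y → ‖‖ℂ-weaken le (‖‖ℂ-cong (λ j → lem (at a j) (at b j) (at (u n) j) (at (v n) j))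
        (‖‖ℂ-+ (‖‖ℂ-+ (‖‖ℂ-* a≤ y) (‖‖ℂ-* x b≤)) (‖‖ℂ-* x y)))) (p η 0<η) (q η 0<η)
    where
    lem : ∀ a b u v → a ⊗ (v ⊖ b) ⊕ (u ⊖ a) ⊗ b ⊕ (u ⊖ a) ⊗ (v ⊖ b) ≡ u ⊗ v ⊖ a ⊗ b
    lem = solve 4 (λ a b u v → a :* (v :- b) :+ (u :- a) :* b :+ (u :- a) :* (v :- b) := u :* v :- a :* b) refl
      where open GSolver

  Lim-^ : ∀ {u a} → Lim u a → ∀ k → Lim (λ n → u n ^ℂ k) (a ^ℂ k)
  Lim-^ p zero    ε 0<ε = 0 , λ _ _ → ‖‖ℂ-weaken (ℚ.<⇒≤ 0<ε) ≋-refl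
  Lim-^ p (suc k) = Lim-* p (Lim-^ p k)

  /suc-small : ∀ c ε → 0ℚ < ε → Eventually (λ n → + c / suc n ≤ ε)
  /suc-small c ε 0<ε with *-pos-inverse ε 0<ε
  ... | r , 0<r , e with archimedes (ι c * r)
  ... | n₀ , cr≤n₀ = n₀ , λ n n₀≤n → *-cancelˡ-≤ (ι (suc n)) (0<ι (suc n)) (begin
      ι (suc n) * (+ c / suc n)     ≡⟨ ι-/ c (suc n) ⟩
      ι c                           ≡⟨ ℚ.*-identityʳ (ι c) ⟨
      ι c * 1ℚ                      ≡⟨ cong (ι c *_) e ⟨
      ι c * (ε * r)                 ≡⟨ solve 3 (λ c ε r → c :* (ε :* r) := c :* r :* ε) refl (ι c) ε r ⟩
      ι c * r * ε                   ≤⟨ *-mono-≤ (ℚ.<⇒≤ 0<ε) (0≤ι (suc n)) (ℚ.≤-trans cr≤n₀ (ι-mono (ℕ.m≤n⇒m≤1+n n₀≤n))) ℚ.≤-refl ⟩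
      ι (suc n) * ε                 ∎)
    where
    open ℚ.≤-Reasoning
    open ℚSolver

  at-factor : ∀ n t .{{_ : NonZero t}} j v → ι (suc n ℕ.* t) * v ≡ riemannSum j →
    at (1ℂ +ℂ 1/ℂ suc n *ℂ (1/ℂ t *ℂ 2πi)) j ≡ (1ℚ +𝕚 v + v)
  at-factor n t j v Mv≡R = cong₂ _+𝕚_
    (solve 3 (λ p a b → con (+ 1) :+ (a :* (b :* (con (+ 2) :* p :* con (+ 0) :- con (+ 0) :* con (+ 1)) :- con (+ 0) :* (con (+ 2) :* p :* con (+ 1) :+ con (+ 0) :* con (+ 0)))
        :- con (+ 0) :* (b :* (con (+ 2) :* p :* con (+ 1) :+ con (+ 0) :* con (+ 0)) :+ con (+ 0) :* (con (+ 2) :* p :* con (+ 0) :- con (+ 0) :* con (+ 1)))) := con (+ 1))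
      refl (seq π j) (+ 1 / suc n) (+ 1 / t))
    (trans (solve 3 (λ p a b → con (+ 0) :+ (a :* (b :* (con (+ 2) :* p :* con (+ 1) :+ con (+ 0) :* con (+ 0)) :+ con (+ 0) :* (con (+ 2) :* p :* con (+ 0) :- con (+ 0) :* con (+ 1)))
        :+ con (+ 0) :* (b :* (con (+ 2) :* p :* con (+ 0) :- con (+ 0) :* con (+ 1)) :- con (+ 0) :* (con (+ 2) :* p :* con (+ 1) :+ con (+ 0) :* con (+ 0)))) := a :* b :* p :+ a :* b :* p)
      refl (seq π j) (+ 1 / suc n) (+ 1 / t))
      (cong (λ x → x + x) (trans (cong (λ x → (+ 1 / suc n) * (+ 1 / t) * x) (seq-π j)) (sym v≡))))
    where
    open ℚSolver
    M : ℕ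
    M = suc n ℕ.* t
    instance
      M≢0 : NonZero M
      M≢0 = ℕ.m*n≢0 (suc n) t
    e : ι M * v ≡ ι M * ((+ 1 / suc n) * (+ 1 / t) * riemannSum j)
    e = begin
      ι M * v                                            ≡⟨ Mv≡R ⟩
      riemannSum j                                       ≡⟨ solve 1 (λ r → r := con (+ 1) :* con (+ 1) :* r) refl (riemannSum j) ⟩
      1ℚ * 1ℚ * riemannSum j                             ≡⟨ cong₂ (λ x y → x * y * riemannSum j) (ι-/ 1 (suc n)) (ι-/ 1 t) ⟨
      (ι (suc n) * (+ 1 / suc n)) * (ι t * (+ 1 / t)) * riemannSum j
        ≡⟨ solve 5 (λ a b c d r → (a :* c) :* (b :* d) :* r := a :* b :* (c :* d :* r)) refl (ι (suc n)) (ι t) (+ 1 / suc n) (+ 1 / t) (riemannSum j) ⟩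
      ι (suc n) * ι t * ((+ 1 / suc n) * (+ 1 / t) * riemannSum j)
        ≡⟨ cong (_* ((+ 1 / suc n) * (+ 1 / t) * riemannSum j)) (ι-* (suc n) t) ⟨
      ι M * ((+ 1 / suc n) * (+ 1 / t) * riemannSum j)   ∎
      where open ≡-Reasoning
    v≡ : v ≡ (+ 1 / suc n) * (+ 1 / t) * riemannSum j
    v≡ = *-cancelˡ-≡ (ι M) (0<ι M) e

opaque

  -- Opaque to keep the type checker from expanding powers of real numbers.
  compound : ℂ → ℕ → ℂ
  compound z n = (1ℂ +ℂ 1/ℂ suc n *ℂ z) ^ℂ suc n

  isExp⇒Lim : ∀ {w z} → w IsExp z → Lim (compound z) w
  isExp⇒Lim {w} {z} p = ⟶⇒Lim {compound z} {w} p

  at-compound : ∀ z n j → at (compound z n) j ≡ at (1ℂ +ℂ 1/ℂ suc n *ℂ z) j ^ᵍ suc n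
  at-compound z n = at-^ (1ℂ +ℂ 1/ℂ suc n *ℂ z) (suc n)

opaque

  compound-near : ∀ t .{{_ : NonZero t}} {n j ε δ} → 64 ℕ.≤ n → + 128 / suc n ≤ ε → + 12 / suc j ≤ δ → ‖ at (compound (1/ℂ t *ℂ 2πi) n ^ℂ t -ℂ 1ℂ) j ‖≤ ε + δ
  compound-near t {n} {j} {ε} {δ} 64≤n small tiny = subst (λ x → ‖ x ⊖ 1ᵍ ‖≤ ε + δ) (sym power)
    (‖‖-weaken le (compound-near-1 j M v (0≤* (0≤/ 1 M) (0≤riemannSum j)) Mv≡R
      (ℕ.≤-trans (ℕ.m≤n⇒m≤1+n 64≤n) (ℕ.m≤m*n (suc n) t))))
    where
    M : ℕ
    M = suc n ℕ.* t
    instance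
      M≢0 : NonZero M
      M≢0 = ℕ.m*n≢0 (suc n) t
    v : ℚ
    v = + 1 / M * riemannSum j
    Mv≡R : ι M * v ≡ riemannSum j
    Mv≡R = trans (sym (ℚ.*-assoc (ι M) (+ 1 / M) (riemannSum j))) (trans (cong (_* riemannSum j) (ι-/ 1 M)) (ℚ.*-identityˡ _))
    base : ℂ
    base = 1ℂ +ℂ 1/ℂ suc n *ℂ (1/ℂ t *ℂ 2πi)
    power : at (compound (1/ℂ t *ℂ 2πi) n ^ℂ t) j ≡ (1ℚ +𝕚 v + v) ^ᵍ M
    power = begin
      at (compound (1/ℂ t *ℂ 2πi) n ^ℂ t) j      ≡⟨ at-^ (compound (1/ℂ t *ℂ 2πi) n) t j ⟩
      at (compound (1/ℂ t *ℂ 2πi) n) j ^ᵍ t      ≡⟨ cong (_^ᵍ t) (at-compound (1/ℂ t *ℂ 2πi) n j) ⟩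
      (at base j ^ᵍ suc n) ^ᵍ t                  ≡⟨ cong (λ x → (x ^ᵍ suc n) ^ᵍ t) (at-factor n t j v Mv≡R) ⟩
      ((1ℚ +𝕚 v + v) ^ᵍ suc n) ^ᵍ t              ≡⟨ ^ᵍ-* (1ℚ +𝕚 v + v) (suc n) t ⟨
      (1ℚ +𝕚 v + v) ^ᵍ M                         ∎
      where open ≡-Reasoning
    scale : ∀ a b c d .{{_ : NonZero d}} → a ℕ.* b ≡ c → ι a * (+ b / d) ≡ + c / d
    scale a b c d refl = *-cancelˡ-≡ (ι d) (0<ι d) eq
      where
      eq : ι d * (ι a * (+ b / d)) ≡ ι d * (+ (a ℕ.* b) / d)
      eq = trans (solve 3 (λ d a x → d :* (a :* x) := a :* (d :* x)) refl (ι d) (ι a) (+ b / d))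
        (trans (cong (ι a *_) (ι-/ b d)) (trans (sym (ι-* a b)) (sym (ι-/ (a ℕ.* b) d))))
        where open ℚSolver
    le : ι 3 * (+ 4 / suc j) + ι 128 * (+ 1 / M) ≤ ε + δ
    le = ℚ.≤-trans (ℚ.≤-reflexive (ℚ.+-comm _ (ι 128 * (+ 1 / M)))) (ℚ.+-mono-≤
      (ℚ.≤-trans (ℚ.≤-reflexive (scale 128 1 128 M refl)) (ℚ.≤-trans (/-mono 128 M 128 (suc n) (ℕ.*-monoʳ-≤ 128 (ℕ.m≤m*n (suc n) t))) small))
      (ℚ.≤-trans (ℚ.≤-reflexive (scale 3 4 12 (suc j) refl)) tiny))

  isExp⇒rootOfUnity : ∀ {w} t .{{_ : NonZero t}} → w IsExp (1/ℂ t *ℂ 2πi) → w ^ℂ t ≋ 1ℂ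
  isExp⇒rootOfUnity {w} t w-exp = Lim-unique {λ n → compound (1/ℂ t *ℂ 2πi) n ^ℂ t}
    (Lim-^ {compound (1/ℂ t *ℂ 2πi)} (isExp⇒Lim w-exp) t) λ ε 0<ε →
      ev-both (λ {n} small 64≤n → boundℂ (ℚ.<⇒≤ 0<ε) λ δ 0<δ →
        ev-map (λ {j} tiny → compound-near t {n} {j} 64≤n small tiny) (/suc-small 12 δ 0<δ))
      (/suc-small 128 ε 0<ε) (64 , λ _ le → le)

-- Mean values

opaque

  ιℂ : ℕ → ℂ
  ιℂ n = ofℚℂ (ι n)

  at-ιℂ : ∀ n j → at (ιℂ n) j ≡ ofℚ (ι n)
  at-ιℂ n j = refl

  ‖‖ℂ-ι : ∀ n → ‖ ιℂ n ‖ℂ≤ ι n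
  ‖‖ℂ-ι n = ‖‖ℂ-ofℚ (0≤ι n)

opaque

  ιℂ-+ : ∀ m n j → at (ιℂ (m ℕ.+ n)) j ≡ at (ιℂ m) j ⊕ at (ιℂ n) j
  ιℂ-+ m n j = trans (at-ιℂ (m ℕ.+ n) j) (trans (cong ofℚ (ι-+ m n)) (sym (cong₂ _⊕_ (at-ιℂ m j) (at-ιℂ n j))))

  ιℂ-* : ∀ m n j → at (ιℂ (m ℕ.* n)) j ≡ at (ιℂ m) j ⊗ at (ιℂ n) j
  ιℂ-* m n j = trans (at-ιℂ (m ℕ.* n) j) (trans lem (sym (cong₂ _⊗_ (at-ιℂ m j) (at-ιℂ n j))))
    where
    lem : ofℚ (ι (m ℕ.* n)) ≡ ofℚ (ι m) ⊗ ofℚ (ι n)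
    lem = cong₂ _+𝕚_ (trans (ι-* m n) (solve 2 (λ a b → a :* b := a :* b :- con (+ 0) :* con (+ 0)) refl (ι m) (ι n)))
      (solve 2 (λ a b → con (+ 0) := a :* con (+ 0) :+ con (+ 0) :* b) refl (ι m) (ι n))
      where open ℚSolver

opaque

  deviation : (ℕ → ℂ) → ℂ → ℕ → ℂ
  deviation g M n = ∑₁ n g -ℂ ιℂ n *ℂ M

HasAverage : (ℕ → ℂ) → ℂ → Set
HasAverage g M = ∀ ε → 0ℚ < ε → Σ[ C ∈ ℚ ] 0ℚ ≤ C × ∀ n → ‖ deviation g M n ‖ℂ≤ ε * ι n + C

opaque
  unfolding deviation

  average⇒mean : ∀ {g M} → HasAverage g M → HasMean g M
  average⇒mean {g} {M} avg = Lim⇒⟶ {λ n → 1/ℂ suc n *ℂ ∑₁ (suc n) g} {M} λ ε 0<ε → go ε (avg (½ * ε) (0<½* 0<ε)) 0<ε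
    where
    go : ∀ ε → (Σ[ C ∈ ℚ ] 0ℚ ≤ C × ∀ n → ‖ deviation g M n ‖ℂ≤ ½ * ε * ι n + C) → 0ℚ < ε →
      Eventually (λ n → ‖ 1/ℂ suc n *ℂ ∑₁ (suc n) g -ℂ M ‖ℂ≤ ε)
    go ε (C , 0≤C , dev) 0<ε = ev-map (λ {n} small → ‖‖ℂ-weaken (le n small)
        (‖‖ℂ-cong {1/ℂ suc n *ℂ deviation g M (suc n)} (λ j → trans (cong (λ x → ofℚ (+ 1 / suc n) ⊗ (at (∑₁ (suc n) g) j ⊖ x ⊗ at M j)) (at-ιℂ (suc n) j))
            (identity (+ 1 / suc n) (ι (suc n)) (at (∑₁ (suc n) g) j) (at M j) (ι-/ 1 (suc n))))
          (‖‖ℂ-* (‖‖ℂ-ofℚ (0≤/ 1 (suc n))) (dev (suc n)))))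
      (/suc-small c (½ * ε) (0<½* 0<ε))
      where
      c : ℕ
      c = proj₁ (archimedes C)
      identity : ∀ μ x G M → x * μ ≡ 1ℚ → ofℚ μ ⊗ (G ⊖ ofℚ x ⊗ M) ≡ ofℚ μ ⊗ G ⊖ M
      identity μ x G M e = trans (lem (ofℚ μ) (ofℚ x) G M) (cong (ofℚ μ ⊗ G ⊖_) (trans (cong (_⊗ M) one) (Gℚ.*-identityˡ M)))
        where
        lem : ∀ u x G M → u ⊗ (G ⊖ x ⊗ M) ≡ u ⊗ G ⊖ x ⊗ u ⊗ M
        lem = solve 4 (λ u x G M → u :* (G :- x :* M) := u :* G :- x :* u :* M) refl where open GSolver
        one : ofℚ x ⊗ ofℚ μ ≡ 1ᵍ
        one = cong₂ _+𝕚_ (trans (solve 2 (λ x u → x :* u :- con (+ 0) :* con (+ 0) := x :* u) refl x μ) e)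
          (solve 2 (λ x u → x :* con (+ 0) :+ con (+ 0) :* u := con (+ 0)) refl x μ)
          where open ℚSolver
      le : ∀ n → + c / suc n ≤ ½ * ε → (+ 1 / suc n) * (½ * ε * ι (suc n) + C) ≤ ε
      le n small = begin
        μ * (½ * ε * ι (suc n) + C)                ≤⟨ *-monoˡ-≤ μ (0≤/ 1 (suc n)) (ℚ.+-monoʳ-≤ (½ * ε * ι (suc n)) (proj₂ (archimedes C))) ⟩
        μ * (½ * ε * ι (suc n) + ι c)              ≡⟨ solve 4 (λ u e n c → u :* (e :* n :+ c) := n :* u :* e :+ c :* u) refl μ (½ * ε) (ι (suc n)) (ι c) ⟩
        ι (suc n) * μ * (½ * ε) + ι c * μ          ≡⟨ cong₂ _+_ (trans (cong (_* (½ * ε)) (ι-/ 1 (suc n))) (ℚ.*-identityˡ (½ * ε))) cμ ⟩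
        ½ * ε + + c / suc n                        ≤⟨ ℚ.+-monoʳ-≤ (½ * ε) small ⟩
        ½ * ε + ½ * ε                              ≡⟨ ½+½ ε ⟩
        ε                                          ∎
        where
        open ℚ.≤-Reasoning
        open ℚSolver
        μ : ℚ
        μ = + 1 / suc n
        cμ : ι c * μ ≡ + c / suc n
        cμ = *-cancelˡ-≡ (ι (suc n)) (0<ι (suc n)) (trans (solve 3 (λ n c u → n :* (c :* u) := c :* (n :* u)) refl (ι (suc n)) (ι c) μ)
          (trans (cong (ι c *_) (ι-/ 1 (suc n))) (trans (ℚ.*-identityʳ (ι c)) (sym (ι-/ c (suc n))))))

  average-1 : ∀ {g} → (∀ m .{{_ : NonZero m}} → g m ≋ 1ℂ) → HasAverage g 1ℂ
  average-1 {g} g≋1 ε 0<ε = 0ℚ , ℚ.≤-refl , λ n → ‖‖ℂ-weaken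
      (subst (0ℚ ≤_) (sym (ℚ.+-identityʳ (ε * ι n))) (0≤* (ℚ.<⇒≤ 0<ε) (0≤ι n))) (exact n)
    where
    exact : ∀ n → ‖ deviation g 1ℂ n ‖ℂ≤ 0ℚ
    exact zero    = ‖‖ℂ-pointwise λ j → subst (λ x → ‖ 0ᵍ ⊖ x ⊗ 1ᵍ ‖≤ 0ℚ) (sym (at-ιℂ 0 j))
        (subst (‖_‖≤ 0ℚ) (solve 0 (con (+ 0) := con (+ 0) :- con (+ 0) :* con (+ 1)) refl) (‖‖-ofℚ ℚ.≤-refl))
      where open GSolver
    exact (suc n) = ‖‖ℂ-cong {deviation g 1ℂ n +ℂ (g (suc n) -ℂ 1ℂ)} (λ j → trans (lem (at (∑₁ n g) j) (at (g (suc n)) j) (at (ιℂ n) j))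
        (cong (λ x → at (∑₁ (suc n) g) j ⊖ x ⊗ 1ᵍ) (sym (trans (ιℂ-+ 1 n j) (cong (_⊕ at (ιℂ n) j) (at-ιℂ 1 j))))))
      (‖‖ℂ-+ (exact n) (g≋1 (suc n)))
      where
      lem : ∀ s x y → s ⊖ y ⊗ 1ᵍ ⊕ (x ⊖ 1ᵍ) ≡ s ⊕ x ⊖ (1ᵍ ⊕ y) ⊗ 1ᵍ
      lem = solve 3 (λ s x y → s :- y :* con (+ 1) :+ (x :- con (+ 1)) := s :+ x :- (con (+ 1) :+ y) :* con (+ 1)) refl
        where open GSolver

opaque

  bounded-below : ∀ (f : ℕ → ℂ) n → Σ[ C ∈ ℚ ] 0ℚ ≤ C × ∀ k → k ℕ.< n → ‖ f k ‖ℂ≤ C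
  bounded-below f zero    = 0ℚ , ℚ.≤-refl , λ _ ()
  bounded-below f (suc n) with bounded-below f n | ‖‖ℂ-exists (f n)
  ... | C , 0≤C , p | B , q = C + B , 0≤+ 0≤C (0≤rℂ q) , bnd
    where
    bnd : ∀ k → k ℕ.< suc n → ‖ f k ‖ℂ≤ C + B
    bnd k k<1+n with ℕ.m≤n⇒m<n∨m≡n (ℕ.s≤s⁻¹ k<1+n)
    ... | inj₁ k<n  = ‖‖ℂ-weaken (≤-by B refl (0≤rℂ q)) (p k k<n)
    ... | inj₂ refl = ‖‖ℂ-weaken (≤-by C (ℚ.+-comm C B) 0≤C) q

  eventually-above : ∀ {ε} K → 0ℚ < ε → Eventually (λ n → K ≤ ε * ι n)
  eventually-above {ε} K 0<ε with *-pos-inverse ε 0<ε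
  ... | i , 0<i , e with archimedes (i * K)
  ... | n₀ , iK≤n₀ = n₀ , λ n le → ℚ.≤-trans
      (ℚ.≤-reflexive (trans (sym (ℚ.*-identityˡ K)) (trans (cong (_* K) (sym e)) (ℚ.*-assoc ε i K))))
      (*-monoˡ-≤ ε (ℚ.<⇒≤ 0<ε) (ℚ.≤-trans iK≤n₀ (ι-mono le)))

  -- One step of the recurrence at least halves n; the slack 8ε(n − n/p) absorbs its error once n is large.
  descent-absorb : ∀ {ε C D b} x y → 0ℚ ≤ ε → y + y ≤ x → 0ℚ ≤ y → C + C + b ≤ ε * x →
    ι 8 * ε * y + D + (ε * x + C + (ε * y + C)) + b ≤ ι 8 * ε * x + D
  descent-absorb {ε} {C} {D} {b} x y 0≤ε 2y≤x 0≤y K≤ =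
    ≤-by (ι 5 * (ε * (x - (y + y))) + (ε * x - (C + C + b)) + (ε * x + ε * y))
      (solve 6 (λ e x y D C b → con (+ 8) :* e :* x :+ D
        := con (+ 8) :* e :* y :+ D :+ (e :* x :+ C :+ (e :* y :+ C)) :+ b
           :+ (con (+ 5) :* (e :* (x :- (y :+ y))) :+ (e :* x :- (C :+ C :+ b)) :+ (e :* x :+ e :* y))) refl ε x y D C b)
      (0≤+ (0≤+ (0≤* (0≤ι 5) (0≤* 0≤ε (0≤q-p 2y≤x))) (0≤q-p K≤))
        (0≤+ (0≤* 0≤ε (ℚ.≤-trans (0≤+ 0≤y 0≤y) 2y≤x)) (0≤* 0≤ε 0≤y)))
    where open ℚSolver

module _ {p′ : ℕ} (2≤p : 2 ℕ.≤ suc p′) {z c : ℂ} (z≤1 : ‖ z ‖ℂ≤ 1ℚ) (c-inv : c *ℂ (ιℂ (suc p′) -ℂ z) ≋ 1ℂ)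
  {g h : ℕ → ℂ}
  (g-p : ∀ m → g (suc m ℕ.* suc p′) ≋ z *ℂ g (suc m)) (h-p : ∀ m → h (suc m ℕ.* suc p′) ≋ h (suc m))
  (g≋h : ∀ m → ¬ (suc p′ ∣ m) → g m ≋ h m)
  where

  private
    p : ℕ
    p = suc p′

  private
    defect : ℕ → ℕ → ℂ
    defect n a = ∑₁ n g -ℂ ∑₁ n h -ℂ z *ℂ ∑₁ a g +ℂ ∑₁ a h

  opaque

    private
      mutual
        -- Only multiples of p contribute to ∑ g − ∑ h.
        defect-multiple : ∀ a → ‖ defect (a ℕ.* p) a ‖ℂ≤ 0ℚ
        defect-multiple zero    = ‖‖ℂ-pointwise λ j → subst (‖_‖≤ 0ℚ) (lem (at z j)) (‖‖-ofℚ ℚ.≤-refl)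
          where
          lem : ∀ z → 0ᵍ ≡ 0ᵍ ⊖ 0ᵍ ⊖ z ⊗ 0ᵍ ⊕ 0ᵍ
          lem = solve 1 (λ z → con (+ 0) := con (+ 0) :- con (+ 0) :- z :* con (+ 0) :+ con (+ 0)) refl where open GSolver
        defect-multiple (suc a) = ‖‖ℂ-cong
          {defect (p′ ℕ.+ a ℕ.* p) a +ℂ ((g n -ℂ z *ℂ g (suc a)) -ℂ (h n -ℂ h (suc a)))}
          (λ j → lem (at (∑₁ (p′ ℕ.+ a ℕ.* p) g) j) (at (∑₁ (p′ ℕ.+ a ℕ.* p) h) j) (at (∑₁ a g) j) (at (∑₁ a h) j) (at z j)
            (at (g n) j) (at (h n) j) (at (g (suc a)) j) (at (h (suc a)) j))
          (‖‖ℂ-+ (defect-remainder a p′ ℕ.≤-refl) (‖‖ℂ-- (g-p a) (h-p a)))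
          where
          n : ℕ
          n = suc a ℕ.* p
          lem : ∀ G H Ga Ha z x y u v → G ⊖ H ⊖ z ⊗ Ga ⊕ Ha ⊕ ((x ⊖ z ⊗ u) ⊖ (y ⊖ v))
            ≡ (G ⊕ x) ⊖ (H ⊕ y) ⊖ z ⊗ (Ga ⊕ u) ⊕ (Ha ⊕ v)
          lem = solve 9 (λ G H Ga Ha z x y u v → G :- H :- z :* Ga :+ Ha :+ ((x :- z :* u) :- (y :- v))
            := (G :+ x) :- (H :+ y) :- z :* (Ga :+ u) :+ (Ha :+ v)) refl where open GSolver

        defect-remainder : ∀ a r → r ℕ.< p → ‖ defect (r ℕ.+ a ℕ.* p) a ‖ℂ≤ 0ℚ
        defect-remainder a zero    _   = defect-multiple a
        defect-remainder a (suc r) r<p = ‖‖ℂ-cong {defect (r ℕ.+ a ℕ.* p) a +ℂ (g n -ℂ h n)}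
          (λ j → lem (at (∑₁ (r ℕ.+ a ℕ.* p) g) j) (at (∑₁ (r ℕ.+ a ℕ.* p) h) j) (at (z *ℂ ∑₁ a g) j) (at (∑₁ a h) j)
            (at (g n) j) (at (h n) j))
          (‖‖ℂ-+ (defect-remainder a r (ℕ.<-trans ℕ.≤-refl r<p)) (g≋h n λ p∣n →
            >⇒∤ r<p (∣m+n∣m⇒∣n (subst (p ∣_) (ℕ.+-comm (suc r) (a ℕ.* p)) p∣n) (n∣m*n a))))
          where
          n : ℕ
          n = suc r ℕ.+ a ℕ.* p
          lem : ∀ G H Ga Ha x y → G ⊖ H ⊖ Ga ⊕ Ha ⊕ (x ⊖ y) ≡ (G ⊕ x) ⊖ (H ⊕ y) ⊖ Ga ⊕ Ha
          lem = solve 6 (λ G H Ga Ha x y → G :- H :- Ga :+ Ha :+ (x :- y) := (G :+ x) :- (H :+ y) :- Ga :+ Ha) refl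
            where open GSolver

  module _ {M : ℂ} where

    newAverage : ℂ
    newAverage = c *ℂ (ιℂ p -ℂ 1ℂ) *ℂ M

    private
      L imbalance : ℂ
      L = newAverage
      imbalance = z *ℂ L +ℂ ιℂ p *ℂ M -ℂ M -ℂ ιℂ p *ℂ L

    opaque

      private
        imbalance≋0 : ‖ imbalance ‖ℂ≤ 0ℚ
        imbalance≋0 = ‖‖ℂ-cong {((1ℂ -ℂ ιℂ p) *ℂ M) *ℂ (c *ℂ (ιℂ p -ℂ z) -ℂ 1ℂ)} (λ j → lem (at c j) (at (ιℂ p) j) (at z j) (at M j))
            (‖‖ℂ-*-zero ((1ℂ -ℂ ιℂ p) *ℂ M) c-inv)
          where
          lem : ∀ c p z M → ((1ᵍ ⊖ p) ⊗ M) ⊗ (c ⊗ (p ⊖ z) ⊖ 1ᵍ)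
            ≡ z ⊗ (c ⊗ (p ⊖ 1ᵍ) ⊗ M) ⊕ p ⊗ M ⊖ M ⊖ p ⊗ (c ⊗ (p ⊖ 1ᵍ) ⊗ M)
          lem = solve 4 (λ c p z M → ((con (+ 1) :- p) :* M) :* (c :* (p :- z) :- con (+ 1))
            := z :* (c :* (p :- con (+ 1)) :* M) :+ p :* M :- M :- p :* (c :* (p :- con (+ 1)) :* M)) refl
            where open GSolver

      newAverage-nonZero : ‖ L ‖ℂ≤ 0ℚ → ‖ M ‖ℂ≤ 0ℚ
      newAverage-nonZero L≋0 = go (*-pos-inverse (ι p′) (0<ι p′ {{ℕ.>-nonZero (ℕ.s≤s⁻¹ 2≤p)}}))
        where
        step : ‖ imbalance +ℂ (ιℂ p -ℂ z) *ℂ L ‖ℂ≤ 0ℚ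
        step = ‖‖ℂ-+ imbalance≋0 (‖‖ℂ-*-zero (ιℂ p -ℂ z) L≋0)
        go : Σ[ r ∈ ℚ ] 0ℚ < r × ι p′ * r ≡ 1ℚ → ‖ M ‖ℂ≤ 0ℚ
        go (r , 0<r , e) = ‖‖ℂ-cong {ofℚℂ r *ℂ (imbalance +ℂ (ιℂ p -ℂ z) *ℂ L)}
            (λ j → trans (lem (ofℚ r) (at (ιℂ p) j) (at z j) (at L j) (at M j)) (trans (cong (_⊗ at M j) (trans (cong (λ x → ofℚ r ⊗ (x ⊖ 1ᵍ)) (at-ιℂ p j)) one)) (Gℚ.*-identityˡ (at M j))))
            (‖‖ℂ-*-zero (ofℚℂ r) step)
          where
          lem : ∀ r p z L M → r ⊗ ((z ⊗ L ⊕ p ⊗ M ⊖ M ⊖ p ⊗ L) ⊕ (p ⊖ z) ⊗ L) ≡ r ⊗ (p ⊖ 1ᵍ) ⊗ M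
          lem = solve 5 (λ r p z L M → r :* ((z :* L :+ p :* M :- M :- p :* L) :+ (p :- z) :* L) := r :* (p :- con (+ 1)) :* M) refl
            where open GSolver
          one : ofℚ r ⊗ (ofℚ (ι p) ⊖ 1ᵍ) ≡ 1ᵍ
          one = trans (cong (λ x → ofℚ r ⊗ (ofℚ x ⊖ 1ᵍ)) (ι-+ 1 p′)) (cong₂ _+𝕚_
            (trans (solve 2 (λ r x → r :* (con (+ 1) :+ x :- con (+ 1)) :- con (+ 0) :* (con (+ 0) :- con (+ 0)) := x :* r) refl r (ι p′)) e)
            (solve 2 (λ r x → r :* (con (+ 0) :- con (+ 0)) :+ con (+ 0) :* (con (+ 1) :+ x :- con (+ 1)) := con (+ 0)) refl r (ι p′)))
            where open ℚSolver

    private opaque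
      unfolding deviation

      recurrence : ∀ {ε C B} → ‖ M -ℂ L ‖ℂ≤ B → (∀ n → ‖ deviation h M n ‖ℂ≤ ε * ι n + C) → ∀ a r → r ℕ.< p → ∀ {E} →
        ‖ deviation g L a ‖ℂ≤ E →
        ‖ deviation g L (r ℕ.+ a ℕ.* p) ‖ℂ≤ E + (ε * ι (r ℕ.+ a ℕ.* p) + C + (ε * ι a + C)) + ι p * B
      recurrence {ε} {C} {B} B≤ dev a r r<p {E} ind = ‖‖ℂ-weaken le (‖‖ℂ-cong
          {z *ℂ deviation g L a +ℂ (deviation h M n -ℂ deviation h M a) +ℂ (defect n a +ℂ ιℂ a *ℂ imbalance) +ℂ ιℂ r *ℂ (M -ℂ L)}
          (λ j → trans (lem (at z j) (at (∑₁ n g) j) (at (∑₁ n h) j) (at (∑₁ a g) j) (at (∑₁ a h) j) (at (ιℂ n) j) (at (ιℂ a) j) (at (ιℂ r) j) (at (ιℂ p) j) (at L j) (at M j))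
            (trans (cong (λ x → at (∑₁ n g) j ⊖ at (ιℂ n) j ⊗ at L j ⊕ (x ⊖ at (ιℂ n) j) ⊗ (at M j ⊖ at L j)) (ι-n j))
              (cancel (at (∑₁ n g) j ⊖ at (ιℂ n) j ⊗ at L j) (at (ιℂ n) j) (at M j ⊖ at L j))))
          (‖‖ℂ-+ (‖‖ℂ-+ (‖‖ℂ-+ (‖‖ℂ-* z≤1 ind) (‖‖ℂ-- (dev n) (dev a)))
            (‖‖ℂ-+ (defect-remainder a r r<p) (‖‖ℂ-*-zero (ιℂ a) imbalance≋0)))
            (‖‖ℂ-* (‖‖ℂ-weaken (ι-mono (ℕ.<⇒≤ r<p)) (‖‖ℂ-ι r)) B≤)))
        where
        n : ℕ
        n = r ℕ.+ a ℕ.* p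
        ι-n : ∀ j → at (ιℂ r) j ⊕ at (ιℂ a) j ⊗ at (ιℂ p) j ≡ at (ιℂ n) j
        ι-n j = sym (trans (ιℂ-+ r (a ℕ.* p) j) (cong (at (ιℂ r) j ⊕_) (ιℂ-* a p j)))
        lem : ∀ z Gn Hn Ga Ha n a r p L M →
          z ⊗ (Ga ⊖ a ⊗ L) ⊕ ((Hn ⊖ n ⊗ M) ⊖ (Ha ⊖ a ⊗ M)) ⊕ ((Gn ⊖ Hn ⊖ z ⊗ Ga ⊕ Ha) ⊕ a ⊗ (z ⊗ L ⊕ p ⊗ M ⊖ M ⊖ p ⊗ L)) ⊕ r ⊗ (M ⊖ L)
          ≡ Gn ⊖ n ⊗ L ⊕ ((r ⊕ a ⊗ p) ⊖ n) ⊗ (M ⊖ L)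
        lem = solve 11 (λ z Gn Hn Ga Ha n a r p L M →
          z :* (Ga :- a :* L) :+ ((Hn :- n :* M) :- (Ha :- a :* M)) :+ ((Gn :- Hn :- z :* Ga :+ Ha) :+ a :* (z :* L :+ p :* M :- M :- p :* L)) :+ r :* (M :- L)
          := Gn :- n :* L :+ ((r :+ a :* p) :- n) :* (M :- L)) refl
          where open GSolver
        cancel : ∀ x n y → x ⊕ (n ⊖ n) ⊗ y ≡ x
        cancel = solve 3 (λ x n y → x :+ (n :- n) :* y := x) refl where open GSolver
        le : 1ℚ * E + (ε * ι n + C + (ε * ι a + C)) + (0ℚ + 0ℚ) + ι p * B ≤ E + (ε * ι n + C + (ε * ι a + C)) + ι p * B
        le = ℚ.≤-reflexive (solve 3 (λ E x y → con (+ 1) :* E :+ x :+ (con (+ 0) :+ con (+ 0)) :+ y := E :+ x :+ y) refl E (ε * ι n + C + (ε * ι a + C)) (ι p * B))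
          where open ℚSolver

    opaque

      private
        descent-step : ∀ {ε C B D} a r → 0ℚ < ε → ‖ M -ℂ L ‖ℂ≤ B → (∀ n → ‖ deviation h M n ‖ℂ≤ ε * ι n + C) → r ℕ.< p →
          C + C + ι p * B ≤ ε * ι (r ℕ.+ a ℕ.* p) → ‖ deviation g L a ‖ℂ≤ ι 8 * ε * ι a + D →
          ‖ deviation g L (r ℕ.+ a ℕ.* p) ‖ℂ≤ ι 8 * ε * ι (r ℕ.+ a ℕ.* p) + D
        descent-step {ε} {C} {B} {D} a r 0<ε B≤ dev r<p large ind = ‖‖ℂ-weaken
          (descent-absorb {ε} {C} {D} {ι p * B} (ι (r ℕ.+ a ℕ.* p)) (ι a) (ℚ.<⇒≤ 0<ε)
            (subst (_≤ ι (r ℕ.+ a ℕ.* p)) (ι-+ a a) (ι-mono 2a≤)) (0≤ι a) large)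
          (recurrence {ε} {C} {B} B≤ dev a r r<p {ι 8 * ε * ι a + D} ind)
          where
          2a≤ : a ℕ.+ a ℕ.≤ r ℕ.+ a ℕ.* p
          2a≤ = ℕ.≤-trans (ℕ.≤-reflexive (trans (cong (a ℕ.+_) (sym (ℕ.+-identityʳ a))) (ℕ.*-comm 2 a)))
            (ℕ.≤-trans (ℕ.*-monoʳ-≤ a 2≤p) (ℕ.m≤n+m (a ℕ.* p) r))

        descent : ∀ {ε C B D n₀} → 0ℚ < ε → 0ℚ ≤ D → ‖ M -ℂ L ‖ℂ≤ B → (∀ n → ‖ deviation h M n ‖ℂ≤ ε * ι n + C) →
          (∀ n → n₀ ℕ.≤ n → C + C + ι p * B ≤ ε * ι n) → (∀ n → n ℕ.< suc n₀ → ‖ deviation g L n ‖ℂ≤ D) →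
          ∀ n → ‖ deviation g L n ‖ℂ≤ ι 8 * ε * ι n + D
        descent {ε} {C} {B} {D} {n₀} 0<ε 0≤D B≤ dev large small = <-rec (λ n → ‖ deviation g L n ‖ℂ≤ ι 8 * ε * ι n + D) step
          where
          step : ∀ n → (∀ {m} → m ℕ.< n → ‖ deviation g L m ‖ℂ≤ ι 8 * ε * ι m + D) → ‖ deviation g L n ‖ℂ≤ ι 8 * ε * ι n + D
          step n rec with n ℕ.<? suc n₀
          ... | yes n<n₀ = ‖‖ℂ-weaken (≤-by (ι 8 * ε * ι n) (ℚ.+-comm _ D) (0≤* (0≤* (0≤ι 8) (ℚ.<⇒≤ 0<ε)) (0≤ι n))) (small n n<n₀)
          ... | no  n≮n₀ = subst (λ k → ‖ deviation g L k ‖ℂ≤ ι 8 * ε * ι k + D) (sym n≡)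
            (descent-step {ε} {C} {B} {D} (n ℕ./ p) (n ℕ.% p) 0<ε B≤ dev (ℕ.m%n<n n p)
              (subst (λ k → C + C + ι p * B ≤ ε * ι k) n≡ (large n (ℕ.<⇒≤ n₀<n))) (rec a<n))
            where
            n₀<n : n₀ ℕ.< n
            n₀<n = ℕ.≮⇒≥ n≮n₀
            n≡ : n ≡ n ℕ.% p ℕ.+ n ℕ./ p ℕ.* p
            n≡ = ℕ.m≡m%n+[m/n]*n n p
            a<n : n ℕ./ p ℕ.< n
            a<n = ℕ.m/n<m n p {{ℕ.>-nonZero (ℕ.≤-trans (ℕ.s≤s ℕ.z≤n) n₀<n)}} {{_}} 2≤p

      newAverage-correct : HasAverage h M → HasAverage g L
      newAverage-correct avg ε 0<ε = go (avg ε₁ 0<ε₁)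
        where
        ε₁ : ℚ
        ε₁ = (+ 1 / 8) * ε
        0<ε₁ : 0ℚ < ε₁
        0<ε₁ = 0<* (ℚ.positive⁻¹ (+ 1 / 8)) 0<ε
        8ε₁≡ε : ι 8 * ε₁ ≡ ε
        8ε₁≡ε = trans (sym (ℚ.*-assoc (ι 8) (+ 1 / 8) ε)) (trans (cong (_* ε) (ι-/ 1 8)) (ℚ.*-identityˡ ε))
        go : (Σ[ C ∈ ℚ ] 0ℚ ≤ C × ∀ n → ‖ deviation h M n ‖ℂ≤ ε₁ * ι n + C) →
          Σ[ D ∈ ℚ ] 0ℚ ≤ D × ∀ n → ‖ deviation g L n ‖ℂ≤ ε * ι n + D
        go (C , _ , dev) = go′ (eventually-above (C + C + ι p * B) 0<ε₁)
          where
          B : ℚ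
          B = proj₁ (‖‖ℂ-exists (M -ℂ L))
          go′ : Eventually (λ n → C + C + ι p * B ≤ ε₁ * ι n) → Σ[ D ∈ ℚ ] 0ℚ ≤ D × ∀ n → ‖ deviation g L n ‖ℂ≤ ε * ι n + D
          go′ (n₀ , large) = go″ (bounded-below (deviation g L) (suc n₀))
            where
            go″ : (Σ[ D ∈ ℚ ] 0ℚ ≤ D × ∀ n → n ℕ.< suc n₀ → ‖ deviation g L n ‖ℂ≤ D) →
              Σ[ D ∈ ℚ ] 0ℚ ≤ D × ∀ n → ‖ deviation g L n ‖ℂ≤ ε * ι n + D
            go″ (D , 0≤D , small) = D , 0≤D , λ n → subst (λ x → ‖ deviation g L n ‖ℂ≤ x * ι n + D) 8ε₁≡ε
              (descent {ε₁} {C} {B} {D} {n₀} 0<ε₁ 0≤D (proj₂ (‖‖ℂ-exists (M -ℂ L))) dev large small n)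

record Admissible (z : ℂ) : Set where
  field
    norm≤1  : ‖ z ‖ℂ≤ 1ℚ
    inverse : ∀ n → 2 ℕ.≤ n → ∃ λ c → c *ℂ (ιℂ n -ℂ z) ≋ 1ℂ

open Admissible public

opaque

  1≤N-^ : ∀ z n → 1ℚ ≤ N z → 1ℚ ≤ N (z ^ᵍ n)
  1≤N-^ z zero    1≤ = ℚ.≤-refl
  1≤N-^ z (suc n) 1≤ = subst (1ℚ ≤_) (sym (N-⊗ z (z ^ᵍ n))) (*-mono-≤ 0≤1 (0≤N z) 1≤ (1≤N-^ z n 1≤))

  ‖‖-root : ∀ {z r} n → 1ℚ ≤ r → ‖ z ^ᵍ suc n ‖≤ r → ‖ z ‖≤ r
  ‖‖-root {z} {r} n 1≤r (bound 0≤r p) with N z ℚ.≤? r * r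
  ... | yes q = bound 0≤r q
  ... | no ¬q = contradiction (ℚ.≤-trans (subst₂ _≤_ (ℚ.*-identityʳ (N z)) (sym (N-⊗ z (z ^ᵍ n)))
        (*-monoˡ-≤ (N z) (0≤N z) (1≤N-^ z n 1≤N))) p) ¬q
    where
    1≤N : 1ℚ ≤ N z
    1≤N = ℚ.≤-trans (*-mono-≤ 0≤1 0≤r 1≤r 1≤r) (ℚ.<⇒≤ (ℚ.≰⇒> ¬q))

  ‖‖ℂ-root : ∀ {z} n → z ^ℂ suc n ≋ 1ℂ → ‖ z ‖ℂ≤ 1ℚ
  ‖‖ℂ-root {z} n e = boundℂ 0≤1 λ δ 0<δ →
    ev-map (λ {j} b → ‖‖-root n (≤-by δ refl (ℚ.<⇒≤ 0<δ)) (subst (‖_‖≤ 1ℚ + δ) (at-^ z (suc n) j) b))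
      (eventually (‖‖ℂ-≋ (≋-sym e) (‖‖ℂ-ofℚ 0≤1)) δ 0<δ)

geometric : ℂ → ℂ → ℕ → ℂ
geometric x z zero    = 0ℂ
geometric x z (suc n) = x *ℂ geometric x z n +ℂ z ^ℂ n

opaque

  geometric-eq : ∀ x z n j → (at x j ⊖ at z j) ⊗ at (geometric x z n) j ≡ at x j ^ᵍ n ⊖ at z j ^ᵍ n
  geometric-eq x z zero    j = trans (Gℚ.zeroʳ (at x j ⊖ at z j)) (sym (Gℚ.-‿inverseʳ 1ᵍ))
  geometric-eq x z (suc n) j = begin
    (X ⊖ Z) ⊗ (X ⊗ G ⊕ at (z ^ℂ n) j)              ≡⟨ cong (λ y → (X ⊖ Z) ⊗ (X ⊗ G ⊕ y)) (at-^ z n j) ⟩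
    (X ⊖ Z) ⊗ (X ⊗ G ⊕ Z ^ᵍ n)                     ≡⟨ expand X Z G (Z ^ᵍ n) ⟩
    X ⊗ ((X ⊖ Z) ⊗ G) ⊕ (X ⊖ Z) ⊗ Z ^ᵍ n           ≡⟨ cong (λ y → X ⊗ y ⊕ (X ⊖ Z) ⊗ Z ^ᵍ n) (geometric-eq x z n j) ⟩
    X ⊗ (X ^ᵍ n ⊖ Z ^ᵍ n) ⊕ (X ⊖ Z) ⊗ Z ^ᵍ n       ≡⟨ collect X Z (X ^ᵍ n) (Z ^ᵍ n) ⟩
    X ⊗ X ^ᵍ n ⊖ Z ⊗ Z ^ᵍ n                        ∎
    where
    open ≡-Reasoning
    X Z G : ℚ[i]
    X = at x j
    Z = at z j
    G = at (geometric x z n) j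
    expand : ∀ X Z G W → (X ⊖ Z) ⊗ (X ⊗ G ⊕ W) ≡ X ⊗ ((X ⊖ Z) ⊗ G) ⊕ (X ⊖ Z) ⊗ W
    expand = solve 4 (λ X Z G W → (X :- Z) :* (X :* G :+ W) := X :* ((X :- Z) :* G) :+ (X :- Z) :* W) refl where open GSolver
    collect : ∀ X Z V W → X ⊗ (V ⊖ W) ⊕ (X ⊖ Z) ⊗ W ≡ X ⊗ V ⊖ Z ⊗ W
    collect = solve 4 (λ X Z V W → X :* (V :- W) :+ (X :- Z) :* W := X :* V :- Z :* W) refl where open GSolver

  at-ιℂ-^ : ∀ n k j → at (ιℂ n) j ^ᵍ k ≡ ofℚ (ι (n ℕ.^ k))
  at-ιℂ-^ n zero    j = refl
  at-ιℂ-^ n (suc k) j = trans (cong (at (ιℂ n) j ⊗_) (trans (at-ιℂ-^ n k j) (sym (at-ιℂ (n ℕ.^ k) j))))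
    (trans (sym (ιℂ-* n (n ℕ.^ k) j)) (at-ιℂ (n ℕ.* n ℕ.^ k) j))

  -- 1/(n − z) = (nᵗ⁻¹ + nᵗ⁻²z + ⋯ + zᵗ⁻¹)/(nᵗ − 1) when zᵗ = 1.
  root-inverse : ∀ z k → z ^ℂ suc k ≋ 1ℂ → ∀ n → 2 ℕ.≤ n → ∃ λ c → c *ℂ (ιℂ n -ℂ z) ≋ 1ℂ
  root-inverse z k e n 2≤n = go (*-pos-inverse (ι m) (0<ι m {{ℕ.>-nonZero (ℕ.pred-mono-≤ 2≤n^)}}))
    where
    m : ℕ
    m = ℕ.pred (n ℕ.^ suc k)
    2≤n^ : 2 ℕ.≤ n ℕ.^ suc k
    2≤n^ = ℕ.≤-trans (ℕ.≤-trans 2≤n (ℕ.≤-reflexive (sym (ℕ.^-identityʳ n))))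
      (ℕ.^-monoʳ-≤ n {{ℕ.>-nonZero (ℕ.≤-trans (ℕ.s≤s ℕ.z≤n) 2≤n)}} {1} {suc k} (ℕ.s≤s ℕ.z≤n))
    n^≡ : n ℕ.^ suc k ≡ 1 ℕ.+ m
    n^≡ = sym (ℕ.suc-pred (n ℕ.^ suc k) {{ℕ.>-nonZero (ℕ.≤-trans (ℕ.s≤s ℕ.z≤n) 2≤n^)}})
    go : Σ[ r ∈ ℚ ] 0ℚ < r × ι m * r ≡ 1ℚ → ∃ λ c → c *ℂ (ιℂ n -ℂ z) ≋ 1ℂ
    go (r , _ , mr≡1) = ofℚℂ r *ℂ geometric (ιℂ n) z (suc k) , ‖‖ℂ-cong {ofℚℂ r *ℂ (1ℂ -ℂ z ^ℂ suc k)}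
        (λ j → identity j (at (ιℂ n) j) (at z j) (at (geometric (ιℂ n) z (suc k)) j) (geometric-eq (ιℂ n) z (suc k) j) (at-ιℂ-^ n (suc k) j) (at-^ z (suc k) j))
        (‖‖ℂ-*-zero (ofℚℂ r) (≋-sym e))
      where
      rm≡1 : ofℚ r ⊗ ofℚ (ι m) ≡ 1ᵍ
      rm≡1 = cong₂ _+𝕚_ (trans (solve 2 (λ r m → r :* m :- con (+ 0) :* con (+ 0) := m :* r) refl r (ι m)) mr≡1)
        (solve 2 (λ r m → r :* con (+ 0) :+ con (+ 0) :* m := con (+ 0)) refl r (ι m))
        where open ℚSolver
      identity : ∀ j X Z G → (X ⊖ Z) ⊗ G ≡ X ^ᵍ suc k ⊖ Z ^ᵍ suc k → X ^ᵍ suc k ≡ ofℚ (ι (n ℕ.^ suc k)) →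
        at (z ^ℂ suc k) j ≡ Z ^ᵍ suc k →
        ofℚ r ⊗ (1ᵍ ⊖ at (z ^ℂ suc k) j) ≡ ofℚ r ⊗ G ⊗ (X ⊖ Z) ⊖ 1ᵍ
      identity j X Z G e₁ e₂ e₃ = begin
        ofℚ r ⊗ (1ᵍ ⊖ at (z ^ℂ suc k) j)                       ≡⟨ cong (λ y → ofℚ r ⊗ (1ᵍ ⊖ y)) e₃ ⟩
        ofℚ r ⊗ (1ᵍ ⊖ Z ^ᵍ suc k)                              ≡⟨ lem₁ (ofℚ r) (ofℚ (ι m)) (Z ^ᵍ suc k) ⟩
        ofℚ r ⊗ (1ᵍ ⊕ ofℚ (ι m) ⊖ Z ^ᵍ suc k) ⊖ ofℚ r ⊗ ofℚ (ι m)
          ≡⟨ cong₂ (λ x y → ofℚ r ⊗ (x ⊖ Z ^ᵍ suc k) ⊖ y) (sym (trans e₂ (trans (cong (λ x → ofℚ (ι x)) n^≡) (cong ofℚ (ι-+ 1 m))))) rm≡1 ⟩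
        ofℚ r ⊗ (X ^ᵍ suc k ⊖ Z ^ᵍ suc k) ⊖ 1ᵍ                 ≡⟨ cong (λ y → ofℚ r ⊗ y ⊖ 1ᵍ) e₁ ⟨
        ofℚ r ⊗ ((X ⊖ Z) ⊗ G) ⊖ 1ᵍ                             ≡⟨ lem₂ (ofℚ r) (X ⊖ Z) G ⟩
        ofℚ r ⊗ G ⊗ (X ⊖ Z) ⊖ 1ᵍ                               ∎
        where
        open ≡-Reasoning
        lem₁ : ∀ r m Z → r ⊗ (1ᵍ ⊖ Z) ≡ r ⊗ (1ᵍ ⊕ m ⊖ Z) ⊖ r ⊗ m
        lem₁ = solve 3 (λ r m Z → r :* (con (+ 1) :- Z) := r :* (con (+ 1) :+ m :- Z) :- r :* m) refl where open GSolver
        lem₂ : ∀ r D G → r ⊗ (D ⊗ G) ⊖ 1ᵍ ≡ r ⊗ G ⊗ D ⊖ 1ᵍ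
        lem₂ = solve 3 (λ r D G → r :* (D :* G) :- con (+ 1) := r :* G :* D :- con (+ 1)) refl where open GSolver

  root-admissible : ∀ {z} n .{{_ : NonZero n}} → z ^ℂ n ≋ 1ℂ → Admissible z
  root-admissible {z} (suc k) e = record { norm≤1 = ‖‖ℂ-root k e ; inverse = root-inverse z k e }

  zero-admissible : ∀ {z} → ‖ z ‖ℂ≤ 0ℚ → Admissible z
  zero-admissible {z} z≋0 = record
    { norm≤1  = ‖‖ℂ-weaken 0≤1 z≋0
    ; inverse = λ n 2≤n → let instance n≢0 = ℕ.>-nonZero (ℕ.≤-trans (ℕ.s≤s ℕ.z≤n) 2≤n) in
        1/ℂ n , ‖‖ℂ-cong {(-ℂ 1/ℂ n) *ℂ z} (λ j → identity j n (+ 1 / n) (at z j) (ι-/ 1 n)) (‖‖ℂ-*-zero (-ℂ 1/ℂ n) z≋0)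
    }
    where
    identity : ∀ j n r Z → ι n * r ≡ 1ℚ → (⊝ ofℚ r) ⊗ Z ≡ ofℚ r ⊗ (at (ιℂ n) j ⊖ Z) ⊖ 1ᵍ
    identity j n r Z e = trans (lem (ofℚ r) (at (ιℂ n) j) Z) (cong (λ y → ofℚ r ⊗ (at (ιℂ n) j ⊖ Z) ⊖ y) rn≡1)
      where
      lem : ∀ r n Z → (⊝ r) ⊗ Z ≡ r ⊗ (n ⊖ Z) ⊖ r ⊗ n
      lem = solve 3 (λ r n Z → (:- r) :* Z := r :* (n :- Z) :- r :* n) refl where open GSolver
      rn≡1 : ofℚ r ⊗ at (ιℂ n) j ≡ 1ᵍ
      rn≡1 = trans (cong (ofℚ r ⊗_) (at-ιℂ n j)) (cong₂ _+𝕚_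
        (trans (solve 2 (λ r m → r :* m :- con (+ 0) :* con (+ 0) := m :* r) refl r (ι n)) e)
        (solve 2 (λ r m → r :* con (+ 0) :+ con (+ 0) :* m := con (+ 0)) refl r (ι n)))
        where open ℚSolver

  1≋̸0 : ¬ ‖ 1ℂ ‖ℂ≤ 0ℚ
  1≋̸0 p with eventually p ½ (ℚ.positive⁻¹ ½)
  ... | J , q with ‖‖-Re (q J ℕ.≤-refl)
  ... | le = contradiction le (λ { (ℚ.*≤* (ℤ.+≤+ (ℕ.s≤s ()))) })

-- Removing a prime from a multiplicative function

prime-∣-prime : ∀ {p q} → Prime p → Prime q → p ∣ q → p ≡ q
prime-∣-prime pp pq p∣q with prime⇒irreducible pq p∣q
... | inj₁ refl = contradiction pp ¬prime[1]
... | inj₂ p≡q  = p≡q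

prime⇒2≤ : ∀ {p} → Prime p → 2 ℕ.≤ p
prime⇒2≤ {p} pp = ℕ.nonTrivial⇒n>1 p {{prime⇒nonTrivial pp}}

module _ {p : ℕ} (pp : Prime p) where

  private instance
    p≢0 : NonZero p
    p≢0 = prime⇒nonZero pp

  decompose : ∀ f m .{{_ : NonZero m}} → m ℕ.≤ f → ∃ λ v → ∃ λ a → ¬ p ∣ a × m ≡ p ℕ.^ v ℕ.* a
  decompose f m m≤f with p ∣? m
  decompose f m m≤f | no p∤m = 0 , m , p∤m , sym (ℕ.*-identityˡ m)
  decompose zero (suc _) () | yes _
  decompose (suc f) m@(suc _) m≤f | yes (divides a m≡ap) =
    let v , b , p∤b , a≡ = decompose f a {{a≢0}} (ℕ.s≤s⁻¹ (ℕ.≤-trans a<m m≤f))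
    in suc v , b , p∤b , trans m≡ap (trans (ℕ.*-comm a p) (trans (cong (p ℕ.*_) a≡) (sym (ℕ.*-assoc p (p ℕ.^ v) b))))
    where
    a≢0 : NonZero a
    a≢0 = ℕ.m*n≢0⇒m≢0 a {{subst NonZero m≡ap _}}
    a<m : a ℕ.< m
    a<m = subst (a ℕ.<_) (sym m≡ap) (ℕ.m<m*n a p {{a≢0}} (prime⇒2≤ pp))

  -- The largest divisor of m prime to p.
  core : ℕ → ℕ
  core zero      = zero
  core m@(suc _) = proj₁ (proj₂ (decompose m m ℕ.≤-refl))

  core-spec : ∀ m .{{_ : NonZero m}} → ¬ p ∣ core m × ∃ λ v → m ≡ p ℕ.^ v ℕ.* core m
  core-spec m@(suc _) = let v , a , p∤a , e = decompose m m ℕ.≤-refl in p∤a , v , e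

  prime-to-part-unique : ∀ v w {a b} → ¬ p ∣ a → ¬ p ∣ b → p ℕ.^ v ℕ.* a ≡ p ℕ.^ w ℕ.* b → a ≡ b
  prime-to-part-unique zero    zero    {a} {b} _ _ e = trans (sym (ℕ.*-identityˡ a)) (trans e (ℕ.*-identityˡ b))
  prime-to-part-unique zero    (suc w) {a} {b} p∤a _ e = contradiction
    (subst (p ∣_) (trans (sym (ℕ.*-assoc p (p ℕ.^ w) b)) (trans (sym e) (ℕ.*-identityˡ a))) (m∣m*n (p ℕ.^ w ℕ.* b))) p∤a
  prime-to-part-unique (suc v) zero    {a} {b} _ p∤b e = contradiction
    (subst (p ∣_) (trans (sym (ℕ.*-assoc p (p ℕ.^ v) a)) (trans e (ℕ.*-identityˡ b))) (m∣m*n (p ℕ.^ v ℕ.* a))) p∤b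
  prime-to-part-unique (suc v) (suc w) {a} {b} p∤a p∤b e = prime-to-part-unique v w p∤a p∤b
    (ℕ.*-cancelˡ-≡ _ _ p (trans (sym (ℕ.*-assoc p (p ℕ.^ v) a)) (trans e (ℕ.*-assoc p (p ℕ.^ w) b))))

  core-unique : ∀ v a .{{_ : NonZero a}} → ¬ p ∣ a → core (p ℕ.^ v ℕ.* a) ≡ a
  core-unique v a p∤a =
    let p∤c , w , e = core-spec (p ℕ.^ v ℕ.* a) {{ℕ.m*n≢0 (p ℕ.^ v) a {{ℕ.m^n≢0 p v}}}} in
    prime-to-part-unique w v p∤c p∤a (sym e)

  core-coprime : ∀ a .{{_ : NonZero a}} → ¬ p ∣ a → core a ≡ a
  core-coprime a p∤a = trans (cong core (sym (ℕ.*-identityˡ a))) (core-unique 0 a p∤a)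

  core≢0 : ∀ m .{{_ : NonZero m}} → NonZero (core m)
  core≢0 m = ℕ.≢-nonZero λ e → proj₁ (core-spec m) (subst (p ∣_) (sym e) (p ∣0))

  core-p* : ∀ m .{{_ : NonZero m}} → core (p ℕ.* m) ≡ core m
  core-p* m = let p∤c , v , e = core-spec m in
    trans (cong core (trans (cong (p ℕ.*_) e) (sym (ℕ.*-assoc p (p ℕ.^ v) (core m))))) (core-unique (suc v) (core m) {{core≢0 m}} p∤c)

  core-prime* : ∀ {q} → Prime q → q ≢ p → ∀ m .{{_ : NonZero m}} → core (q ℕ.* m) ≡ q ℕ.* core m
  core-prime* {q} pq q≢p m = let p∤c , v , e = core-spec m in
    trans (cong core (trans (cong (q ℕ.*_) e) (swap v)))
      (core-unique v (q ℕ.* core m) {{ℕ.m*n≢0 q (core m) {{prime⇒nonZero pq}} {{core≢0 m}}}} (p∤q* p∤c))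
    where
    swap : ∀ v → q ℕ.* (p ℕ.^ v ℕ.* core m) ≡ p ℕ.^ v ℕ.* (q ℕ.* core m)
    swap v = trans (sym (ℕ.*-assoc q (p ℕ.^ v) (core m))) (trans (cong (ℕ._* core m) (ℕ.*-comm q (p ℕ.^ v))) (ℕ.*-assoc (p ℕ.^ v) q (core m)))
    p∤q* : ¬ p ∣ core m → ¬ p ∣ q ℕ.* core m
    p∤q* p∤c d with euclidsLemma q (core m) pp d
    ... | inj₁ p∣q = q≢p (sym (prime-∣-prime pp pq p∣q))
    ... | inj₂ p∣c = p∤c p∣c

  core-p : core p ≡ 1
  core-p = trans (cong core (trans (sym (ℕ.*-identityʳ p)) (cong (ℕ._* 1) (sym (ℕ.*-identityʳ p)))))
    (core-unique 1 1 λ p∣1 → contradiction (subst Prime (∣1⇒≡1 p∣1) pp) ¬prime[1])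

record PrimeMultiplicative (g : ℕ → ℂ) : Set where
  field
    g-1     : g 1 ≋ 1ℂ
    g-prime : ∀ p → Prime p → ∀ m .{{_ : NonZero m}} → g (p ℕ.* m) ≋ g p *ℂ g m

open PrimeMultiplicative

opaque

  1*-≋ : ∀ {z w} → z ≋ 1ℂ → z *ℂ w ≋ w
  1*-≋ {z} {w} e = ≋-trans (*ℂ-cong e ≋-refl) (≋-pointwise λ j → Gℚ.*-identityˡ (at w j))

  ≋-reflexive : ∀ (g : ℕ → ℂ) {m n} → m ≡ n → g m ≋ g n
  ≋-reflexive g refl = ≋-refl

  all-primes-1 : ∀ {g} → PrimeMultiplicative g → (∀ p → Prime p → g p ≋ 1ℂ) → ∀ m .{{_ : NonZero m}} → g m ≋ 1ℂ
  all-primes-1 {g} mult g≋1 m = ≋-trans (≋-reflexive g (PrimeFactorisation.isFactorisation fac))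
    (products (PrimeFactorisation.factorsPrime fac))
    where
    fac : PrimeFactorisation m
    fac = factorise m
    products : ∀ {ps} → All Prime ps → g (product ps) ≋ 1ℂ
    products []                       = g-1 mult
    products {p ∷ ps} (pp ∷ pps) = ≋-trans (g-prime mult p pp (product ps) {{productOfPrimes≢0 pps}})
      (≋-trans (1*-≋ (g≋1 p pp)) (products pps))

  remove-prime : ∀ {g p} (pp : Prime p) → PrimeMultiplicative g → PrimeMultiplicative (λ m → g (core pp m))
  remove-prime {g} {p} pp mult = record
    { g-1 = ≋-trans (≋-reflexive g (core-coprime pp 1 λ p∣1 → contradiction (subst Prime (∣1⇒≡1 p∣1) pp) ¬prime[1])) (g-1 mult)
    ; g-prime = step
    }
    where
    step : ∀ q → Prime q → ∀ m .{{_ : NonZero m}} → g (core pp (q ℕ.* m)) ≋ g (core pp q) *ℂ g (core pp m)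
    step q pq m with q ℕ.≟ p
    ... | yes refl = ≋-trans (≋-reflexive g (core-p* pp m))
      (≋-sym (1*-≋ (≋-trans (≋-reflexive g (core-p pp)) (g-1 mult))))
    ... | no q≢p   = ≋-trans (≋-reflexive g (core-prime* pp pq q≢p m))
      (≋-trans (g-prime mult q pq (core pp m) {{core≢0 pp m}})
        (*ℂ-cong (≋-reflexive g (sym (core-coprime pp q {{prime⇒nonZero pq}} λ p∣q → q≢p (sym (prime-∣-prime pp pq p∣q))))) ≋-refl))

  nonZeroAverage-step : ∀ {g p} (pp : Prime p) → PrimeMultiplicative g → Admissible (g p) →
    (∃ λ M → ¬ ‖ M ‖ℂ≤ 0ℚ × HasAverage (λ m → g (core pp m)) M) → ∃ λ L → ¬ ‖ L ‖ℂ≤ 0ℚ × HasAverage g L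
  nonZeroAverage-step {g} {zero}   pp = contradiction pp ¬prime[0]
  nonZeroAverage-step {g} {suc p′} pp mult adm (M , M≉0 , avg) = go (inverse adm (suc p′) (prime⇒2≤ pp))
    where
    p : ℕ
    p = suc p′
    h : ℕ → ℂ
    h m = g (core pp m)
    g-p : ∀ m → g (suc m ℕ.* p) ≋ g p *ℂ g (suc m)
    g-p m = ≋-trans (≋-reflexive g (ℕ.*-comm (suc m) p)) (g-prime mult p pp (suc m))
    h-p : ∀ m → h (suc m ℕ.* p) ≋ h (suc m)
    h-p m = ≋-reflexive g (trans (cong (core pp) (ℕ.*-comm (suc m) p)) (core-p* pp (suc m)))
    g≋h : ∀ m → ¬ (p ∣ m) → g m ≋ h m
    g≋h zero      p∤m = contradiction (p ∣0) p∤m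
    g≋h m@(suc _) p∤m = ≋-reflexive g (sym (core-coprime pp m p∤m))
    go : (∃ λ c → c *ℂ (ιℂ p -ℂ g p) ≋ 1ℂ) → ∃ λ L → ¬ ‖ L ‖ℂ≤ 0ℚ × HasAverage g L
    go (c , c-inv) =
        newAverage (prime⇒2≤ pp) (norm≤1 adm) c-inv {g} {h} g-p h-p g≋h {M}
      , (λ L≋0 → M≉0 (newAverage-nonZero (prime⇒2≤ pp) (norm≤1 adm) c-inv {g} {h} g-p h-p g≋h {M} L≋0))
      , newAverage-correct (prime⇒2≤ pp) (norm≤1 adm) c-inv {g} {h} g-p h-p g≋h {M} avg

  nonZeroAverage : ∀ ps {g} → PrimeMultiplicative g → (∀ p → Prime p → Admissible (g p)) →
    (∀ p → Prime p → ¬ p ∈ ps → g p ≋ 1ℂ) → ∃ λ L → ¬ ‖ L ‖ℂ≤ 0ℚ × HasAverage g L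
  nonZeroAverage [] mult _ g≋1 = 1ℂ , 1≋̸0 , average-1 (all-primes-1 mult λ p pp → g≋1 p pp λ ())
  nonZeroAverage (p ∷ ps) {g} mult adm g≋1 with prime? p
  ... | no ¬pp = nonZeroAverage ps mult adm λ q pq q∉ps → g≋1 q pq λ
    { (here refl) → ¬pp pq ; (there q∈ps) → q∉ps q∈ps }
  ... | yes pp = nonZeroAverage-step pp mult (adm p pp)
      (nonZeroAverage ps (remove-prime pp mult) admissible h≋1)
    where
    at-p : g (core pp p) ≋ 1ℂ
    at-p = ≋-trans (≋-reflexive g (core-p pp)) (g-1 mult)
    at-q : ∀ {q} → Prime q → q ≢ p → core pp q ≡ q
    at-q {q} pq q≢p = core-coprime pp q {{prime⇒nonZero pq}} λ p∣q → q≢p (sym (prime-∣-prime pp pq p∣q))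
    admissible : ∀ q → Prime q → Admissible (g (core pp q))
    admissible q pq with q ℕ.≟ p
    ... | yes refl = root-admissible 1 (≋-trans (^ℂ-cong at-p 1) (1^ℂ 1))
    ... | no q≢p   = subst (λ n → Admissible (g n)) (sym (at-q pq q≢p)) (adm q pq)
    h≋1 : ∀ q → Prime q → ¬ q ∈ ps → g (core pp q) ≋ 1ℂ
    h≋1 q pq q∉ps with q ℕ.≟ p
    ... | yes refl = at-p
    ... | no q≢p   = ≋-trans (≋-reflexive g (at-q pq q≢p)) (g≋1 q pq λ
      { (here q≡p) → q≢p q≡p ; (there q∈ps) → q∉ps q∈ps })

  mean-unique : ∀ {g L M} → HasMean g L → HasMean g M → L ≋ M
  mean-unique {g} {L} {M} p r = Lim-unique {u} {L} {M} (⟶⇒Lim {u} {L} p) (⟶⇒Lim {u} {M} r)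
    where
    u : ℕ → ℂ
    u n = 1/ℂ suc n *ℂ ∑₁ (suc n) g

  multiple-^ℂ : ∀ {z} m {n} → m ∣ n → z ^ℂ m ≋ 1ℂ → z ^ℂ n ≋ 1ℂ
  multiple-^ℂ {z} m (divides a n≡) e = ≋-trans (≋-reflexive (z ^ℂ_) (trans n≡ (ℕ.*-comm a m)))
    (≋-trans (^ℂ-* z m a) (≋-trans (^ℂ-cong e a) (1^ℂ a)))

  root-^ℂ : ∀ {z} m n → z ^ℂ m ≋ 1ℂ → (z ^ℂ n) ^ℂ m ≋ 1ℂ
  root-^ℂ {z} m n e = ≋-trans (≋-sym (^ℂ-* z n m)) (multiple-^ℂ m (n∣m*n n) e)

  zero-^ℂ : ∀ {z} n .{{_ : NonZero n}} → ‖ z ‖ℂ≤ 0ℚ → ‖ z ^ℂ n ‖ℂ≤ 0ℚ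
  zero-^ℂ {z} (suc n) z≋0 = ‖‖ℂ-cong {z ^ℂ n *ℂ z} (λ j → Gℚ.*-comm (at (z ^ℂ n) j) (at z j)) (‖‖ℂ-*-zero (z ^ℂ n) z≋0)

module _ {q : ℕ} (q-prime : Prime q) {ψ : ℕ → ℂ} (isPsi : IsPsi q q-prime ψ) (k : ℕ) where

  private
    g : ℕ → ℂ
    g m = ψ m ^ℂ k

  opaque

    power-multiplicative : PrimeMultiplicative g
    power-multiplicative = record
      { g-1 = ≋-trans (^ℂ-cong (≈⇒≋ (proj₁ (proj₁ isPsi))) k) (1^ℂ k)
      ; g-prime = λ p pp m → ≋-trans
          (^ℂ-cong (≈⇒≋ (proj₂ (proj₁ isPsi) p m {{prime⇒nonZero pp}})) k) (^ℂ-distrib-* (ψ p) (ψ m) k)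
      }

    power-root : ∀ p (pp : Prime p) → p ≢ q → ψ p ^ℂ t q p ≋ 1ℂ
    power-root p pp p≢q = isExp⇒rootOfUnity (t q p) {{t-nonZero q-prime pp p≢q}} (proj₁ (proj₂ isPsi) p pp p≢q)

    power-1 : ∀ p (pp : Prime p) → p ≢ q → t q p ∣ k → g p ≋ 1ℂ
    power-1 p pp p≢q t∣k = multiple-^ℂ (t q p) t∣k (power-root p pp p≢q)

    power-admissible : .{{_ : NonZero k}} → ∀ p → Prime p → Admissible (g p)
    power-admissible p pp = go (p ℕ.≟ q)
      where
      ψq≋0 : ‖ ψ q ‖ℂ≤ 0ℚ
      ψq≋0 = ‖‖ℂ-≋ {0ℂ} {ψ q} (≋-sym {ψ q} {0ℂ} (≈⇒≋ (proj₂ (proj₂ isPsi)))) (‖‖ℂ-ofℚ ℚ.≤-refl)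
      go : Dec (p ≡ q) → Admissible (g p)
      go (yes p≡q) = subst (λ n → Admissible (g n)) (sym p≡q) (zero-admissible (zero-^ℂ k ψq≋0))
      go (no p≢q)  = root-admissible (t q p) {{t-nonZero q-prime pp p≢q}} (root-^ℂ (t q p) k (power-root p pp p≢q))

    power-nonZeroMean : .{{_ : NonZero k}} → (∃ λ ps → ∀ {p} → S q k p → p ∈ ps) → ∃ λ L → ¬ ‖ L ‖ℂ≤ 0ℚ × HasMean g L
    power-nonZeroMean (ps , S⊆ps) = go (nonZeroAverage (q ∷ ps) power-multiplicative power-admissible trivial)
      where
      trivial : ∀ p → Prime p → ¬ p ∈ q ∷ ps → g p ≋ 1ℂ
      trivial p pp p∉ = case (t q p ∣? k)
        where
        case : Dec (t q p ∣ k) → g p ≋ 1ℂ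
        case (yes t∣k) = power-1 p pp (λ p≡q → p∉ (here p≡q)) t∣k
        case (no  t∤k) = contradiction (there (S⊆ps (pp , (λ p≡q → p∉ (here p≡q)) , t∤k))) p∉
      go : (∃ λ L → ¬ ‖ L ‖ℂ≤ 0ℚ × HasAverage g L) → ∃ λ L → ¬ ‖ L ‖ℂ≤ 0ℚ × HasMean g L
      go (L , L≉0 , avg) = L , L≉0 , average⇒mean avg

theorem3 : ∀ (q : ℕ) (q-prime : Prime q) (ψ : ℕ → ℂ) → IsPsi q q-prime ψ →
    ∀ (k : ℕ) .{{_ : NonZero k}} →
    (¬ (∃ λ L → HasMean (λ m → ψ m ^ℂ k) L)) ⊎ HasMean (λ m → ψ m ^ℂ k) 0ℂ →
    Infinite (S q k)
theorem3 q q-prime ψ isPsi k noMean finite = go noMean (power-nonZeroMean q-prime isPsi k finite)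
  where
  go : (¬ (∃ λ L → HasMean (λ m → ψ m ^ℂ k) L)) ⊎ HasMean (λ m → ψ m ^ℂ k) 0ℂ →
    (∃ λ L → ¬ ‖ L ‖ℂ≤ 0ℚ × HasMean (λ m → ψ m ^ℂ k) L) → ⊥
  go (inj₁ none)  (L , _ , mean)   = none (L , mean)
  go (inj₂ mean0) (L , L≉0 , mean) = L≉0 (‖‖ℂ-≋ (mean-unique {λ m → ψ m ^ℂ k} mean0 mean) (‖‖ℂ-ofℚ ℚ.≤-refl))
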